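{- Let $p$ be a prime, let $k,\ell$ be positive integers, and write $q:=p^k$ and $Q:=p^\ell$. Let $r$ be a positive integer such that $r\equiv Q+1\pmod{q+1}$. Let $a,b,c,d\in\mathbb{F}_{q^2}$ and write $A(X):=aX^{Q+1}+bX^Q+cX+d$. Then the polynomial $X^rA(X^{q-1})=aX^{r+qQ+q-Q-1}+bX^{r+qQ-Q}+cX^{r+q-1}+dX^r$ permutes $\mathbb{F}_{q^2}$ if and only if all of the following hold: (1) $\gcd(r,q-1)=1$; (2) $p=2$; (3) $e:=a^{q+1}+b^{q+1}+c^{q+1}+d^{q+1}$ is nonzero; (4) $(ab^q+cd^q)^Q=e^{Q-1}(ac^q+bd^q)$; (5) writing $m$ for the largest integer of the form $2^i$ (with $i\ge 0$) which divides $\gcd(k,\ell)$, we have $$\mathrm{Tr}_{\mathbb{F}_q/\mathbb{F}_{2^m}}\Bigl(\frac{b^{q+1}+c^{q+1}}{e}\Bigr)=\frac{\mathrm{lcm}(k,\ell)}{m}.$$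
   Context: A polynomial $f(X)\in\mathbb{F}_{q^2}[X]$ permutes $\mathbb{F}_{q^2}$ if $\alpha\mapsto f(\alpha)$ is a bijection of $\mathbb{F}_{q^2}$. When $p=2$, note that $e$ and $b^{q+1}+c^{q+1}$ lie in $\mathbb{F}_q$; $\mathrm{Tr}_{\mathbb{F}_q/\mathbb{F}_{2^m}}(X)=X+X^{2^m}+X^{2^{2m}}+\dots+X^{q/2^m}$ is the trace, and the integer $\mathrm{lcm}(k,\ell)/m$ in (5) is viewed as an element of $\mathbb{F}_2\subseteq\mathbb{F}_{2^m}$ (i.e. reduced mod $2$). -}

module Defs where

open import Algebra.Apartness.Bundles using (HeytingCommutativeRing; HeytingField)
open import Algebra.Bundles using (CommutativeRing; RawSemiring; Semiring)
open import Data.Fin.Base using (Fin; toℕ)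
open import Data.List.Base using (List; []; _∷_; _++_; map; replicate)
open import Data.Nat.Base as ℕ using (ℕ; NonZero)
open import Data.Nat.DivMod as ℕ using (_/_)
open import Data.Nat.Divisibility as ℕ using (_∣_)
open import Data.Product.Base using (∃; proj₁)
open import Function.Bundles using (Inverse)
open import Function.Definitions using (Bijective)
open import Level using (Level; _⊔_)
open import Relation.Binary.PropositionalEquality using (_≡_; setoid)

import Algebra.Definitions.RawSemiring as RawSemiringDefinitions

infix 4 _≡_[mod_]

_≡_[mod_] : ℕ → ℕ → ℕ → Set
a ≡ b [mod n ] = n ∣ ℕ.∣ a - b ∣

record IsLargestPowerOfTwoDividing (n m : ℕ) : Set where
  field
    isPowerOfTwo : ∃ λ i → m ≡ 2 ℕ.^ i
    divides      : m ∣ n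
    largest      : ∀ j → 2 ℕ.^ j ∣ n → 2 ℕ.^ j ℕ.≤ m

-- A polynomial is its list of coefficients, constant term first. Trailing
-- zeros are allowed, so different lists can represent the same polynomial.
module Polynomial {c ℓ : Level} (R : RawSemiring c ℓ) where

  open RawSemiring R

  infixl 7 _*ᴾ_
  infixl 6 _+ᴾ_
  infixr 9 _∘ᴾ_

  Poly : Set c
  Poly = List Carrier

  eval : Poly → Carrier → Carrier
  eval []      x = 0#
  eval (a ∷ f) x = a + x * eval f x

  monomial : Carrier → ℕ → Poly
  monomial a n = replicate n 0# ++ (a ∷ [])

  X^_ : ℕ → Poly
  X^ n = monomial 1# n

  _+ᴾ_ : Poly → Poly → Poly
  []      +ᴾ g       = g
  (a ∷ f) +ᴾ []      = a ∷ f
  (a ∷ f) +ᴾ (b ∷ g) = (a + b) ∷ (f +ᴾ g)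

  _*ᴾ_ : Poly → Poly → Poly
  []      *ᴾ g = []
  (a ∷ f) *ᴾ g = map (a *_) g +ᴾ (0# ∷ (f *ᴾ g))

  _∘ᴾ_ : Poly → Poly → Poly
  []      ∘ᴾ g = []
  (a ∷ f) ∘ᴾ g = (a ∷ []) +ᴾ g *ᴾ (f ∘ᴾ g)

  Permutes : Poly → Set (c ⊔ ℓ)
  Permutes f = Bijective _≈_ _≈_ (eval f)

-- The apartness # is invertibility of the difference. On a carrier in
-- bijection with some Fin n, equality is decidable and an inverse can be
-- searched for, so there x # y holds exactly when x ≈ y fails.
module Field {c ℓ₁ ℓ₂ : Level} (F : HeytingField c ℓ₁ ℓ₂) where

  open HeytingField F public
    using (Carrier; _≈_; _#_; _+_; _*_; 0#; 1#; #⇒invertible)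

  private
    module R = CommutativeRing
      (HeytingCommutativeRing.commutativeRing (HeytingField.heytingCommutativeRing F))

  open RawSemiringDefinitions (Semiring.rawSemiring R.semiring) public
    using (_^_; sum) renaming (_×_ to _·_)

  open Polynomial (Semiring.rawSemiring R.semiring) public

  HasOrder : ℕ → Set (c ⊔ ℓ₁)
  HasOrder n = Inverse R.setoid (setoid (Fin n))

  infixl 7 _÷_[_]

  -- #⇒invertible inverts y - 0#, which equals y.
  _÷_[_] : Carrier → (y : Carrier) → y # 0# → Carrier
  x ÷ y [ y#0 ] = x * proj₁ (#⇒invertible y#0)

  -- The trace from the field of order pᵏ to the field of order pᵐ, where m
  -- divides k, both taken inside F: its terms are x, x^(pᵐ), x^(p²ᵐ), …,
  -- x^(pᵏ⁻ᵐ).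
  Tr : (p k m : ℕ) .{{_ : NonZero m}} → Carrier → Carrier
  Tr p k m x = sum {n = k ℕ./ m} λ i → x ^ (p ℕ.^ (m ℕ.* toℕ i))

{-# OPTIONS --safe #-}
module Submission where

-- On the field of q² elements write x̄ = x^q and [x , y] = x ȳ + x̄ y. For p odd, r and q - 1 are
-- both even, so (1) forces p = 2. Up to the norm factor N(x)^s, X^r A(X^{q-1}) is the map
-- B(x) = a x̄^{Q+1} + b x̄^Q x + c x̄ x^Q + d x^{Q+1}, so given (1) it permutes the field if and
-- only if [B x , B y] ≠ 0 whenever [x , y] ≠ 0. This form in x and y depends only on
-- N a + N d, N b + N c, P = a b̄ + c d̄ and R = a c̄ + b d̄. Restricting it to lines y + 𝔽_q x shows
-- that the quadratic forms e N x + P̄ x² + P x̄² and (e N z + R̄ z² + R z̄²) ∘ (z = x^Q) have the same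
-- zeros; hence e ≠ 0, and (4) if there are zeros. If there are none, a root of the determinant of
-- the pencil B + Y B̄ gives B + Y B̄ = L^Q (s L + t L̄) with L linear; as B permutes, the sum of the
-- (q-1)-st powers of this form is 0, but it is a nonzero multiple of s^i t^{q-1-i} for a single
-- i, so s t = 0, which is (4) again. Once (3) and (4) hold, the form is
-- e [x , y]^{Q+1} (h^Q + h + u + 1), where u = (N b + N c) / e and h runs over all solutions
-- of h + h̄ = 1. Additive Hilbert 90 turns the unsolvability of h^Q + h = u + 1 into (5).

open import Defs
open import Algebra.Apartness.Bundles using (HeytingField; HeytingCommutativeRing)
open import Algebra.Bundles using (CommutativeMonoid; CommutativeRing; RawRing; Semiring)
open import Algebra.Morphism.Structures using (IsRingMonomorphism)
import Algebra.Morphism.RingMonomorphism as RingMonomorphism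
open import Algebra.Structures using (IsCommutativeRing)
open import Data.Bool.Base using (Bool; true; false; not; _∧_; if_then_else_)
open import Data.Empty using (⊥)
open import Data.Fin.Base as Fin using (Fin; zero; suc; punchIn; inject≤; toℕ; fromℕ<)
open import Data.Fin.Permutation using (Permutation′; permutation)
import Data.Fin.Properties as Fin
open import Data.List.Base using (List; []; _∷_; _++_; map; foldr)
open import Data.Nat.Base as ℕ using (ℕ; zero; suc; s≤s; z≤n; NonZero; _∸_)
open import Data.Nat.DivMod as ℕ using (_/_)
open import Data.Nat.Divisibility as ℕ using (_∣_)
open import Data.Nat.GCD using (gcd; gcd[m,n]∣m; gcd[m,n]∣n)
open import Data.Nat.LCM using (lcm)
open import Data.Nat.Primality using (Prime; prime⇒nonTrivial; prime⇒nonZero)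
import Data.Nat.Properties as ℕ
open import Data.Product.Base using (∃; _×_; _,_; proj₁; proj₂; Σ-syntax; ∃-syntax)
open import Data.Sum.Base as Sum using (_⊎_; inj₁; inj₂; [_,_]′)
open import Data.Vec.Base as Vec using (Vec; []; _∷_; lookup; allFin)
open import Data.Vec.N-ary using (N-ary; curryⁿ; Eq; curryⁿ-cong; _$ⁿ_)
open import Function.Base using (_∘_; id)
open import Function.Bundles using (Inverse; _⇔_; mk⇔)
open import Level using (Level; 0ℓ)
open import Relation.Binary.Definitions using (DecidableEquality)
open import Relation.Binary.PropositionalEquality
  using (_≡_; _≢_; refl; sym; trans; cong; cong₂; subst; subst₂; module ≡-Reasoning)
open import Relation.Nullary using (¬_; Dec; yes; no; contradiction)
open import Relation.Nullary.Decidable using (decidable-stable; ¬?)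

-- For y ≠ 0 the value [x , y] vanishes exactly when x lies on the line 𝔽_q y, and the map
-- multiplies by l^r along such a line. Given (1), permuting the field therefore means permuting
-- these lines, and the form records just that. The obstacle is (4). Where the quadratic forms have
-- zeros, the zeros can be compared point by point; anisotropic forms offer nothing to compare, so a
-- sum over the whole field has to replace them. The split is on the norm of the root Y: N Y = 1
-- produces a zero, while for N Y ≠ 1 the map y ↦ y + Y ȳ is bijective and may be composed with the
-- permutation before summing. The right-hand side of (5) is a parity. With κ = k/m and λ = ℓ/m
-- modulo 2, the trace of u is κ + λ if h exists and κ λ if not. These differ because the maximality
-- of m keeps k/m and ℓ/m from both being even, and lcm(k, ℓ)/m has the parity of κ λ. Polynomial
-- identities are decided by normal forms in which bar and σ are commuting ring endomorphisms; the
-- hypothesis that an element is fixed by bar is absorbed by writing it as s + s̄.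

record DiscreteField (A : Set) : Set where
  infix  8 -_
  infixl 7 _*_
  infixl 6 _+_
  infix  4 _≟_
  field
    _+_ _*_           : A → A → A
    -_                : A → A
    0# 1#             : A
    isCommutativeRing : IsCommutativeRing _≡_ _+_ _*_ -_ 0# 1#
    _≟_               : DecidableEquality A
    1≢0               : 1# ≢ 0#
    inverse           : ∀ {x} → x ≢ 0# → ∃ λ y → x * y ≡ 1#

-- Cancellation, powers and roots of monic polynomials over a field.

module FieldProperties {A : Set} (K : DiscreteField A) where

  open DiscreteField K public

  commutativeRing : CommutativeRing 0ℓ 0ℓ
  commutativeRing = record { isCommutativeRing = isCommutativeRing }

  open CommutativeRing commutativeRing public
    using ( +-identityˡ; +-identityʳ; *-identityˡ; *-identityʳ; zeroˡ; zeroʳ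
          ; +-assoc; +-comm; *-assoc; *-comm; distribˡ; distribʳ; -‿inverseʳ
          ; -‿inverseˡ; ring; semiring; commutativeSemiring; +-group
          ; *-commutativeMonoid; +-commutativeMonoid; +-monoid )
  open import Algebra.Properties.CommutativeSemiring.Exp commutativeSemiring public
    using (_^_; ^-homo-*; ^-assocʳ; ^-distrib-*)
  open import Algebra.Properties.Group +-group using (∙-cancelʳ)
  open import Algebra.Properties.Ring ring using (-‿distribˡ-*)
  open ≡-Reasoning

  _⁻¹[_] : ∀ x → x ≢ 0# → A
  _ ⁻¹[ x≢0 ] = proj₁ (inverse x≢0)

  *-inverseʳ : ∀ {x} (x≢0 : x ≢ 0#) → x * x ⁻¹[ x≢0 ] ≡ 1#
  *-inverseʳ x≢0 = proj₂ (inverse x≢0)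

  *-inverseˡ : ∀ {x} (x≢0 : x ≢ 0#) → x ⁻¹[ x≢0 ] * x ≡ 1#
  *-inverseˡ x≢0 = trans (*-comm _ _) (*-inverseʳ x≢0)

  *-cancelˡ : ∀ {x} → x ≢ 0# → ∀ {y z} → x * y ≡ x * z → y ≡ z
  *-cancelˡ {x} x≢0 {y} {z} xy≡xz = begin
    y  ≡⟨ *-identityˡ y ⟨
    1# * y  ≡⟨ cong (_* y) (*-inverseˡ x≢0) ⟨
    x ⁻¹[ x≢0 ] * x * y ≡⟨ *-assoc _ _ _ ⟩
    x ⁻¹[ x≢0 ] * (x * y) ≡⟨ cong (_ *_) xy≡xz ⟩
    x ⁻¹[ x≢0 ] * (x * z) ≡⟨ *-assoc _ _ _ ⟨
    x ⁻¹[ x≢0 ] * x * z ≡⟨ cong (_* z) (*-inverseˡ x≢0) ⟩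
    1# * z  ≡⟨ *-identityˡ z ⟩
    z  ∎

  *-cancelʳ : ∀ {x} → x ≢ 0# → ∀ {y z} → y * x ≡ z * x → y ≡ z
  *-cancelʳ x≢0 eq = *-cancelˡ x≢0 (trans (*-comm _ _) (trans eq (*-comm _ _)))

  x*y≡0⇒y≡0 : ∀ {x y} → x ≢ 0# → x * y ≡ 0# → y ≡ 0#
  x*y≡0⇒y≡0 x≢0 xy≡0 = *-cancelˡ x≢0 (trans xy≡0 (sym (zeroʳ _)))

  x*y≢0 : ∀ {x y} → x ≢ 0# → y ≢ 0# → x * y ≢ 0#
  x*y≢0 x≢0 y≢0 xy≡0 = y≢0 (x*y≡0⇒y≡0 x≢0 xy≡0)

  ^-≢0 : ∀ {x} n → x ≢ 0# → x ^ n ≢ 0#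
  ^-≢0 zero    x≢0 = 1≢0
  ^-≢0 (suc n) x≢0 = x*y≢0 x≢0 (^-≢0 n x≢0)

  0^suc : ∀ n → 0# ^ suc n ≡ 0#
  0^suc n = zeroˡ _

  0^>0 : ∀ {n} → n ℕ.> 0 → 0# ^ n ≡ 0#
  0^>0 {suc n} _ = 0^suc n

  1^ : ∀ n → 1# ^ n ≡ 1#
  1^ zero    = refl
  1^ (suc n) = trans (*-identityˡ _) (1^ n)

  ^-zero⇒zero : ∀ {x} n → x ^ n ≡ 0# → x ≡ 0#
  ^-zero⇒zero {x} n xⁿ≡0 with x ≟ 0#
  ... | yes x≡0 = x≡0
  ... | no  x≢0 = contradiction xⁿ≡0 (^-≢0 n x≢0)

  -- The polynomial X^d + c_{d-1} X^{d-1} + … + c_0.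
  evalMonic : ∀ {d} → Vec A d → A → A
  evalMonic []       x = 1#
  evalMonic (c ∷ cs) x = c + x * evalMonic cs x

  monic-divide : ∀ {d} (cs : Vec A (suc d)) a → evalMonic cs a ≡ 0# →
                 Σ[ ds ∈ Vec A d ] ∀ x → evalMonic cs x ≡ (x + - a) * evalMonic ds x
  monic-divide cs a root = proj₁ (divide cs) , λ x → begin
    evalMonic cs x  ≡⟨ +-identityʳ _ ⟨
    evalMonic cs x + 0#  ≡⟨ cong (evalMonic cs x +_) (trans (cong -_ root) -0≡0) ⟨
    evalMonic cs x + - evalMonic cs a  ≡⟨ proj₂ (divide cs) x ⟩
    (x + - a) * evalMonic (proj₁ (divide cs)) x           ∎
    where
    open import Algebra.Properties.Group +-group using () renaming (ε⁻¹≈ε to -0≡0)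
    open import Algebra.Properties.CommutativeSemigroup
      (CommutativeRing.+-commutativeSemigroup commutativeRing) using (interchange)
    open import Algebra.Properties.CommutativeSemigroup
      (CommutativeRing.*-commutativeSemigroup commutativeRing) using (x∙yz≈y∙xz)
    open import Algebra.Properties.AbelianGroup (CommutativeRing.+-abelianGroup commutativeRing)
      using (⁻¹-∙-comm)

    telescope : ∀ x u v → x * u + - (a * v) ≡ (x + - a) * v + x * (u + - v)
    telescope x u v = sym (begin
      (x + - a) * v + x * (u + - v)  ≡⟨ cong₂ _+_ (distribʳ v x (- a)) (distribˡ x u (- v)) ⟩
      x * v + - a * v + (x * u + x * - v)        ≡⟨ cong (_+ (x * u + x * - v)) (+-comm _ _) ⟩
      - a * v + x * v + (x * u + x * - v)        ≡⟨ cong (- a * v + x * v +_) (+-comm _ _) ⟩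
      - a * v + x * v + (x * - v + x * u)        ≡⟨ +-assoc _ _ _ ⟩
      - a * v + (x * v + (x * - v + x * u))      ≡⟨ cong (- a * v +_) (+-assoc _ _ _) ⟨
      - a * v + (x * v + x * - v + x * u)        ≡⟨ cong (λ t → - a * v + (t + x * u)) (distribˡ x v (- v)) ⟨
      - a * v + (x * (v + - v) + x * u)  ≡⟨ cong (λ t → - a * v + (x * t + x * u)) (-‿inverseʳ v) ⟩
      - a * v + (x * 0# + x * u)  ≡⟨ cong (λ t → - a * v + (t + x * u)) (zeroʳ x) ⟩
      - a * v + (0# + x * u)  ≡⟨ cong (- a * v +_) (+-identityˡ _) ⟩
      - a * v + x * u  ≡⟨ +-comm _ _ ⟩
      x * u + - a * v  ≡⟨ cong (x * u +_) (-‿distribˡ-* a v) ⟨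
      x * u + - (a * v)  ∎)

    cancel-head : ∀ c s t → c + s + - (c + t) ≡ s + - t
    cancel-head c s t = begin
      c + s + - (c + t)     ≡⟨ cong (c + s +_) (⁻¹-∙-comm c t) ⟨
      c + s + (- c + - t)   ≡⟨ interchange c s (- c) (- t) ⟩
      c + - c + (s + - t)   ≡⟨ cong (_+ (s + - t)) (-‿inverseʳ c) ⟩
      0# + (s + - t)        ≡⟨ +-identityˡ _ ⟩
      s + - t  ∎

    -- Horner's division. Subtracting the value at `a` frees the induction from the assumption that
    -- `a` is a root, which the tails of `cs` do not inherit; the values of the tails at `a` are the
    -- coefficients of the quotient.
    divide : ∀ {d} (cs : Vec A (suc d)) →
             Σ[ ds ∈ Vec A d ] ∀ x → evalMonic cs x + - evalMonic cs a ≡ (x + - a) * evalMonic ds x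
    divide {zero} (c ∷ []) = [] , λ x → begin
      c + x * 1# + - (c + a * 1#)       ≡⟨ cancel-head c _ _ ⟩
      x * 1# + - (a * 1#)  ≡⟨ telescope x 1# 1# ⟩
      (x + - a) * 1# + x * (1# + - 1#)  ≡⟨ cong (λ t → (x + - a) * 1# + x * t) (-‿inverseʳ 1#) ⟩
      (x + - a) * 1# + x * 0#  ≡⟨ cong ((x + - a) * 1# +_) (zeroʳ x) ⟩
      (x + - a) * 1# + 0#  ≡⟨ +-identityʳ _ ⟩
      (x + - a) * 1#  ∎
    divide {suc d} (c ∷ cs) with divide cs
    ... | ds , quotient = evalMonic cs a ∷ ds , λ x → begin
      c + x * evalMonic cs x + - (c + a * evalMonic cs a)  ≡⟨ cancel-head c _ _ ⟩
      x * evalMonic cs x + - (a * evalMonic cs a)  ≡⟨ telescope x _ _ ⟩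
      (x + - a) * evalMonic cs a + x * (evalMonic cs x + - evalMonic cs a)
        ≡⟨ cong (λ t → (x + - a) * evalMonic cs a + x * t) (quotient x) ⟩
      (x + - a) * evalMonic cs a + x * ((x + - a) * evalMonic ds x)
        ≡⟨ cong ((x + - a) * evalMonic cs a +_) (x∙yz≈y∙xz x _ _) ⟩
      (x + - a) * evalMonic cs a + (x + - a) * (x * evalMonic ds x) ≡⟨ distribˡ _ _ _ ⟨
      (x + - a) * (evalMonic cs a + x * evalMonic ds x)  ∎

  x+-y≡0⇒x≡y : ∀ {x y} → x + - y ≡ 0# → x ≡ y
  x+-y≡0⇒x≡y {x} {y} eq = ∙-cancelʳ (- y) x y (trans eq (sym (-‿inverseʳ y)))

  monic-roots-bounded : ∀ {d} (cs : Vec A d) (points : Fin (suc d) → A) →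
                        (∀ {i j} → points i ≡ points j → i ≡ j) →
                        ¬ (∀ i → evalMonic cs (points i) ≡ 0#)
  monic-roots-bounded {zero}  []  points inj roots = 1≢0 (roots zero)
  monic-roots-bounded {suc d} cs points inj roots
    with monic-divide cs (points zero) (roots zero)
  ... | ds , factor = monic-roots-bounded ds (points ∘ suc) (Fin.suc-injective ∘ inj)
    λ i → x*y≡0⇒y≡0
      (λ eq → contradiction (inj (x+-y≡0⇒x≡y eq)) λ ())
      (trans (sym (factor (points (suc i)))) (roots (suc i)))

-- Finite fields with n units: orders of elements and power sums.

module FiniteFieldProperties {n : ℕ} (K : DiscreteField (Fin (suc n))) where

  open FieldProperties K public
  open import Algebra.Properties.Semiring.Sum semiring public
    using (sum; *-distribˡ-sum; *-distribʳ-sum; sum-cong-≗; ∑-comm; ∑-distrib-+; sum-remove; sum-permute; sum-replicate; sum-replicate-zero)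
  open import Algebra.Properties.Monoid.Mult +-monoid public
    using () renaming (_×_ to _·_)
  import Algebra.Properties.CommutativeMonoid.Sum *-commutativeMonoid as Product
  open import Algebra.Properties.Group +-group using (∙-cancelˡ)
  open ≡-Reasoning

  F : Set
  F = Fin (suc n)

  unit : Fin n → F
  unit = punchIn 0#

  unit≢0 : ∀ i → unit i ≢ 0#
  unit≢0 i = Fin.punchInᵢ≢i 0# i

  n>0 : n ℕ.> 0
  n>0 = ℕ.n≢0⇒n>0 λ { refl → 1≢0 (Fin1 1# 0#) }
    where
    Fin1 : ∀ (x y : Fin 1) → x ≡ y
    Fin1 zero zero = refl

  *-permutation : ∀ {y} → y ≢ 0# → Permutation′ (suc n)
  *-permutation {y} y≢0 = permutation (y *_) (y ⁻¹[ y≢0 ] *_)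
    (λ x → trans (sym (*-assoc _ _ _)) (trans (cong (_* x) (*-inverseʳ y≢0)) (*-identityˡ x)))
    (λ x → trans (sym (*-assoc _ _ _)) (trans (cong (_* x) (*-inverseˡ y≢0)) (*-identityˡ x)))

  -- Multiplication by `x` permutes the units, so their product absorbs the factor `x ^ n`. The
  -- product runs over the whole field, with `units` and `scale` taking the value 1 at 0, so that
  -- the permutation acts on the full index set.
  x^n≡1 : ∀ {x} → x ≢ 0# → x ^ n ≡ 1#
  x^n≡1 {x} x≢0 = *-cancelʳ ∏≢0 (begin
    x ^ n * ∏  ≡⟨ cong (_* ∏) ∏scale ⟨
    Product.sum scale * ∏  ≡⟨ Product.∑-distrib-+ scale units ⟨
    Product.sum (λ y → scale y * units y)    ≡⟨ Product.sum-cong-≗ (sym ∘ units-* ) ⟩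
    Product.sum (units ∘ (x *_))  ≡⟨ Product.sum-permute units (*-permutation x≢0) ⟨
    ∏  ≡⟨ *-identityˡ ∏ ⟨
    1# * ∏  ∎)
    where
    units scale : F → F
    units y with y ≟ 0#
    ... | yes _ = 1#
    ... | no  _ = y
    scale y with y ≟ 0#
    ... | yes _ = 1#
    ... | no  _ = x
    ∏ = Product.sum units
    product≢0 : ∀ {m} (t : Fin m → F) → (∀ i → t i ≢ 0#) → Product.sum t ≢ 0#
    product≢0 {zero}  t t≢0 = 1≢0
    product≢0 {suc m} t t≢0 = x*y≢0 (t≢0 zero) (product≢0 (t ∘ suc) (t≢0 ∘ suc))
    units≢0 : ∀ y → units y ≢ 0#
    units≢0 y with y ≟ 0#
    ... | yes _   = 1≢0
    ... | no  y≢0 = y≢0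
    ∏≢0 : ∏ ≢ 0#
    ∏≢0 = product≢0 units units≢0
    units-* : ∀ y → units (x * y) ≡ scale y * units y
    units-* y with y ≟ 0# | (x * y) ≟ 0#
    ... | yes _    | yes _    = sym (*-identityˡ 1#)
    ... | yes refl | no  xy≢0 = contradiction (zeroʳ x) xy≢0
    ... | no  y≢0  | yes xy≡0 = contradiction xy≡0 (x*y≢0 x≢0 y≢0)
    ... | no  _    | no  _    = refl
    scale-0 : scale 0# ≡ 1#
    scale-0 with 0# ≟ 0#
    ... | yes _   = refl
    ... | no  0≢0 = contradiction refl 0≢0
    scale-unit : ∀ i → scale (unit i) ≡ x
    scale-unit i with unit i ≟ 0#
    ... | yes eq = contradiction eq (unit≢0 i)
    ... | no  _  = refl
    ∏scale : Product.sum scale ≡ x ^ n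
    ∏scale = begin
      Product.sum scale  ≡⟨ Product.sum-remove {i = 0#} scale ⟩
      scale 0# * Product.sum (scale ∘ unit)    ≡⟨ cong₂ _*_ scale-0 (Product.sum-cong-≗ scale-unit) ⟩
      1# * Product.sum {n} (λ _ → x)  ≡⟨ *-identityˡ _ ⟩
      Product.sum {n} (λ _ → x)  ≡⟨ Product.sum-replicate n ⟩
      x ^ n  ∎

  x^[1+n]≡x : ∀ x → x ^ suc n ≡ x
  x^[1+n]≡x x with x ≟ 0#
  ... | yes refl = 0^suc n
  ... | no  x≢0  = trans (cong (x *_) (x^n≡1 x≢0)) (*-identityʳ x)

  x^[jn]≡1 : ∀ {x} j → x ≢ 0# → x ^ (j ℕ.* n) ≡ 1#
  x^[jn]≡1 {x} j x≢0 = begin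
    x ^ (j ℕ.* n)  ≡⟨ cong (x ^_) (ℕ.*-comm j n) ⟩
    x ^ (n ℕ.* j)  ≡⟨ ^-assocʳ x n j ⟨
    (x ^ n) ^ j    ≡⟨ cong (_^ j) (x^n≡1 x≢0) ⟩
    1# ^ j  ≡⟨ 1^ j ⟩
    1#  ∎

  -- Translation by 1 permutes the field, so the sum of all elements absorbs one summand 1 for each
  -- element.
  [1+n]·1≡0 : suc n · 1# ≡ 0#
  [1+n]·1≡0 = ∙-cancelˡ (sum id) _ _ (begin
    sum id + suc n · 1#  ≡⟨ cong (sum id +_) (sum-replicate (suc n)) ⟨
    sum id + sum {suc n} (λ _ → 1#)    ≡⟨ ∑-distrib-+ id (λ _ → 1#) ⟨
    sum (_+ 1#)  ≡⟨ sum-permute id successor ⟨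
    sum id  ≡⟨ +-identityʳ _ ⟨
    sum id + 0#  ∎)
    where
    successor : Permutation′ (suc n)
    successor = permutation (_+ 1#) (_+ - 1#)
      (λ x → trans (+-assoc _ _ _) (trans (cong (x +_) (-‿inverseˡ 1#)) (+-identityʳ x)))
      (λ x → trans (+-assoc _ _ _) (trans (cong (x +_) (-‿inverseʳ 1#)) (+-identityʳ x)))

  injective⇒surjective : ∀ (f : F → F) → (∀ {x y} → f x ≡ f y → x ≡ y) → ∀ y → ∃ λ x → f x ≡ y
  injective⇒surjective f inj y with Fin.any? (λ x → f x Fin.≟ y)
  ... | yes found   = found
  ... | no  missing = contradiction
    (Fin.injective⇒≤ {f = λ x → Fin.punchOut (avoids x)}
      (λ {x} {x′} eq → inj (Fin.punchOut-injective (avoids x) (avoids x′) eq)))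
    ℕ.1+n≰n
    where
    avoids : ∀ x → y ≢ f x
    avoids x y≡fx = missing (x , sym y≡fx)

  sum-reindex : ∀ (g f : F → F) → (∀ {x y} → f x ≡ f y → x ≡ y) → sum (g ∘ f) ≡ sum g
  sum-reindex g f inj = sym (sum-permute g (permutation f (proj₁ ∘ surj) (proj₂ ∘ surj) (λ x → inj (proj₂ (surj (f x))))))
    where surj = injective⇒surjective f inj

  -- The polynomial X^m - 1 has at most m roots, and there are n > m units.
  power-nontrivial : ∀ m → 0 ℕ.< m → m ℕ.< n → ∃ λ y → y ≢ 0# × y ^ m ≢ 1#
  power-nontrivial (suc m) _ 1+m<n with Fin.any? (λ i → ¬? (unit i ^ suc m ≟ 1#))
  ... | yes (i , y^m≢1) = unit i , unit≢0 i , y^m≢1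
  ... | no  all-trivial = contradiction
    (λ i → trans (evaluate (points i)) (trans (cong (λ t → - 1# + t) (trivial i)) (-‿inverseˡ 1#)))
    (monic-roots-bounded (- 1# ∷ zeros m) points
      (λ eq → Fin.inject≤-injective 1+m<n 1+m<n _ _ (Fin.punchIn-injective 0# _ _ eq)))
    where
    zeros : ∀ d → Vec F d
    zeros zero    = []
    zeros (suc d) = 0# ∷ zeros d
    evaluate-zeros : ∀ d x → evalMonic (zeros d) x ≡ x ^ d
    evaluate-zeros zero    x = refl
    evaluate-zeros (suc d) x = trans (+-identityˡ _) (cong (x *_) (evaluate-zeros d x))
    evaluate : ∀ x → evalMonic (- 1# ∷ zeros m) x ≡ - 1# + x ^ suc m
    evaluate x = cong (λ t → - 1# + x * t) (evaluate-zeros m x)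
    points : Fin (suc (suc m)) → F
    points i = unit (inject≤ i 1+m<n)
    trivial : ∀ i → points i ^ suc m ≡ 1#
    trivial i = decidable-stable (_ ≟ _) λ ≢1 → all-trivial (inject≤ i 1+m<n , ≢1)

  -- Replacing x by y x permutes the terms and multiplies the sum by y^m. A unit with y^m ≠ 1 is
  -- found for the remainder m mod n, which lies strictly between 0 and n and determines y^m.
  power-sum-zero : ∀ m → ¬ n ∣ m → sum (_^ m) ≡ 0#
  power-sum-zero m n∤m = decidable-stable (_ ≟ 0#) λ s≢0 → y^m≢1 (*-cancelʳ s≢0 (begin
    y ^ m * sum (_^ m)  ≡⟨ *-distribˡ-sum (y ^ m) (_^ m) ⟩
    sum (λ x → y ^ m * x ^ m)    ≡⟨ sum-cong-≗ (λ x → ^-distrib-* y x m) ⟨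
    sum (λ x → (y * x) ^ m)      ≡⟨ sum-permute (_^ m) (*-permutation y≢0) ⟨
    sum (_^ m)  ≡⟨ *-identityˡ _ ⟨
    1# * sum (_^ m)  ∎))
    where
    instance
      n-nonZero : NonZero n
      n-nonZero = ℕ.>-nonZero n>0
    nontrivial : ∃ λ y → y ≢ 0# × y ^ (m ℕ.% n) ≢ 1#
    nontrivial = power-nontrivial (m ℕ.% n)
      (ℕ.n≢0⇒n>0 (λ eq → n∤m (ℕ.m%n≡0⇒n∣m m n eq))) (ℕ.m%n<n m n)
    y = proj₁ nontrivial
    y≢0 = proj₁ (proj₂ nontrivial)
    y^m≢1 : y ^ m ≢ 1#
    y^m≢1 eq = proj₂ (proj₂ nontrivial) (begin
      y ^ (m ℕ.% n)  ≡⟨ *-identityʳ _ ⟨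
      y ^ (m ℕ.% n) * 1#  ≡⟨ cong (y ^ (m ℕ.% n) *_) (x^[jn]≡1 (m ℕ./ n) y≢0) ⟨
      y ^ (m ℕ.% n) * y ^ (m ℕ./ n ℕ.* n)       ≡⟨ ^-homo-* y (m ℕ.% n) _ ⟨
      y ^ (m ℕ.% n ℕ.+ m ℕ./ n ℕ.* n)  ≡⟨ cong (y ^_) (ℕ.m≡m%n+[m/n]*n m n) ⟨
      y ^ m  ≡⟨ eq ⟩
      1#  ∎)

  -- Every unit contributes 1, so the sum is n · 1 = -1; `m > 0` is what makes the term at 0 vanish.
  power-sum-nonzero : ∀ m → n ∣ m → m ℕ.> 0 → sum (_^ m) ≢ 0#
  power-sum-nonzero m (ℕ.divides j m≡jn) m>0 s≡0 = 1≢0 (begin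
    1#  ≡⟨ +-identityʳ 1# ⟨
    1# + 0#  ≡⟨ cong (1# +_) (trans (sym s≡0) sum≡n·1) ⟩
    suc n · 1#  ≡⟨ [1+n]·1≡0 ⟩
    0#  ∎)
    where
    sum≡n·1 : sum (_^ m) ≡ n · 1#
    sum≡n·1 = begin
      sum (_^ m)  ≡⟨ sum-remove {i = 0#} (_^ m) ⟩
      0# ^ m + sum (λ i → unit i ^ m)   ≡⟨ cong₂ _+_ (0^>0 m>0) (sum-cong-≗ λ i →
                                             trans (cong (unit i ^_) m≡jn) (x^[jn]≡1 j (unit≢0 i))) ⟩
      0# + sum {n} (λ _ → 1#)  ≡⟨ +-identityˡ _ ⟩
      sum {n} (λ _ → 1#)  ≡⟨ sum-replicate n ⟩
      n · 1#  ∎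

-- Fields of characteristic 2 with an involution and a commuting automorphism.

-- In the application A is the field of order q², bar is x ↦ x^q and σ is x ↦ x^Q.
record ConjugationStructure {A : Set} (K : DiscreteField A) : Set where
  open DiscreteField K
  field
    1+1≡0       : 1# + 1# ≡ 0#
    bar σ       : A → A
    bar-+       : ∀ x y → bar (x + y) ≡ bar x + bar y
    bar-*       : ∀ x y → bar (x * y) ≡ bar x * bar y
    bar-bar     : ∀ x → bar (bar x) ≡ x
    σ-+         : ∀ x y → σ (x + y) ≡ σ x + σ y
    σ-*         : ∀ x y → σ (x * y) ≡ σ x * σ y
    bar-σ       : ∀ x → bar (σ x) ≡ σ (bar x)
    bar-1       : bar 1# ≡ 1#
    σ-1         : σ 1# ≡ 1#
    σ-injective : ∀ {x y} → σ x ≡ σ y → x ≡ y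
    σ⁻¹         : A → A
    σ-σ⁻¹       : ∀ x → σ (σ⁻¹ x) ≡ x
    ω           : A
    bar-ω≢ω     : bar ω ≢ ω
    √           : A → A
    √-square    : ∀ x → √ x * √ x ≡ x
    artin-schreier : ∀ {x} → bar x ≡ x → ∃ λ z → z * z + z ≡ x

-- A decision procedure for identities in +, *, `bar` and `σ`.

module ConjugationSolver {A : Set} (K : DiscreteField A) (C : ConjugationStructure K) where

  open FieldProperties K public
  open ConjugationStructure C public
  open ≡-Reasoning

  x+x≡0 : ∀ x → x + x ≡ 0#
  x+x≡0 x = begin
    x + x  ≡⟨ cong₂ _+_ (*-identityʳ x) (*-identityʳ x) ⟨
    x * 1# + x * 1#  ≡⟨ distribˡ x 1# 1# ⟨
    x * (1# + 1#)    ≡⟨ cong (x *_) 1+1≡0 ⟩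
    x * 0#  ≡⟨ zeroʳ x ⟩
    0#  ∎

  x+y≡0⇒x≡y : ∀ {x y} → x + y ≡ 0# → x ≡ y
  x+y≡0⇒x≡y {x} {y} x+y≡0 = begin
    x  ≡⟨ +-identityʳ x ⟨
    x + 0#       ≡⟨ cong (x +_) (x+x≡0 y) ⟨
    x + (y + y)  ≡⟨ +-assoc x y y ⟨
    x + y + y    ≡⟨ cong (_+ y) x+y≡0 ⟩
    0# + y       ≡⟨ +-identityˡ y ⟩
    y  ∎

  x≡y⇒x+y≡0 : ∀ {x y} → x ≡ y → x + y ≡ 0#
  x≡y⇒x+y≡0 {x} refl = x+x≡0 x

  bar-0 : bar 0# ≡ 0#
  bar-0 = trans (cong bar (sym (x+x≡0 0#))) (trans (bar-+ 0# 0#) (x+x≡0 (bar 0#)))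

  σ-0 : σ 0# ≡ 0#
  σ-0 = trans (cong σ (sym (x+x≡0 0#))) (trans (σ-+ 0# 0#) (x+x≡0 (σ 0#)))

  infix  4 _:=_
  infixl 6 _:+_
  infixl 7 _:*_

  data Expr (n : ℕ) : Set where
    var       : Fin n → Expr n
    :0 :1     : Expr n
    _:+_ _:*_ : Expr n → Expr n → Expr n
    :bar :σ   : Expr n → Expr n

  _:=_ : ∀ {n} → Expr n → Expr n → Expr n × Expr n
  _:=_ = _,_

  ⟦_⟧ : ∀ {n} → Expr n → Vec A n → A
  ⟦ var i ⟧    ρ = lookup ρ i
  ⟦ :0 ⟧       ρ = 0#
  ⟦ :1 ⟧       ρ = 1#
  ⟦ e₁ :+ e₂ ⟧ ρ = ⟦ e₁ ⟧ ρ + ⟦ e₂ ⟧ ρ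
  ⟦ e₁ :* e₂ ⟧ ρ = ⟦ e₁ ⟧ ρ * ⟦ e₂ ⟧ ρ
  ⟦ :bar e ⟧   ρ = bar (⟦ e ⟧ ρ)
  ⟦ :σ e ⟧     ρ = σ (⟦ e ⟧ ρ)

  private
    open import Algebra.Properties.CommutativeSemigroup
      (CommutativeMonoid.commutativeSemigroup +-commutativeMonoid) using (x∙yz≈y∙xz)

    -- An atom (i , b , s) stands for σˢ applied to the variable i, conjugated if b.
    Atom Monomial Sum : ℕ → Set
    Atom n     = Fin n × Bool × ℕ
    Monomial n = List (Atom n)
    Sum n      = List (Monomial n)

    data Comparison {X : Set} (x y : X) : Set where
      less greater : Comparison x y
      equal        : x ≡ y → Comparison x y

    compareℕ : ∀ (m n : ℕ) → Comparison m n
    compareℕ m n with m ℕ.≟ n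
    ... | yes m≡n = equal m≡n
    ... | no  _   = if m ℕ.<ᵇ n then less else greater

    compareBool : ∀ (a b : Bool) → Comparison a b
    compareBool false false = equal refl
    compareBool false true  = less
    compareBool true  false = greater
    compareBool true  true  = equal refl

    compare× : ∀ {X Y : Set} → (∀ x x′ → Comparison {X} x x′) → (∀ y y′ → Comparison {Y} y y′) →
               ∀ p p′ → Comparison {X × Y} p p′
    compare× compareX compareY (x , y) (x′ , y′) with compareX x x′
    ... | less       = less
    ... | greater    = greater
    ... | equal refl with compareY y y′
    ...   | less       = less
    ...   | greater    = greater
    ...   | equal refl = equal refl

    compareFin : ∀ {n} (i j : Fin n) → Comparison i j
    compareFin i j with compareℕ (toℕ i) (toℕ j)
    ... | less     = less
    ... | greater  = greater
    ... | equal eq = equal (Fin.toℕ-injective eq)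

    compareAtom : ∀ {n} (x y : Atom n) → Comparison x y
    compareAtom = compare× compareFin (compare× compareBool compareℕ)

    compareMonomial : ∀ {n} (x y : Monomial n) → Comparison x y
    compareMonomial []      []      = equal refl
    compareMonomial []      (_ ∷ _) = less
    compareMonomial (_ ∷ _) []      = greater
    compareMonomial (x ∷ xs) (y ∷ ys) with compareAtom x y
    ... | less       = less
    ... | greater    = greater
    ... | equal refl with compareMonomial xs ys
    ...   | less       = less
    ...   | greater    = greater
    ...   | equal refl = equal refl

    insertAtom : ∀ {n} → Atom n → Monomial n → Monomial n
    insertAtom x []       = x ∷ []
    insertAtom x (y ∷ ys) with compareAtom x y
    ... | greater = y ∷ insertAtom x ys
    ... | _       = x ∷ y ∷ ys

    multiply : ∀ {n} → Sum n → Sum n → Sum n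
    multiply []      q = []
    multiply (x ∷ p) q = map (λ y → foldr insertAtom y x) q ++ multiply p q

    -- The two last arguments collect the occurrences of `:bar` and `:σ` above the current node. As
    -- `bar` is an involution and commutes with `σ`, a parity and a count describe them, and both
    -- can be pushed down to the variables.
    expand : ∀ {n} → Expr n → Bool → ℕ → Sum n
    expand (var i)    b s = ((i , b , s) ∷ []) ∷ []
    expand :0         b s = []
    expand :1         b s = [] ∷ []
    expand (e₁ :+ e₂) b s = expand e₁ b s ++ expand e₂ b s
    expand (e₁ :* e₂) b s = multiply (expand e₁ b s) (expand e₂ b s)
    expand (:bar e)   b s = expand e (not b) s
    expand (:σ e)     b s = expand e b (suc s)

    -- The Bool of a node is the coefficient of its monomial in 𝔽₂.
    data Tree (n : ℕ) : Set where
      leaf : Tree n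
      node : Tree n → Monomial n → Bool → Tree n → Tree n

    toggle : ∀ {n} → Monomial n → Tree n → Tree n
    toggle x leaf           = node leaf x true leaf
    toggle x (node l y c r) with compareMonomial x y
    ... | less    = node (toggle x l) y c r
    ... | greater = node l y c (toggle x r)
    ... | equal _ = node l y (not c) r

    vanishes : ∀ {n} → Tree n → Bool
    vanishes leaf           = true
    vanishes (node l _ c r) = not c ∧ vanishes l ∧ vanishes r

    σ^ : ℕ → A → A
    σ^ zero    x = x
    σ^ (suc s) x = σ^ s (σ x)

    bar^ : Bool → A → A
    bar^ false x = x
    bar^ true  x = bar x

    twist : Bool → ℕ → A → A
    twist b s x = σ^ s (bar^ b x)

    twist-homo : ∀ (_∙_ : A → A → A) → (∀ x y → bar (x ∙ y) ≡ bar x ∙ bar y) →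
                 (∀ x y → σ (x ∙ y) ≡ σ x ∙ σ y) →
                 ∀ b s x y → twist b s (x ∙ y) ≡ twist b s x ∙ twist b s y
    twist-homo _∙_ bar-homo σ-homo b s x y = trans (cong (σ^ s) (bar^-homo b)) (σ^-homo s _ _)
      where
      bar^-homo : ∀ b → bar^ b (x ∙ y) ≡ bar^ b x ∙ bar^ b y
      bar^-homo false = refl
      bar^-homo true  = bar-homo x y
      σ^-homo : ∀ s x y → σ^ s (x ∙ y) ≡ σ^ s x ∙ σ^ s y
      σ^-homo zero    x y = refl
      σ^-homo (suc s) x y = trans (cong (σ^ s) (σ-homo x y)) (σ^-homo s _ _)

    twist-fixed : ∀ {x} → bar x ≡ x → σ x ≡ x → ∀ b s → twist b s x ≡ x
    twist-fixed {x} bar-x σ-x b s = trans (cong (σ^ s) (bar^-x b)) (σ^-x s)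
      where
      bar^-x : ∀ b → bar^ b x ≡ x
      bar^-x false = refl
      bar^-x true  = bar-x
      σ^-x : ∀ s → σ^ s x ≡ x
      σ^-x zero    = refl
      σ^-x (suc s) = trans (cong (σ^ s) σ-x) (σ^-x s)

    twist-bar : ∀ b s x → twist (not b) s x ≡ twist b s (bar x)
    twist-bar false s x = refl
    twist-bar true  s x = cong (σ^ s) (sym (bar-bar x))

    twist-σ : ∀ b s x → twist b (suc s) x ≡ twist b s (σ x)
    twist-σ false s x = refl
    twist-σ true  s x = cong (σ^ s) (sym (bar-σ x))

    module _ {n} (ρ : Vec A n) where

      ⟦_⟧ᵃ : Atom n → A
      ⟦ i , b , s ⟧ᵃ = twist b s (lookup ρ i)

      ⟦_⟧ᵐ : Monomial n → A
      ⟦_⟧ᵐ = foldr (λ x → ⟦ x ⟧ᵃ *_) 1#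

      ⟦_⟧ˢ : Sum n → A
      ⟦_⟧ˢ = foldr (λ x → ⟦ x ⟧ᵐ +_) 0#

      ⟦_⟧ᵗ : Tree n → A
      ⟦ leaf ⟧ᵗ         = 0#
      ⟦ node l x c r ⟧ᵗ = (if c then ⟦ x ⟧ᵐ else 0#) + (⟦ l ⟧ᵗ + ⟦ r ⟧ᵗ)

      insertAtom-correct : ∀ x m → ⟦ insertAtom x m ⟧ᵐ ≡ ⟦ x ⟧ᵃ * ⟦ m ⟧ᵐ
      insertAtom-correct x []       = refl
      insertAtom-correct x (y ∷ ys) with compareAtom x y
      ... | less    = refl
      ... | equal _ = refl
      ... | greater = begin
        ⟦ y ⟧ᵃ * ⟦ insertAtom x ys ⟧ᵐ     ≡⟨ cong (⟦ y ⟧ᵃ *_) (insertAtom-correct x ys) ⟩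
        ⟦ y ⟧ᵃ * (⟦ x ⟧ᵃ * ⟦ ys ⟧ᵐ)       ≡⟨ *-assoc _ _ _ ⟨
        ⟦ y ⟧ᵃ * ⟦ x ⟧ᵃ * ⟦ ys ⟧ᵐ  ≡⟨ cong (_* ⟦ ys ⟧ᵐ) (*-comm _ _) ⟩
        ⟦ x ⟧ᵃ * ⟦ y ⟧ᵃ * ⟦ ys ⟧ᵐ  ≡⟨ *-assoc _ _ _ ⟩
        ⟦ x ⟧ᵃ * (⟦ y ⟧ᵃ * ⟦ ys ⟧ᵐ)       ∎

      merge-correct : ∀ x y → ⟦ foldr insertAtom y x ⟧ᵐ ≡ ⟦ x ⟧ᵐ * ⟦ y ⟧ᵐ
      merge-correct []       y = sym (*-identityˡ _)
      merge-correct (a ∷ x) y = begin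
        ⟦ insertAtom a (foldr insertAtom y x) ⟧ᵐ   ≡⟨ insertAtom-correct a (foldr insertAtom y x) ⟩
        ⟦ a ⟧ᵃ * ⟦ foldr insertAtom y x ⟧ᵐ  ≡⟨ cong (⟦ a ⟧ᵃ *_) (merge-correct x y) ⟩
        ⟦ a ⟧ᵃ * (⟦ x ⟧ᵐ * ⟦ y ⟧ᵐ)  ≡⟨ *-assoc _ _ _ ⟨
        ⟦ a ⟧ᵃ * ⟦ x ⟧ᵐ * ⟦ y ⟧ᵐ  ∎

      ++-correct : ∀ p q → ⟦ p ++ q ⟧ˢ ≡ ⟦ p ⟧ˢ + ⟦ q ⟧ˢ
      ++-correct []      q = sym (+-identityˡ _)
      ++-correct (x ∷ p) q = trans (cong (⟦ x ⟧ᵐ +_) (++-correct p q)) (sym (+-assoc _ _ _))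

      map-correct : ∀ x q → ⟦ map (λ y → foldr insertAtom y x) q ⟧ˢ ≡ ⟦ x ⟧ᵐ * ⟦ q ⟧ˢ
      map-correct x []      = sym (zeroʳ _)
      map-correct x (y ∷ q) =
        trans (cong₂ _+_ (merge-correct x y) (map-correct x q)) (sym (distribˡ _ _ _))

      multiply-correct : ∀ p q → ⟦ multiply p q ⟧ˢ ≡ ⟦ p ⟧ˢ * ⟦ q ⟧ˢ
      multiply-correct []      q = sym (zeroˡ _)
      multiply-correct (x ∷ p) q = begin
        ⟦ map (λ y → foldr insertAtom y x) q ++ multiply p q ⟧ˢ  ≡⟨ ++-correct (map _ q) _ ⟩
        ⟦ map (λ y → foldr insertAtom y x) q ⟧ˢ + ⟦ multiply p q ⟧ˢ
          ≡⟨ cong₂ _+_ (map-correct x q) (multiply-correct p q) ⟩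
        ⟦ x ⟧ᵐ * ⟦ q ⟧ˢ + ⟦ p ⟧ˢ * ⟦ q ⟧ˢ  ≡⟨ distribʳ _ _ _ ⟨
        (⟦ x ⟧ᵐ + ⟦ p ⟧ˢ) * ⟦ q ⟧ˢ  ∎

      expand-correct : ∀ e b s → ⟦ expand e b s ⟧ˢ ≡ twist b s (⟦ e ⟧ ρ)
      expand-correct (var i)    b s = trans (+-identityʳ _) (*-identityʳ _)
      expand-correct :0         b s = sym (twist-fixed bar-0 σ-0 b s)
      expand-correct :1         b s = trans (+-identityʳ 1#) (sym (twist-fixed bar-1 σ-1 b s))
      expand-correct (e₁ :+ e₂) b s = begin
        ⟦ expand e₁ b s ++ expand e₂ b s ⟧ˢ  ≡⟨ ++-correct (expand e₁ b s) _ ⟩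
        ⟦ expand e₁ b s ⟧ˢ + ⟦ expand e₂ b s ⟧ˢ
          ≡⟨ cong₂ _+_ (expand-correct e₁ b s) (expand-correct e₂ b s) ⟩
        twist b s (⟦ e₁ ⟧ ρ) + twist b s (⟦ e₂ ⟧ ρ)   ≡⟨ twist-homo _+_ bar-+ σ-+ b s _ _ ⟨
        twist b s (⟦ e₁ :+ e₂ ⟧ ρ)  ∎
      expand-correct (e₁ :* e₂) b s = begin
        ⟦ multiply (expand e₁ b s) (expand e₂ b s) ⟧ˢ ≡⟨ multiply-correct (expand e₁ b s) _ ⟩
        ⟦ expand e₁ b s ⟧ˢ * ⟦ expand e₂ b s ⟧ˢ
          ≡⟨ cong₂ _*_ (expand-correct e₁ b s) (expand-correct e₂ b s) ⟩
        twist b s (⟦ e₁ ⟧ ρ) * twist b s (⟦ e₂ ⟧ ρ)   ≡⟨ twist-homo _*_ bar-* σ-* b s _ _ ⟨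
        twist b s (⟦ e₁ :* e₂ ⟧ ρ)  ∎
      expand-correct (:bar e)   b s = trans (expand-correct e (not b) s) (twist-bar b s _)
      expand-correct (:σ e)     b s = trans (expand-correct e b (suc s)) (twist-σ b s _)

      toggle-correct : ∀ x t → ⟦ toggle x t ⟧ᵗ ≡ ⟦ x ⟧ᵐ + ⟦ t ⟧ᵗ
      toggle-correct x leaf           = cong (⟦ x ⟧ᵐ +_) (+-identityˡ 0#)
      toggle-correct x (node l y c r) with compareMonomial x y
      ... | less = begin
        z + (⟦ toggle x l ⟧ᵗ + ⟦ r ⟧ᵗ)        ≡⟨ cong (λ u → z + (u + ⟦ r ⟧ᵗ)) (toggle-correct x l) ⟩
        z + (⟦ x ⟧ᵐ + ⟦ l ⟧ᵗ + ⟦ r ⟧ᵗ)        ≡⟨ cong (z +_) (+-assoc _ _ _) ⟩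
        z + (⟦ x ⟧ᵐ + (⟦ l ⟧ᵗ + ⟦ r ⟧ᵗ))      ≡⟨ x∙yz≈y∙xz z _ _ ⟩
        ⟦ x ⟧ᵐ + (z + (⟦ l ⟧ᵗ + ⟦ r ⟧ᵗ))      ∎
        where z = if c then ⟦ y ⟧ᵐ else 0#
      ... | greater = begin
        z + (⟦ l ⟧ᵗ + ⟦ toggle x r ⟧ᵗ)        ≡⟨ cong (λ u → z + (⟦ l ⟧ᵗ + u)) (toggle-correct x r) ⟩
        z + (⟦ l ⟧ᵗ + (⟦ x ⟧ᵐ + ⟦ r ⟧ᵗ))      ≡⟨ cong (z +_) (x∙yz≈y∙xz _ _ _) ⟩
        z + (⟦ x ⟧ᵐ + (⟦ l ⟧ᵗ + ⟦ r ⟧ᵗ))      ≡⟨ x∙yz≈y∙xz z _ _ ⟩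
        ⟦ x ⟧ᵐ + (z + (⟦ l ⟧ᵗ + ⟦ r ⟧ᵗ))      ∎
        where z = if c then ⟦ y ⟧ᵐ else 0#
      ... | equal refl = trans (cong (_+ (⟦ l ⟧ᵗ + ⟦ r ⟧ᵗ)) (flip c)) (+-assoc _ _ _)
        where
        flip : ∀ c → (if not c then ⟦ x ⟧ᵐ else 0#) ≡ ⟦ x ⟧ᵐ + (if c then ⟦ x ⟧ᵐ else 0#)
        flip false = sym (+-identityʳ _)
        flip true  = sym (x+x≡0 _)

      tree-correct : ∀ p → ⟦ foldr toggle leaf p ⟧ᵗ ≡ ⟦ p ⟧ˢ
      tree-correct []      = refl
      tree-correct (x ∷ p) = trans (toggle-correct x (foldr toggle leaf p)) (cong (⟦ x ⟧ᵐ +_) (tree-correct p))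

      vanishes-correct : ∀ t → vanishes t ≡ true → ⟦ t ⟧ᵗ ≡ 0#
      vanishes-correct leaf               _  = refl
      vanishes-correct (node l x false r) eq with vanishes l in eqˡ | vanishes r in eqʳ
      vanishes-correct (node l x false r) refl | true | true =
        trans (+-identityˡ _) (trans (cong₂ _+_ (vanishes-correct l eqˡ) (vanishes-correct r eqʳ)) (+-identityˡ 0#))

  -- In characteristic 2 two expressions agree when their sum is zero, so the monomials of both
  -- sides are toggled into one tree. The hypothesis computes to `refl` when every coefficient has
  -- cancelled.
  solve : ∀ n (f : N-ary n (Expr n) (Expr n × Expr n)) →
          (let (e₁ , e₂) = f $ⁿ Vec.map var (allFin n)) →
          vanishes (foldr toggle leaf (expand (e₁ :+ e₂) false 0)) ≡ true →
          Eq n _≡_ (curryⁿ ⟦ e₁ ⟧) (curryⁿ ⟦ e₂ ⟧)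
  solve n f eq = curryⁿ-cong _≡_ ⟦ e₁ ⟧ ⟦ e₂ ⟧ λ ρ → x+y≡0⇒x≡y (begin
    ⟦ e₁ :+ e₂ ⟧ ρ  ≡⟨ expand-correct ρ (e₁ :+ e₂) false 0 ⟨
    ⟦_⟧ˢ ρ (expand (e₁ :+ e₂) false 0) ≡⟨ tree-correct ρ (expand (e₁ :+ e₂) false 0) ⟨
    ⟦_⟧ᵗ ρ (foldr toggle leaf (expand (e₁ :+ e₂) false 0)) ≡⟨ vanishes-correct ρ (foldr toggle leaf (expand (e₁ :+ e₂) false 0)) eq ⟩
    0#  ∎)
    where
    e₁ = proj₁ (f $ⁿ Vec.map var (allFin n))
    e₂ = proj₂ (f $ⁿ Vec.map var (allFin n))

-- The alternating form, its quadratic forms and the form Ω.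

module Quadrinomial {A : Set} (K : DiscreteField A) (C : ConjugationStructure K) where

  open ConjugationSolver K C public
  open ≡-Reasoning

  Real : A → Set
  Real x = bar x ≡ x

  N : A → A
  N x = x * bar x

  -- The polar form of `N`: an alternating form over the subfield of real elements, zero exactly on
  -- pairs that are linearly dependent over it.
  wedge : A → A → A
  wedge x y = x * bar y + bar x * y

  :N : ∀ {n} → Expr n → Expr n
  :N x = x :* :bar x

  :wedge : ∀ {n} → Expr n → Expr n → Expr n
  :wedge x y = x :* :bar y :+ :bar x :* y

  bar≢0 : ∀ {x} → x ≢ 0# → bar x ≢ 0#
  bar≢0 x≢0 bar-x≡0 = x≢0 (trans (sym (bar-bar _)) (trans (cong bar bar-x≡0) bar-0))

  σ≢0 : ∀ {x} → x ≢ 0# → σ x ≢ 0#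
  σ≢0 x≢0 σx≡0 = x≢0 (σ-injective (trans σx≡0 (sym σ-0)))

  N≢0 : ∀ {x} → x ≢ 0# → N x ≢ 0#
  N≢0 x≢0 = x*y≢0 x≢0 (bar≢0 x≢0)

  x*x≡0⇒x≡0 : ∀ {x} → x * x ≡ 0# → x ≡ 0#
  x*x≡0⇒x≡0 {x} eq with x ≟ 0#
  ... | yes x≡0 = x≡0
  ... | no  x≢0 = contradiction eq (x*y≢0 x≢0 x≢0)

  N-real : ∀ x → Real (N x)
  N-real = solve 1 (λ x → :bar (:N x) := :N x) refl

  wedge-real : ∀ x y → Real (wedge x y)
  wedge-real = solve 2 (λ x y → :bar (:wedge x y) := :wedge x y) refl

  +-real : ∀ {x y} → Real x → Real y → Real (x + y)
  +-real x-real y-real = trans (bar-+ _ _) (cong₂ _+_ x-real y-real)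

  *-real : ∀ {x y} → Real x → Real y → Real (x * y)
  *-real x-real y-real = trans (bar-* _ _) (cong₂ _*_ x-real y-real)

  factor-real : ∀ {x y} → x ≢ 0# → Real x → Real (x * y) → Real y
  factor-real {x} {y} x≢0 x-real xy-real = *-cancelˡ x≢0 (begin
    x * bar y      ≡⟨ cong (_* bar y) x-real ⟨
    bar x * bar y  ≡⟨ bar-* x y ⟨
    bar (x * y)    ≡⟨ xy-real ⟩
    x * y          ∎)

  divide : ∀ {x} → x ≢ 0# → ∀ y → ∃ λ z → x * z ≡ y
  divide {x} x≢0 y = x ⁻¹[ x≢0 ] * y ,
    trans (sym (*-assoc _ _ _)) (trans (cong (_* y) (*-inverseʳ x≢0)) (*-identityˡ y))

  -- Writing real elements as traces lets the solver handle them without side conditions.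
  real⇒trace : ∀ {x} → Real x → ∃ λ s → x ≡ s + bar s
  real⇒trace {x} x-real with divide (λ eq → bar-ω≢ω (sym (x+y≡0⇒x≡y eq))) (x * ω)
  ... | s , eq = s , *-cancelˡ {ω + bar ω} (λ eq → bar-ω≢ω (sym (x+y≡0⇒x≡y eq))) (begin
    (ω + bar ω) * x  ≡⟨ solve 2 (λ w x → (w :+ :bar w) :* x := x :* w :+ :bar w :* x) refl ω x ⟩
    x * ω + bar ω * x  ≡⟨ cong (λ t → x * ω + bar ω * t) x-real ⟨
    x * ω + bar ω * bar x  ≡⟨ solve 2 (λ w x → x :* w :+ :bar w :* :bar x := x :* w :+ :bar (x :* w)) refl ω x ⟩
    x * ω + bar (x * ω)  ≡⟨ cong (λ t → t + bar t) eq ⟨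
    (ω + bar ω) * s + bar ((ω + bar ω) * s)    ≡⟨ solve 2 (λ w s → (w :+ :bar w) :* s :+ :bar ((w :+ :bar w) :* s)
                                                    := (w :+ :bar w) :* (s :+ :bar s)) refl ω s ⟩
    (ω + bar ω) * (s + bar s)  ∎)

  by-trace : (P : A → Set) → (∀ s → P (s + bar s)) → ∀ {x} → Real x → P x
  by-trace P holds x-real = subst P (sym (proj₂ (real⇒trace x-real))) (holds _)

  1ω-independent : wedge 1# ω ≢ 0#
  1ω-independent eq = bar-ω≢ω (x+y≡0⇒x≡y (trans
    (sym (solve 1 (λ w → :wedge :1 w := :bar w :+ w) refl ω)) eq))

  wedge-nondegenerate : ∀ {x} → x ≢ 0# → ∃ λ y → wedge x y ≢ 0#
  wedge-nondegenerate {x} x≢0 = x * ω , λ eq → x*y≢0 (N≢0 x≢0) 1ω-independent (trans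
    (sym (solve 2 (λ x w → :wedge x (x :* w) := :N x :* :wedge :1 w) refl x ω)) eq)

  wedge≢0⇒ˡ≢0 : ∀ {x y} → wedge x y ≢ 0# → x ≢ 0#
  wedge≢0⇒ˡ≢0 {y = y} w≢0 refl = w≢0 (solve 1 (λ y → :wedge :0 y := :0) refl y)

  wedge≢0⇒ʳ≢0 : ∀ {x y} → wedge x y ≢ 0# → y ≢ 0#
  wedge≢0⇒ʳ≢0 {x = x} w≢0 refl = w≢0 (solve 1 (λ x → :wedge x :0 := :0) refl x)

  -- For real `e` this is a real-valued quadratic form with polar form `e * wedge`. For `e` = 0 it
  -- is additive, the square of a linear form over the real elements, so two independent zeros force
  -- `P` to vanish.
  quad : A → A → A → A
  quad e P x = e * N x + (bar P * (x * x) + P * (bar x * bar x))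

  :quad : ∀ {n} → Expr n → Expr n → Expr n → Expr n
  :quad e P x = e :* :N x :+ (:bar P :* (x :* x) :+ P :* (:bar x :* :bar x))

  -- The form wedge (B x) (B y), for B with invariants α = N a + N d, β = N b + N c,
  -- P = a b̄ + c d̄ and R = a c̄ + b d̄.
  Ω : (α β P R x y : A) → A
  Ω α β P R x y =
    σ (wedge x y) * (α * (x * bar y) + β * (bar x * y) + bar P * (x * y) + P * (bar x * bar y))
    + wedge x y * ((α + β) * σ (bar x * y) + bar R * σ (x * y) + R * σ (bar x * bar y))

  :Ω : ∀ {n} (α β P R x y : Expr n) → Expr n
  :Ω α β P R x y =
    :σ (:wedge x y) :* (α :* (x :* :bar y) :+ β :* (:bar x :* y) :+ :bar P :* (x :* y) :+ P :* (:bar x :* :bar y))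
    :+ :wedge x y :* ((α :+ β) :* :σ (:bar x :* y) :+ :bar R :* :σ (x :* y) :+ R :* :σ (:bar x :* :bar y))

  Ω-real : ∀ {α β} → Real α → Real β → ∀ P R x y → Real (Ω α β P R x y)
  Ω-real α-real β-real P R x y =
    by-trace (λ α → Real (Ω α _ P R x y)) (λ s → by-trace (λ β → Real (Ω (s + bar s) β P R x y)) (λ t →
      solve 6 (λ s t P R x y → :bar (:Ω (s :+ :bar s) (t :+ :bar t) P R x y)
        := :Ω (s :+ :bar s) (t :+ :bar t) P R x y) refl s t P R x y) β-real) α-real

  -- Consequences of nondegeneracy, and the normal form of Ω.

  module Invariants (α β P R : A) (α-real : Real α) (β-real : Real β)
           (αβ≡NP+NR : α * β ≡ N P + N R) where

    Nondegenerate : Set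
    Nondegenerate = ∀ x y → wedge x y ≢ 0# → Ω α β P R x y ≢ 0#

    e : A
    e = α + β

    e-real : Real e
    e-real = +-real α-real β-real

    quad-real : ∀ {e} → Real e → ∀ P x → Real (quad e P x)
    quad-real e-real P x = by-trace (λ e → Real (quad e P x)) (λ s → solve 3 (λ s P x →
      :bar (:quad (s :+ :bar s) P x) := :quad (s :+ :bar s) P x) refl s P x) e-real

    -- Along a line in direction `x` the form depends on the parameter only through `l` and `σ l`,
    -- and the coefficients carry the two quadratic forms. If one coefficient is zero, the other
    -- alone decides whether Ω can be brought to 0.
    Ω-shift : ∀ {l} → Real l → ∀ x y → Ω α β P R x (y + l * x) ≡
      Ω α β P R x y + (σ (wedge x y) * l * quad e P x + wedge x y * σ l * quad e R (σ x))
    Ω-shift l-real x y = by-trace (λ l → Ω α β P R x (y + l * x) ≡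
      Ω α β P R x y + (σ (wedge x y) * l * quad e P x + wedge x y * σ l * quad e R (σ x)))
      (λ s → solve 7 (λ α β P R x y s → :Ω α β P R x (y :+ (s :+ :bar s) :* x) :=
      :Ω α β P R x y :+ (:σ (:wedge x y) :* (s :+ :bar s) :* :quad (α :+ β) P x
                      :+ :wedge x y :* :σ (s :+ :bar s) :* :quad (α :+ β) R (:σ x))) refl α β P R x y s) l-real

    wedge-shift : ∀ {l} → Real l → ∀ x y → wedge x (y + l * x) ≡ wedge x y
    wedge-shift l-real x y = by-trace (λ l → wedge x (y + l * x) ≡ wedge x y) (λ s → solve 3 (λ x y s →
      :wedge x (y :+ (s :+ :bar s) :* x) := :wedge x y) refl x y s) l-real

    -- If only the term in `σ l` survived, a real `l` could be chosen to cancel `Ω α β P R x y`,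
    -- while the wedge stays constant along the line.
    isotropic⇒ : Nondegenerate → ∀ {x} → x ≢ 0# → quad e P x ≡ 0# → quad e R (σ x) ≡ 0#
    isotropic⇒ nondeg {x} x≢0 P-isotropic = decidable-stable (_ ≟ 0#) λ q₂≢0 →
      let y , w≢0   = wedge-nondegenerate x≢0
          w         = wedge x y
          q₂        = quad e R (σ x)
          wq₂≢0     = x*y≢0 w≢0 q₂≢0
          m , m-eq  = divide wq₂≢0 (Ω α β P R x y)
          m-real    = factor-real wq₂≢0
            (*-real (wedge-real x y) (quad-real e-real R (σ x)))
            (subst Real (sym m-eq) (Ω-real α-real β-real P R x y))
          l         = σ⁻¹ m
          σl≡m      = σ-σ⁻¹ m
          l-real    = σ-injective (trans (sym (bar-σ l)) (trans (cong bar σl≡m) (trans m-real (sym σl≡m))))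
      in nondeg x (y + l * x) (λ eq → w≢0 (trans (sym (wedge-shift l-real x y)) eq)) (begin
        Ω α β P R x (y + l * x)  ≡⟨ Ω-shift l-real x y ⟩
        Ω α β P R x y + (σ w * l * quad e P x + w * σ l * q₂)
          ≡⟨ cong₂ (λ s t → Ω α β P R x y + (σ w * l * s + w * t * q₂)) P-isotropic σl≡m ⟩
        Ω α β P R x y + (σ w * l * 0# + w * m * q₂)
          ≡⟨ solve 5 (λ o k w m q → o :+ (k :* :0 :+ w :* m :* q) := o :+ w :* q :* m) refl _ (σ w * l) w m q₂ ⟩
        Ω α β P R x y + w * q₂ * m  ≡⟨ x≡y⇒x+y≡0 (sym m-eq) ⟩
        0#  ∎)

    module _ (nondeg : Nondegenerate) where

      -- With e = 0 both quadratic forms are squares of linear forms, so nonzero isotropic vectors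
      -- exist. If P = 0, every vector is isotropic, which makes R, then α and β, vanish and Ω with
      -- them. Otherwise √P is isotropic, and Ω vanishes on every pair (√P, y).
      e≢0 : e ≢ 0#
      e≢0 e≡0 with P ≟ 0#
      ... | yes P≡0 = nondeg 1# ω 1ω-independent (begin
        Ω α β P R 1# ω  ≡⟨ cong (λ t → Ω α t P R 1# ω) (sym α≡β) ⟩
        Ω α α P R 1# ω  ≡⟨ cong (λ t → Ω t t P R 1# ω) α≡0 ⟩
        Ω 0# 0# P R 1# ω       ≡⟨ cong₂ (λ s t → Ω 0# 0# s t 1# ω) P≡0 R≡0 ⟩
        Ω 0# 0# 0# 0# 1# ω     ≡⟨ solve 1 (λ w → :Ω :0 :0 :0 :0 :1 w := :0) refl ω ⟩
        0#  ∎)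
        where
        α≡β = x+y≡0⇒x≡y e≡0
        q₂≡0 : ∀ {x} → x ≢ 0# → quad 0# R (σ x) ≡ 0#
        q₂≡0 {x} x≢0 = trans (cong (λ t → quad t R (σ x)) (sym e≡0)) (isotropic⇒ nondeg x≢0 (begin
          quad e P x     ≡⟨ cong₂ (λ s t → quad s t x) e≡0 P≡0 ⟩
          quad 0# 0# x   ≡⟨ solve 1 (λ x → :quad :0 :0 x := :0) refl x ⟩
          0#  ∎))
        R≡0 : R ≡ 0#
        R≡0 = x*y≡0⇒y≡0 (x*y≢0 (σ≢0 1ω-independent) (σ≢0 1ω-independent)) (begin
          σ (wedge 1# ω) * σ (wedge 1# ω) * R
            ≡⟨ solve 2 (λ w R → :σ (:wedge :1 w) :* :σ (:wedge :1 w) :* R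
                 := :quad :0 R (:σ :1) :* (:σ w :* :σ w) :+ :quad :0 R (:σ w)) refl ω R ⟩
          quad 0# R (σ 1#) * (σ ω * σ ω) + quad 0# R (σ ω)
            ≡⟨ cong₂ (λ s t → s * (σ ω * σ ω) + t) (q₂≡0 1≢0) (q₂≡0 (wedge≢0⇒ʳ≢0 1ω-independent)) ⟩
          0# * (σ ω * σ ω) + 0#
            ≡⟨ solve 1 (λ w → :0 :* w :+ :0 := :0) refl _ ⟩
          0#  ∎)
        α≡0 : α ≡ 0#
        α≡0 = x*x≡0⇒x≡0 (begin
          α * α        ≡⟨ cong (α *_) α≡β ⟩
          α * β        ≡⟨ αβ≡NP+NR ⟩
          N P + N R    ≡⟨ cong₂ (λ s t → N s + N t) P≡0 R≡0 ⟩
          N 0# + N 0#  ≡⟨ x+x≡0 _ ⟩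
          0#           ∎)
      ... | no P≢0 = nondeg p y w≢0 (x*y≡0⇒y≡0 (σ≢0 (N≢0 p≢0)) (begin
        σ (N p) * Ω α β P R p y  ≡⟨ cong₂ (λ s t → σ (N p) * Ω α s t R p y) (sym α≡β) (sym p²≡P) ⟩
        σ (N p) * Ω α α (p * p) R p y
          ≡⟨ solve 4 (λ α R p y → :σ (:N p) :* :Ω α α (p :* p) R p y :=
               :σ (:wedge p y) :* :wedge p y :* ((α :+ :N p) :* :σ (:N p) :+ :bar R :* (:σ p :* :σ p))
               :+ :wedge p y :* :σ (p :* :bar y) :* :quad :0 R (:σ p)) refl α R p y ⟩
        σ (wedge p y) * wedge p y * κ + wedge p y * σ (p * bar y) * quad 0# R (σ p)
          ≡⟨ cong₂ (λ s t → σ (wedge p y) * wedge p y * s + wedge p y * σ (p * bar y) * t) κ≡0 q₂≡0 ⟩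
        σ (wedge p y) * wedge p y * 0# + wedge p y * σ (p * bar y) * 0#
          ≡⟨ solve 2 (λ s t → s :* :0 :+ t :* :0 := :0) refl _ _ ⟩
        0#  ∎))
        where
        α≡β = x+y≡0⇒x≡y e≡0
        p = √ P
        p²≡P = √-square P
        p≢0 : p ≢ 0#
        p≢0 p≡0 = P≢0 (trans (sym p²≡P) (trans (cong (_* p) p≡0) (zeroˡ p)))
        y = proj₁ (wedge-nondegenerate p≢0)
        w≢0 = proj₂ (wedge-nondegenerate p≢0)
        -- The factor that remains of `σ (N p) * Ω α β P R p y` once `quad 0# R (σ p)` is removed.
        -- It is shown to vanish through its square, because the available relation `αβ≡NP+NR`
        -- becomes a statement about α² when α = β.
        κ = (α + N p) * σ (N p) + bar R * (σ p * σ p)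
        q₂≡0 : quad 0# R (σ p) ≡ 0#
        q₂≡0 = trans (cong (λ t → quad t R (σ p)) (sym e≡0)) (isotropic⇒ nondeg p≢0 (begin
          quad e P p  ≡⟨ cong₂ (λ s t → quad s t p) e≡0 (sym p²≡P) ⟩
          quad 0# (p * p) p     ≡⟨ solve 1 (λ p → :quad :0 (p :* p) p := :0) refl p ⟩
          0#  ∎))
        α²≡NP+NR : α * α ≡ N (p * p) + N R
        α²≡NP+NR = trans (cong (α *_) α≡β) (trans αβ≡NP+NR (cong (λ t → N t + N R) (sym p²≡P)))
        κ≡0 : κ ≡ 0#
        κ≡0 = x*x≡0⇒x≡0 (begin
          κ * κ
            ≡⟨ solve 3 (λ α R p →
                 let κ = (α :+ :N p) :* :σ (:N p) :+ :bar R :* (:σ p :* :σ p) in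
                 κ :* κ := :σ (:N p) :* :σ (:N p) :* (α :* α :+ (:N (p :* p) :+ :N R))
                           :+ :bar R :* (:σ p :* :σ p) :* :quad :0 R (:σ p)) refl α R p ⟩
          σ (N p) * σ (N p) * (α * α + (N (p * p) + N R)) + bar R * (σ p * σ p) * quad 0# R (σ p)
            ≡⟨ cong₂ (λ s t → σ (N p) * σ (N p) * s + bar R * (σ p * σ p) * t) (x≡y⇒x+y≡0 α²≡NP+NR) q₂≡0 ⟩
          σ (N p) * σ (N p) * 0# + bar R * (σ p * σ p) * 0#
            ≡⟨ solve 2 (λ s t → s :* :0 :+ t :* :0 := :0) refl _ _ ⟩
          0#  ∎)

      -- In e σ(`quad e P x`) + σ e `quad e R (σ x)` the norm terms cancel, leaving
      -- `quad 0# δ (σ x)`, the square of a linear form; two independent zeros give δ = 0. The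
      -- second zero lies on a line in direction `x`: as `x` is isotropic, the quadratic form is
      -- affine in `l` there, with slope e [x , y] ≠ 0.
      isotropic⇒covariant : ∀ {x} → x ≢ 0# → quad e P x ≡ 0# → e * σ P ≡ σ e * R
      isotropic⇒covariant {x} x≢0 q₁x≡0 = x+y≡0⇒x≡y (x*y≡0⇒y≡0 (x*y≢0 (σ≢0 wxz≢0) (σ≢0 wxz≢0)) (begin
        σ (wedge x z) * σ (wedge x z) * δ
          ≡⟨ solve 3 (λ x z δ → :σ (:wedge x z) :* :σ (:wedge x z) :* δ :=
               :quad :0 δ (:σ x) :* (:σ z :* :σ z) :+ :quad :0 δ (:σ z) :* (:σ x :* :σ x)) refl x z δ ⟩
        quad 0# δ (σ x) * (σ z * σ z) + quad 0# δ (σ z) * (σ x * σ x)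
          ≡⟨ cong₂ (λ s t → s * (σ z * σ z) + t * (σ x * σ x)) (δ-isotropic x≢0 q₁x≡0) (δ-isotropic z≢0 q₁z≡0) ⟩
        0# * (σ z * σ z) + 0# * (σ x * σ x)
          ≡⟨ solve 2 (λ s t → :0 :* s :+ :0 :* t := :0) refl _ _ ⟩
        0#  ∎))
        where
        δ = e * σ P + σ e * R
        y = proj₁ (wedge-nondegenerate x≢0)
        w≢0 = proj₂ (wedge-nondegenerate x≢0)
        w = wedge x y
        ew≢0 = x*y≢0 e≢0 w≢0
        l = proj₁ (divide ew≢0 (quad e P y))
        ewl≡q₁ = proj₂ (divide ew≢0 (quad e P y))
        l-real : Real l
        l-real = factor-real ew≢0 (*-real e-real (wedge-real x y)) (subst Real (sym ewl≡q₁) (quad-real e-real P y))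
        z = y + l * x
        wxz≢0 : wedge x z ≢ 0#
        wxz≢0 eq = w≢0 (trans (sym (wedge-shift l-real x y)) eq)
        z≢0 = wedge≢0⇒ʳ≢0 wxz≢0
        quad-shift : ∀ {l} → Real l → quad e P (y + l * x) ≡ quad e P y + (e * w * l + l * l * quad e P x)
        quad-shift l-real = by-trace
          (λ l → quad e P (y + l * x) ≡ quad e P y + (e * w * l + l * l * quad e P x))
          (λ s → solve 5 (λ e P x y s → :quad e P (y :+ (s :+ :bar s) :* x) :=
          :quad e P y :+ (e :* :wedge x y :* (s :+ :bar s) :+ (s :+ :bar s) :* (s :+ :bar s) :* :quad e P x)) refl e P x y s) l-real
        q₁z≡0 : quad e P z ≡ 0#
        q₁z≡0 = begin
          quad e P z  ≡⟨ quad-shift l-real ⟩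
          quad e P y + (e * w * l + l * l * quad e P x)     ≡⟨ cong₂ (λ s t → quad e P y + (s + l * l * t)) ewl≡q₁ q₁x≡0 ⟩
          quad e P y + (quad e P y + l * l * 0#)  ≡⟨ solve 2 (λ q t → q :+ (q :+ t :* :0) := :0) refl _ _ ⟩
          0#  ∎
        quad-δ : ∀ {e} → Real e → ∀ x → quad 0# (e * σ P + σ e * R) (σ x) ≡ e * σ (quad e P x) + σ e * quad e R (σ x)
        quad-δ e-real x = by-trace
          (λ e → quad 0# (e * σ P + σ e * R) (σ x) ≡ e * σ (quad e P x) + σ e * quad e R (σ x))
          (λ s → solve 4 (λ s P R x → let e = s :+ :bar s in
          :quad :0 (e :* :σ P :+ :σ e :* R) (:σ x) := e :* :σ (:quad e P x) :+ :σ e :* :quad e R (:σ x)) refl s P R x) e-real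
        δ-isotropic : ∀ {x} → x ≢ 0# → quad e P x ≡ 0# → quad 0# δ (σ x) ≡ 0#
        δ-isotropic {x} x≢0 q₁≡0 = begin
          quad 0# δ (σ x)  ≡⟨ quad-δ e-real x ⟩
          e * σ (quad e P x) + σ e * quad e R (σ x)      ≡⟨ cong₂ (λ s t → e * σ s + σ e * t) q₁≡0 (isotropic⇒ nondeg x≢0 q₁≡0) ⟩
          e * σ 0# + σ e * 0#  ≡⟨ solve 2 (λ s t → s :* :σ :0 :+ t :* :0 := :0) refl _ _ ⟩
          0#  ∎

    -- With h = (x ȳ + π̄ x y + π x̄ ȳ) / [x , y], condition (4) turns Ω into
    -- e [x , y]^{Q+1} (h^Q + h + u + 1).
    module _ (e≢0 : e ≢ 0#) (covariant : e * σ P ≡ σ e * R) (u : A) (eu≡β : e * u ≡ β) where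

      π = proj₁ (divide e≢0 P)
      eπ≡P = proj₂ (divide e≢0 P)

      H : A → A → A
      H x y = x * bar y + (bar π * (x * y) + π * (bar x * bar y))

      eσπ≡R : e * σ π ≡ R
      eσπ≡R = *-cancelˡ (σ≢0 e≢0) (begin
        σ e * (e * σ π)   ≡⟨ solve 2 (λ e π → :σ e :* (e :* :σ π) := e :* :σ (e :* π)) refl e π ⟩
        e * σ (e * π)     ≡⟨ cong (λ t → e * σ t) eπ≡P ⟩
        e * σ P  ≡⟨ covariant ⟩
        σ e * R           ∎)

      Ω-normal-form : ∀ {e} → Real e → ∀ u π x y h → wedge x y * h ≡ x * bar y + (bar π * (x * y) + π * (bar x * bar y)) →
        Ω (e + e * u) (e * u) (e * π) (e * σ π) x y ≡
        e * wedge x y * σ (wedge x y) * (σ h + h + (u + 1#))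
      Ω-normal-form {e} e-real u π x y h eq = begin
        Ω (e + e * u) (e * u) (e * π) (e * σ π) x y
          ≡⟨ by-trace (λ e → Ω (e + e * u) (e * u) (e * π) (e * σ π) x y ≡ e *
               (σ (wedge x y) * (x * bar y + (bar π * (x * y) + π * (bar x * bar y)) + u * wedge x y)
               + wedge x y * σ (x * bar y + (bar π * (x * y) + π * (bar x * bar y)) + wedge x y)))
             (λ s → solve 5 (λ s u π x y →
               let e = s :+ :bar s ; H = x :* :bar y :+ (:bar π :* (x :* y) :+ π :* (:bar x :* :bar y)) in
               :Ω (e :+ e :* u) (e :* u) (e :* π) (e :* :σ π) x y :=
               e :* (:σ (:wedge x y) :* (H :+ u :* :wedge x y) :+ :wedge x y :* :σ (H :+ :wedge x y))) refl s u π x y) e-real ⟩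
        e * (σ (wedge x y) * (x * bar y + (bar π * (x * y) + π * (bar x * bar y)) + u * wedge x y)
          + wedge x y * σ (x * bar y + (bar π * (x * y) + π * (bar x * bar y)) + wedge x y))
          ≡⟨ cong (λ t → e * (σ (wedge x y) * (t + u * wedge x y) + wedge x y * σ (t + wedge x y))) eq ⟨
        e * (σ (wedge x y) * (wedge x y * h + u * wedge x y) + wedge x y * σ (wedge x y * h + wedge x y))
          ≡⟨ solve 4 (λ e w h u → e :* (:σ w :* (w :* h :+ u :* w) :+ w :* :σ (w :* h :+ w)) :=
               e :* w :* :σ w :* (:σ h :+ h :+ (u :+ :1))) refl e (wedge x y) h u ⟩
        e * wedge x y * σ (wedge x y) * (σ h + h + (u + 1#))  ∎

      Ω-normal : ∀ x y h → wedge x y * h ≡ H x y →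
        Ω α β P R x y ≡ e * wedge x y * σ (wedge x y) * (σ h + h + (u + 1#))
      Ω-normal x y h eq = begin
        Ω α β P R x y
          ≡⟨ cong (λ t → Ω t β P R x y) (solve 2 (λ α β → α := α :+ β :+ β) refl α β) ⟩
        Ω (e + β) β P R x y
          ≡⟨ cong (λ t → Ω (e + t) t P R x y) eu≡β ⟨
        Ω (e + e * u) (e * u) P R x y
          ≡⟨ cong₂ (λ s t → Ω (e + e * u) (e * u) s t x y) eπ≡P eσπ≡R ⟨
        Ω (e + e * u) (e * u) (e * π) (e * σ π) x y
          ≡⟨ Ω-normal-form e-real u π x y h eq ⟩
        e * wedge x y * σ (wedge x y) * (σ h + h + (u + 1#)) ∎

      -- The relation `αβ≡NP+NR` divided by e². Its use is that for every root h₁ of h² + h = N π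
      -- the element u + σ h₁ + h₁ is killed by x² + x, hence lies in 𝔽₂, and this determines the
      -- trace of u.
      u²+u≡Nπ+σNπ : u * u + u ≡ N π + σ (N π)
      u²+u≡Nπ+σNπ = *-cancelˡ (x*y≢0 e≢0 e≢0) (begin
        e * e * (u * u + u)  ≡⟨ solve 2 (λ e u → e :* e :* (u :* u :+ u) := e :* u :* (e :* u) :+ e :* (e :* u)) refl e u ⟩
        e * u * (e * u) + e * (e * u) ≡⟨ cong (λ t → t * t + e * t) eu≡β ⟩
        β * β + (α + β) * β  ≡⟨ solve 2 (λ α β → β :* β :+ (α :+ β) :* β := α :* β) refl α β ⟩
        α * β  ≡⟨ αβ≡NP+NR ⟩
        N P + N R  ≡⟨ cong₂ (λ s t → N s + N t) eπ≡P eσπ≡R ⟨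
        N (e * π) + N (e * σ π)      ≡⟨ by-trace (λ e → N (e * π) + N (e * σ π) ≡ e * e * (N π + σ (N π))) (λ s →
                                          solve 2 (λ s π → let e = s :+ :bar s in
                                            :N (e :* π) :+ :N (e :* :σ π) := e :* e :* (:N π :+ :σ (:N π))) refl s π) e-real ⟩
        e * e * (N π + σ (N π))      ∎)

      Solvable : Set
      Solvable = ∃ λ h → h + bar h ≡ 1# × σ h + h ≡ u + 1#

      unsolvable⇒nondegenerate : ¬ Solvable → Nondegenerate
      unsolvable⇒nondegenerate unsolvable x y w≢0 Ω≡0 = unsolvable (h , h+h̄≡1 , x+y≡0⇒x≡y
        (x*y≡0⇒y≡0 (x*y≢0 (x*y≢0 e≢0 w≢0) (σ≢0 w≢0)) (trans (sym (Ω-normal x y h wh≡H)) Ω≡0)))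
        where
        w = wedge x y
        h = proj₁ (divide w≢0 (H x y))
        wh≡H = proj₂ (divide w≢0 (H x y))
        h+h̄≡1 : h + bar h ≡ 1#
        h+h̄≡1 = *-cancelˡ w≢0 (begin
          w * (h + bar h)  ≡⟨ distribˡ w h (bar h) ⟩
          w * h + w * bar h  ≡⟨ cong (λ t → w * h + t * bar h) (wedge-real x y) ⟨
          w * h + bar w * bar h      ≡⟨ cong (w * h +_) (bar-* w h) ⟨
          w * h + bar (w * h)        ≡⟨ cong (λ t → t + bar t) wh≡H ⟩
          H x y + bar (H x y)        ≡⟨ solve 3 (λ π x y → let H = x :* :bar y :+ (:bar π :* (x :* y) :+ π :* (:bar x :* :bar y)) in
                                          H :+ :bar H := :wedge x y :* :1) refl π x y ⟩
          w * 1#  ∎)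

      nondegenerate⇒unsolvable : Nondegenerate → ¬ Solvable
      nondegenerate⇒unsolvable nondeg (h , h+h̄≡1 , σh+h≡u+1) = nondeg x y w≢0 (begin
        Ω α β P R x y  ≡⟨ Ω-normal x y h (x+y≡0⇒x≡y wh+H≡0) ⟩
        e * wedge x y * σ (wedge x y) * (σ h + h + (u + 1#))   ≡⟨ cong (e * wedge x y * σ (wedge x y) *_) (x≡y⇒x+y≡0 σh+h≡u+1) ⟩
        e * wedge x y * σ (wedge x y) * 0#  ≡⟨ zeroʳ _ ⟩
        0#  ∎)
        where
        -- The polar form of `quad 1# π` is `wedge`, so the form cannot vanish at 1, ω and 1 + ω
        -- simultaneously.
        anisotropic : ∃ λ y → quad 1# π y ≢ 0#
        anisotropic with quad 1# π 1# ≟ 0# | quad 1# π ω ≟ 0#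
        ... | no  ≢0 | _      = 1# , ≢0
        ... | yes _  | no  ≢0 = ω , ≢0
        ... | yes q1≡0 | yes qω≡0 = 1# + ω , λ q≡0 → 1ω-independent (begin
          wedge 1# ω  ≡⟨ solve 2 (λ π w → :wedge :1 w := :quad :1 π (:1 :+ w) :+ (:quad :1 π :1 :+ :quad :1 π w)) refl π ω ⟩
          quad 1# π (1# + ω) + (quad 1# π 1# + quad 1# π ω)  ≡⟨ cong₂ _+_ q≡0 (cong₂ _+_ q1≡0 qω≡0) ⟩
          0# + (0# + 0#)  ≡⟨ trans (+-identityˡ _) (+-identityˡ _) ⟩
          0#  ∎)
        y = proj₁ anisotropic
        -- With 1 + h = h̄, the equation [x , y] h = H x y says that x times the conjugate of h y +
        -- π ȳ equals x̄ times h y + π ȳ, and this x is the obvious solution.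
        x = h * y + π * bar y
        wedge-xy : wedge x y ≡ quad 1# π y
        wedge-xy = begin
          wedge x y
            ≡⟨ solve 3 (λ h y π → :wedge (h :* y :+ π :* :bar y) y := :quad (h :+ :bar h) π y) refl h y π ⟩
          quad (h + bar h) π y   ≡⟨ cong (λ t → quad t π y) h+h̄≡1 ⟩
          quad 1# π y  ∎
        w≢0 : wedge x y ≢ 0#
        w≢0 eq = proj₂ anisotropic (trans (sym wedge-xy) eq)
        wh+H≡0 : wedge x y * h + H x y ≡ 0#
        wh+H≡0 = begin
          wedge x y * h + H x y
            ≡⟨ solve 3 (λ h y π → let x = h :* y :+ π :* :bar y in
                 :wedge x y :* h :+ (x :* :bar y :+ (:bar π :* (x :* y) :+ π :* (:bar x :* :bar y)))
                 := (h :+ :bar h :+ :1) :* (x :* :bar y)) refl h y π ⟩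
          (h + bar h + 1#) * (x * bar y)   ≡⟨ cong (_* (x * bar y)) (x≡y⇒x+y≡0 h+h̄≡1) ⟩
          0# * (x * bar y)  ≡⟨ zeroˡ _ ⟩
          0#  ∎

-- The pencil B + Y B̄ and condition (4).

module Coefficients {A : Set} (K : DiscreteField A) (C : ConjugationStructure K)
  (a b c d : A) where

  open Quadrinomial K C public
  open ≡-Reasoning

  -- B x = x^{Q+1} A(x^{q-1}).
  B : A → A
  B x = a * σ (bar x) * bar x + b * σ (bar x) * x + c * σ x * bar x + d * σ x * x

  :B : ∀ {n} (a b c d x : Expr n) → Expr n
  :B a b c d x = a :* :σ (:bar x) :* :bar x :+ b :* :σ (:bar x) :* x :+ c :* :σ x :* :bar x :+ d :* :σ x :* x

  α β P R : A
  α = N a + N d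
  β = N b + N c
  P = a * bar b + c * bar d
  R = a * bar c + b * bar d

  wedge-B : ∀ x y → wedge (B x) (B y) ≡ Ω α β P R x y
  wedge-B = solve 6 (λ a b c d x y → :wedge (:B a b c d x) (:B a b c d y) :=
    :Ω (:N a :+ :N d) (:N b :+ :N c) (a :* :bar b :+ c :* :bar d) (a :* :bar c :+ b :* :bar d) x y) refl a b c d

  αβ≡NP+NR : α * β ≡ N P + N R
  αβ≡NP+NR = solve 4 (λ a b c d → (:N a :+ :N d) :* (:N b :+ :N c) :=
    :N (a :* :bar b :+ c :* :bar d) :+ :N (a :* :bar c :+ b :* :bar d)) refl a b c d

  open Invariants α β P R (+-real (N-real a) (N-real d)) (+-real (N-real b) (N-real c)) αβ≡NP+NR public

  -- The bilinear form B + Y B̄ has coefficients t₁, t₂, t₃, t₄; for a root Y of its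
  -- determinant Δ̄ Y² + e Y + Δ it has rank one.
  module _ (e≢0 : e ≢ 0#) where

    Δ : A
    Δ = a * d + b * c

    -- For Δ ≠ 0 the substitution Y = (e / Δ̄) z turns the equation into z² + z = N Δ / e². The
    -- right-hand side is real, so `artin-schreier` applies.
    determinant-root : ∃ λ Y → bar Δ * (Y * Y) + e * Y + Δ ≡ 0#
    determinant-root = split (Δ ≟ 0#)
     where
     split : Dec (Δ ≡ 0#) → ∃ λ Y → bar Δ * (Y * Y) + e * Y + Δ ≡ 0#
     split (yes Δ≡0) = 0# , (begin
      bar Δ * (0# * 0#) + e * 0# + Δ  ≡⟨ cong (bar Δ * (0# * 0#) + e * 0# +_) Δ≡0 ⟩
      bar Δ * (0# * 0#) + e * 0# + 0# ≡⟨ solve 2 (λ D e → D :* (:0 :* :0) :+ e :* :0 :+ :0 := :0) refl _ _ ⟩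
      0#  ∎)
     split (no Δ≢0) = f * z , x*y≡0⇒y≡0 (bar≢0 Δ≢0) (begin
      bar Δ * (bar Δ * (f * z * (f * z)) + e * (f * z) + Δ)
        ≡⟨ solve 4 (λ D e f z → :bar D :* (:bar D :* (f :* z :* (f :* z)) :+ e :* (f :* z) :+ D) :=
             :bar D :* f :* (:bar D :* f) :* (z :* z) :+ :bar D :* f :* e :* z :+ :N D) refl Δ e f z ⟩
      bar Δ * f * (bar Δ * f) * (z * z) + bar Δ * f * e * z + N Δ
        ≡⟨ cong₂ (λ s t → s * s * (z * z) + s * e * z + t) Δ̄f≡e (sym e²n≡NΔ) ⟩
      e * e * (z * z) + e * e * z + e * e * n
        ≡⟨ solve 3 (λ E z n → E :* (z :* z) :+ E :* z :+ E :* n := E :* (z :* z :+ z :+ n)) refl (e * e) z n ⟩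
      e * e * (z * z + z + n)
        ≡⟨ cong (e * e *_) (x≡y⇒x+y≡0 z²+z≡n) ⟩
      e * e * 0#
        ≡⟨ trans (zeroʳ _) (sym (zeroʳ _)) ⟩
      bar Δ * 0#
        ≡⟨ zeroʳ _ ⟩
      0#  ∎)
      where
      f = proj₁ (divide (bar≢0 Δ≢0) e)
      Δ̄f≡e = proj₂ (divide (bar≢0 Δ≢0) e)
      e²≢0 = x*y≢0 e≢0 e≢0
      n = proj₁ (divide e²≢0 (N Δ))
      e²n≡NΔ = proj₂ (divide e²≢0 (N Δ))
      n-real : Real n
      n-real = factor-real e²≢0 (*-real e-real e-real) (subst Real (sym e²n≡NΔ) (N-real Δ))
      z = proj₁ (artin-schreier n-real)
      z²+z≡n = proj₂ (artin-schreier n-real)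

    module _ (Y : A) (root : bar Δ * (Y * Y) + e * Y + Δ ≡ 0#) where

      t₁ t₂ t₃ t₄ : A
      t₁ = a + Y * bar d
      t₂ = b + Y * bar c
      t₃ = c + Y * bar b
      t₄ = d + Y * bar a

      t₁t₄≡t₂t₃ : t₁ * t₄ ≡ t₂ * t₃
      t₁t₄≡t₂t₃ = x+y≡0⇒x≡y (begin
        t₁ * t₄ + t₂ * t₃
          ≡⟨ solve 5 (λ a b c d Y → (a :+ Y :* :bar d) :* (d :+ Y :* :bar a) :+ (b :+ Y :* :bar c) :* (c :+ Y :* :bar b) :=
               :bar (a :* d :+ b :* c) :* (Y :* Y) :+ (:N a :+ :N d :+ (:N b :+ :N c)) :* Y :+ (a :* d :+ b :* c)) refl a b c d Y ⟩
        bar Δ * (Y * Y) + e * Y + Δ   ≡⟨ root ⟩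
        0#  ∎)

      module _ (NY≡1 : N Y ≡ 1#) where

        -- The value `quad e P x` is N (a x̄ + b x) + N (c x̄ + d x). The hypothesis says that a x̄
        -- + b x is Y times the conjugate of c x̄ + d x, so for N Y = 1 the two norms are equal and
        -- cancel.
        zero⇒isotropic : ∀ x → t₂ * x ≡ t₁ * bar x → quad e P x ≡ 0#
        zero⇒isotropic x eq = begin
          quad e P x
            ≡⟨ solve 6 (λ a b c d Y x →
                 :quad (:N a :+ :N d :+ (:N b :+ :N c)) (a :* :bar b :+ c :* :bar d) x :=
                 τ a b c d Y x :* (:bar a :* x :+ :bar b :* :bar x)
                 :+ (Y :* :bar (τ a b c d Y x) :+ (:N Y :+ :1) :* (d :* x :+ c :* :bar x)) :* (:bar c :* x :+ :bar d :* :bar x))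
                 refl a b c d Y x ⟩
          T * (bar a * x + bar b * bar x) + (Y * bar T + (N Y + 1#) * (d * x + c * bar x)) * (bar c * x + bar d * bar x)
            ≡⟨ cong₂ (λ s t → s * (bar a * x + bar b * bar x) + (Y * bar s + t * (d * x + c * bar x)) * (bar c * x + bar d * bar x))
                 (x≡y⇒x+y≡0 eq) (x≡y⇒x+y≡0 NY≡1) ⟩
          0# * (bar a * x + bar b * bar x) + (Y * bar 0# + 0# * (d * x + c * bar x)) * (bar c * x + bar d * bar x)
            ≡⟨ solve 4 (λ Y s t u → :0 :* s :+ (Y :* :bar :0 :+ :0 :* t) :* u := :0) refl Y _ _ _ ⟩
          0#  ∎
          where
          T = t₂ * x + t₁ * bar x
          τ : ∀ {n} (a b c d Y x : Expr n) → Expr n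
          τ a b c d Y x = (b :+ Y :* :bar c) :* x :+ (a :+ Y :* :bar d) :* :bar x

        -- For N Y = 1 the second row of the matrix is determined by the first, t₄ = Y t̄₁ and t₃ =
        -- Y t̄₂, so the vanishing determinant compares two norms.
        Nt₁≡Nt₂ : N t₁ ≡ N t₂
        Nt₁≡Nt₂ = *-cancelˡ Y≢0 (begin
          Y * N t₁
            ≡⟨ solve 3 (λ a d Y → let t₁ = a :+ Y :* :bar d in
                 Y :* :N t₁ := t₁ :* (d :+ Y :* :bar a) :+ t₁ :* d :* (:N Y :+ :1)) refl a d Y ⟩
          t₁ * t₄ + t₁ * d * (N Y + 1#)
            ≡⟨ cong₂ _+_ t₁t₄≡t₂t₃ (trans (vanish (t₁ * d)) (sym (vanish (t₂ * c)))) ⟩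
          t₂ * t₃ + t₂ * c * (N Y + 1#)
            ≡⟨ solve 3 (λ b c Y → let t₂ = b :+ Y :* :bar c in
                 t₂ :* (c :+ Y :* :bar b) :+ t₂ :* c :* (:N Y :+ :1) := Y :* :N t₂) refl b c Y ⟩
          Y * N t₂  ∎)
          where
          Y≢0 : Y ≢ 0#
          Y≢0 Y≡0 = 1≢0 (trans (sym NY≡1) (trans (cong (_* bar Y) Y≡0) (zeroˡ _)))
          vanish : ∀ x → x * (N Y + 1#) ≡ 0#
          vanish x = trans (cong (x *_) (x≡y⇒x+y≡0 NY≡1)) (zeroʳ x)

        -- By the equality of norms every t̄₂ s + t₁ s̄ satisfies the hypothesis of
        -- `zero⇒isotropic`. If this gives 0 for both s = 1 and s = ω, then t₁ = t₂ = 0 and the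
        -- hypothesis holds at 1.
        isotropic-vector : ∃ λ x → x ≢ 0# × quad e P x ≡ 0#
        isotropic-vector = choose (x₀ 1# ≟ 0#) (x₀ ω ≟ 0#)
          where
          x₀ : A → A
          x₀ s = bar t₂ * s + t₁ * bar s
          x₀-zero : ∀ s → t₂ * x₀ s ≡ t₁ * bar (x₀ s)
          x₀-zero s = begin
            t₂ * x₀ s  ≡⟨ solve 3 (λ t₁ t₂ s → t₂ :* (:bar t₂ :* s :+ t₁ :* :bar s) := :N t₂ :* s :+ t₁ :* t₂ :* :bar s) refl t₁ t₂ s ⟩
            N t₂ * s + t₁ * t₂ * bar s   ≡⟨ cong (λ n → n * s + t₁ * t₂ * bar s) Nt₁≡Nt₂ ⟨
            N t₁ * s + t₁ * t₂ * bar s   ≡⟨ solve 3 (λ t₁ t₂ s → :N t₁ :* s :+ t₁ :* t₂ :* :bar s := t₁ :* :bar (:bar t₂ :* s :+ t₁ :* :bar s)) refl t₁ t₂ s ⟩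
            t₁ * bar (x₀ s)  ∎
          choose : Dec (x₀ 1# ≡ 0#) → Dec (x₀ ω ≡ 0#) → ∃ λ x → x ≢ 0# × quad e P x ≡ 0#
          choose (no  x≢0) _         = x₀ 1# , x≢0 , zero⇒isotropic _ (x₀-zero 1#)
          choose (yes _)   (no  x≢0) = x₀ ω , x≢0 , zero⇒isotropic _ (x₀-zero ω)
          choose (yes x₀1≡0) (yes x₀ω≡0) = 1# , 1≢0 , zero⇒isotropic 1# (begin
            t₂ * 1#        ≡⟨ cong (_* 1#) t₂≡0 ⟩
            0# * 1#        ≡⟨ trans (zeroˡ _) (sym (zeroˡ _)) ⟩
            0# * bar 1#    ≡⟨ cong (_* bar 1#) t₁≡0 ⟨
            t₁ * bar 1#    ∎)
            where
            t₁≡0 : t₁ ≡ 0#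
            t₁≡0 = x*y≡0⇒y≡0 1ω-independent (begin
              wedge 1# ω * t₁
                ≡⟨ solve 3 (λ t₁ t₂ w → :wedge :1 w :* t₁ := (t₂ :* :1 :+ t₁ :* :bar :1) :* w :+ (t₂ :* w :+ t₁ :* :bar w)) refl t₁ (bar t₂) ω ⟩
              x₀ 1# * ω + x₀ ω
                ≡⟨ cong₂ (λ s t → s * ω + t) x₀1≡0 x₀ω≡0 ⟩
              0# * ω + 0#   ≡⟨ solve 1 (λ w → :0 :* w :+ :0 := :0) refl ω ⟩
              0#  ∎)
            t₂≡0 : t₂ ≡ 0#
            t₂≡0 = begin
              t₂  ≡⟨ solve 2 (λ t₁ t₂ → t₂ := :bar ((:bar t₂ :* :1 :+ t₁ :* :bar :1) :+ t₁)) refl t₁ t₂ ⟩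
              bar (x₀ 1# + t₁)  ≡⟨ cong₂ (λ s t → bar (s + t)) x₀1≡0 t₁≡0 ⟩
              bar (0# + 0#)  ≡⟨ solve 0 (:bar (:0 :+ :0) := :0) refl ⟩
              0#  ∎

      RankOneFactors : Set
      RankOneFactors = ∃[ c₁ ] ∃[ c₂ ] ∃[ d₁ ] ∃[ d₂ ]
        t₁ ≡ σ c₁ * d₁ × t₂ ≡ σ c₁ * d₂ × t₃ ≡ σ c₂ * d₁ × t₄ ≡ σ c₂ * d₂

      -- A 2 × 2 matrix of determinant 0 is a column times a row. Surjectivity of `σ` allows the
      -- column to be written as (σ c₁, σ c₂), which makes the first factor of B + Y B̄ equal to σ
      -- of the linear form c₁ x̄ + c₂ x.
      rank-one : RankOneFactors
      rank-one = split (t₁ ≟ 0#) (t₂ ≟ 0#)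
       where
       split : Dec (t₁ ≡ 0#) → Dec (t₂ ≡ 0#) → RankOneFactors
       split (yes t₁≡0) (yes t₂≡0) = 0# , 1# , t₃ , t₄ ,
        trans t₁≡0 (solve 1 (λ t → :0 := :σ :0 :* t) refl t₃) ,
        trans t₂≡0 (solve 1 (λ t → :0 := :σ :0 :* t) refl t₄) ,
        solve 1 (λ t → t := :σ :1 :* t) refl t₃ ,
        solve 1 (λ t → t := :σ :1 :* t) refl t₄
       split (no t₁≢0) _ = 1# , σ⁻¹ m , t₁ , t₂ ,
        solve 1 (λ t → t := :σ :1 :* t) refl t₁ ,
        solve 1 (λ t → t := :σ :1 :* t) refl t₂ ,
        t₃≡ ,
        *-cancelˡ t₁≢0 (begin
          t₁ * t₄  ≡⟨ t₁t₄≡t₂t₃ ⟩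
          t₂ * t₃  ≡⟨ cong (t₂ *_) t₃≡ ⟩
          t₂ * (σ (σ⁻¹ m) * t₁)   ≡⟨ solve 3 (λ t s u → t :* (s :* u) := u :* (s :* t)) refl t₂ (σ (σ⁻¹ m)) t₁ ⟩
          t₁ * (σ (σ⁻¹ m) * t₂)   ∎)
        where
        m = proj₁ (divide t₁≢0 t₃)
        t₃≡ : t₃ ≡ σ (σ⁻¹ m) * t₁
        t₃≡ = begin
          t₃  ≡⟨ proj₂ (divide t₁≢0 t₃) ⟨
          t₁ * m  ≡⟨ *-comm t₁ m ⟩
          m * t₁  ≡⟨ cong (_* t₁) (σ-σ⁻¹ m) ⟨
          σ (σ⁻¹ m) * t₁   ∎
       split (yes _) (no t₂≢0) = 1# , σ⁻¹ m , t₁ , t₂ ,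
        solve 1 (λ t → t := :σ :1 :* t) refl t₁ ,
        solve 1 (λ t → t := :σ :1 :* t) refl t₂ ,
        *-cancelˡ t₂≢0 (begin
          t₂ * t₃  ≡⟨ t₁t₄≡t₂t₃ ⟨
          t₁ * t₄  ≡⟨ cong (t₁ *_) t₄≡ ⟩
          t₁ * (σ (σ⁻¹ m) * t₂)   ≡⟨ solve 3 (λ t s u → t :* (s :* u) := u :* (s :* t)) refl t₁ (σ (σ⁻¹ m)) t₂ ⟩
          t₂ * (σ (σ⁻¹ m) * t₁)   ∎) ,
        t₄≡
        where
        m = proj₁ (divide t₂≢0 t₄)
        t₄≡ : t₄ ≡ σ (σ⁻¹ m) * t₂
        t₄≡ = begin
          t₄  ≡⟨ proj₂ (divide t₂≢0 t₄) ⟨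
          t₂ * m  ≡⟨ *-comm t₂ m ⟩
          m * t₂  ≡⟨ cong (_* t₂) (σ-σ⁻¹ m) ⟨
          σ (σ⁻¹ m) * t₂   ∎

      -- The invariants e, P and R of B + Y B̄ are N Y + 1 times those of B, so both sides of the
      -- condition scale by the same nonzero factor.
      covariant-scaled : (N t₁ + N t₄ + (N t₂ + N t₃)) * σ (t₁ * bar t₂ + t₃ * bar t₄) ≡
                         σ (N t₁ + N t₄ + (N t₂ + N t₃)) * (t₁ * bar t₃ + t₂ * bar t₄) →
                         N Y ≢ 1# → e * σ P ≡ σ e * R
      covariant-scaled eq NY≢1 = *-cancelˡ (x*y≢0 n≢0 (σ≢0 n≢0)) (begin
        n * σ n * (e * σ P)       ≡⟨ solve 3 (λ n e P → n :* :σ n :* (e :* :σ P) := n :* e :* :σ (n :* P)) refl n e P ⟩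
        n * e * σ (n * P)  ≡⟨ cong₂ (λ s t → s * σ t) e-scaled P-scaled ⟨
        _  ≡⟨ eq ⟩
        _  ≡⟨ cong₂ (λ s t → σ s * t) e-scaled R-scaled ⟩
        σ (n * e) * (n * R)       ≡⟨ solve 3 (λ n e R → :σ (n :* e) :* (n :* R) := n :* :σ n :* (:σ e :* R)) refl n e R ⟩
        n * σ n * (σ e * R)       ∎)
        where
        n = N Y + 1#
        n≢0 : n ≢ 0#
        n≢0 n≡0 = NY≢1 (x+y≡0⇒x≡y n≡0)
        e-scaled : N t₁ + N t₄ + (N t₂ + N t₃) ≡ n * e
        e-scaled = solve 5 (λ a b c d Y → :N (a :+ Y :* :bar d) :+ :N (d :+ Y :* :bar a) :+ (:N (b :+ Y :* :bar c) :+ :N (c :+ Y :* :bar b))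
          := (:N Y :+ :1) :* (:N a :+ :N d :+ (:N b :+ :N c))) refl a b c d Y
        P-scaled : t₁ * bar t₂ + t₃ * bar t₄ ≡ n * P
        P-scaled = solve 5 (λ a b c d Y → (a :+ Y :* :bar d) :* :bar (b :+ Y :* :bar c) :+ (c :+ Y :* :bar b) :* :bar (d :+ Y :* :bar a)
          := (:N Y :+ :1) :* (a :* :bar b :+ c :* :bar d)) refl a b c d Y
        R-scaled : t₁ * bar t₃ + t₂ * bar t₄ ≡ n * R
        R-scaled = solve 5 (λ a b c d Y → (a :+ Y :* :bar d) :* :bar (c :+ Y :* :bar b) :+ (b :+ Y :* :bar c) :* :bar (d :+ Y :* :bar a)
          := (:N Y :+ :1) :* (a :* :bar c :+ b :* :bar d)) refl a b c d Y

    -- The inequalities say that y ↦ y + Y ȳ and x ↦ c₁ x̄ + c₂ x are injective. The property is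
    -- isolated as a hypothesis because its proof sums over the field, whereas everything here is
    -- algebraic.
    NoMixedTerm : Set
    NoMixedTerm = ∀ Y c₁ c₂ s t → N Y ≢ 1# → N c₁ + N c₂ ≢ 0# →
      (∀ x → let z = c₁ * bar x + c₂ * x in B x + Y * bar (B x) ≡ σ z * (s * z + t * bar z)) →
      s ≡ 0# ⊎ t ≡ 0#

    factors⇒covariant : NoMixedTerm → ∀ Y root → N Y ≢ 1# → RankOneFactors Y root → e * σ P ≡ σ e * R
    factors⇒covariant noMixed Y root NY≢1 (c₁ , c₂ , d₁ , d₂ , t₁≡ , t₂≡ , t₃≡ , t₄≡) = covariant-scaled Y root
      (subst₂ (λ t₁ t₂ → (N t₁ + N T₄ + (N t₂ + N T₃)) * σ (t₁ * bar t₂ + T₃ * bar T₄) ≡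
                         σ (N t₁ + N T₄ + (N t₂ + N T₃)) * (t₁ * bar T₃ + t₂ * bar T₄)) (sym t₁≡) (sym t₂≡)
      (subst₂ (λ t₃ t₄ → (N (σ c₁ * d₁) + N t₄ + (N (σ c₁ * d₂) + N t₃)) * σ (σ c₁ * d₁ * bar (σ c₁ * d₂) + t₃ * bar t₄) ≡
                         σ (N (σ c₁ * d₁) + N t₄ + (N (σ c₁ * d₂) + N t₃)) * (σ c₁ * d₁ * bar t₃ + σ c₁ * d₂ * bar t₄)) (sym t₃≡) (sym t₄≡)
      factored)) NY≢1
      where
      T₃ = t₃ Y root
      T₄ = t₄ Y root
      D = N c₁ + N c₂
      e-factored : D ≢ 0#
      e-factored D≡0 = x*y≢0 (λ n≡0 → NY≢1 (x+y≡0⇒x≡y n≡0)) e≢0 (begin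
        (N Y + 1#) * e
          ≡⟨ solve 5 (λ a b c d Y → (:N Y :+ :1) :* (:N a :+ :N d :+ (:N b :+ :N c)) :=
               :N (a :+ Y :* :bar d) :+ :N (d :+ Y :* :bar a) :+ (:N (b :+ Y :* :bar c) :+ :N (c :+ Y :* :bar b))) refl a b c d Y ⟩
        N (t₁ Y root) + N T₄ + (N (t₂ Y root) + N T₃)
          ≡⟨ cong₂ _+_ (cong₂ (λ s t → N s + N t) t₁≡ t₄≡) (cong₂ (λ s t → N s + N t) t₂≡ t₃≡) ⟩
        N (σ c₁ * d₁) + N (σ c₂ * d₂) + (N (σ c₁ * d₂) + N (σ c₂ * d₁))
          ≡⟨ solve 4 (λ c₁ c₂ d₁ d₂ → :N (:σ c₁ :* d₁) :+ :N (:σ c₂ :* d₂) :+ (:N (:σ c₁ :* d₂) :+ :N (:σ c₂ :* d₁)) :=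
               :σ (:N c₁ :+ :N c₂) :* (:N d₁ :+ :N d₂)) refl c₁ c₂ d₁ d₂ ⟩
        σ D * (N d₁ + N d₂)     ≡⟨ cong (λ t → σ t * (N d₁ + N d₂)) D≡0 ⟩
        σ 0# * (N d₁ + N d₂)    ≡⟨ solve 1 (λ t → :σ :0 :* t := :0) refl _ ⟩
        0#  ∎)
      -- Cramer's rule for d₁ x̄ + d₂ x = s z + t z̄ with z = c₁ x̄ + c₂ x: the determinant of the
      -- system is `D`, and `s′` and `t′` are the numerators.
      s′ = d₁ * bar c₁ + d₂ * bar c₂
      t′ = d₁ * c₂ + d₂ * c₁
      s = proj₁ (divide e-factored s′)
      t = proj₁ (divide e-factored t′)
      Ds≡s′ = proj₂ (divide e-factored s′)
      Dt≡t′ = proj₂ (divide e-factored t′)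
      substituted : ∀ x → let z = c₁ * bar x + c₂ * x in B x + Y * bar (B x) ≡ σ z * (s * z + t * bar z)
      substituted x = *-cancelˡ e-factored (begin
        D * (B x + Y * bar (B x))
          ≡⟨ cong (D *_) (solve 6 (λ a b c d Y x → :B a b c d x :+ Y :* :bar (:B a b c d x) :=
               :B (a :+ Y :* :bar d) (b :+ Y :* :bar c) (c :+ Y :* :bar b) (d :+ Y :* :bar a) x) refl a b c d Y x) ⟩
        D * (t₁ Y root * σ (bar x) * bar x + t₂ Y root * σ (bar x) * x + T₃ * σ x * bar x + T₄ * σ x * x)
          ≡⟨ cong₂ (λ u v → D * (u + v)) (cong₂ _+_ (cong₂ (λ u v → u * σ (bar x) * bar x + v * σ (bar x) * x) t₁≡ t₂≡)
               (cong (λ u → u * σ x * bar x) t₃≡)) (cong (λ u → u * σ x * x) t₄≡) ⟩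
        D * (σ c₁ * d₁ * σ (bar x) * bar x + σ c₁ * d₂ * σ (bar x) * x + σ c₂ * d₁ * σ x * bar x + σ c₂ * d₂ * σ x * x)
          ≡⟨ solve 5 (λ c₁ c₂ d₁ d₂ x → let z = c₁ :* :bar x :+ c₂ :* x in
               (:N c₁ :+ :N c₂) :* :B (:σ c₁ :* d₁) (:σ c₁ :* d₂) (:σ c₂ :* d₁) (:σ c₂ :* d₂) x :=
               :σ z :* ((d₁ :* :bar c₁ :+ d₂ :* :bar c₂) :* z :+ (d₁ :* c₂ :+ d₂ :* c₁) :* :bar z)) refl c₁ c₂ d₁ d₂ x ⟩
        σ z * (s′ * z + t′ * bar z)
          ≡⟨ cong₂ (λ u v → σ z * (u * z + v * bar z)) Ds≡s′ Dt≡t′ ⟨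
        σ z * (D * s * z + D * t * bar z)
          ≡⟨ solve 6 (λ w D s z t z′ → w :* (D :* s :* z :+ D :* t :* z′) := D :* (w :* (s :* z :+ t :* z′))) refl (σ z) D s z t (bar z) ⟩
        D * (σ z * (s * z + t * bar z))  ∎)
        where z = c₁ * bar x + c₂ * x
      s′≡0⊎t′≡0 : s′ ≡ 0# ⊎ t′ ≡ 0#
      s′≡0⊎t′≡0 = Sum.map
        (λ s≡0 → trans (sym Ds≡s′) (trans (cong (D *_) s≡0) (zeroʳ D)))
        (λ t≡0 → trans (sym Dt≡t′) (trans (cong (D *_) t≡0) (zeroʳ D)))
        (noMixed Y c₁ c₂ s t NY≢1 e-factored substituted)
      -- For the factored form e is σ D (N d₁ + N d₂), P is σ D d₁ d̄₂ and R is σ (c₁ c̄₂) (N d₁ + N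
      -- d₂), so e σ P + σ e R is a multiple of σ of this expression. It vanishes when d₁ x̄ + d₂ x
      -- is a multiple of z or of z̄.
      proportional : D * (d₁ * bar d₂) + (N d₁ + N d₂) * (c₁ * bar c₂) ≡ 0#
      proportional = [ (λ s′≡0 → begin
        D * (d₁ * bar d₂) + (N d₁ + N d₂) * (c₁ * bar c₂)
          ≡⟨ solve 4 (λ c₁ c₂ d₁ d₂ → let s = d₁ :* :bar c₁ :+ d₂ :* :bar c₂ in
               (:N c₁ :+ :N c₂) :* (d₁ :* :bar d₂) :+ (:N d₁ :+ :N d₂) :* (c₁ :* :bar c₂) :=
               :bar d₂ :* c₁ :* s :+ d₁ :* :bar c₂ :* :bar s) refl c₁ c₂ d₁ d₂ ⟩
        bar d₂ * c₁ * s′ + d₁ * bar c₂ * bar s′   ≡⟨ cong (λ u → bar d₂ * c₁ * u + d₁ * bar c₂ * bar u) s′≡0 ⟩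
        bar d₂ * c₁ * 0# + d₁ * bar c₂ * bar 0#   ≡⟨ solve 2 (λ u v → u :* :0 :+ v :* :bar :0 := :0) refl _ _ ⟩
        0#  ∎) , (λ t′≡0 → begin
        D * (d₁ * bar d₂) + (N d₁ + N d₂) * (c₁ * bar c₂)
          ≡⟨ solve 4 (λ c₁ c₂ d₁ d₂ → let t = d₁ :* c₂ :+ d₂ :* c₁ in
               (:N c₁ :+ :N c₂) :* (d₁ :* :bar d₂) :+ (:N d₁ :+ :N d₂) :* (c₁ :* :bar c₂) :=
               :bar d₂ :* :bar c₂ :* t :+ d₁ :* c₁ :* :bar t) refl c₁ c₂ d₁ d₂ ⟩
        bar d₂ * bar c₂ * t′ + d₁ * c₁ * bar t′   ≡⟨ cong (λ u → bar d₂ * bar c₂ * u + d₁ * c₁ * bar u) t′≡0 ⟩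
        bar d₂ * bar c₂ * 0# + d₁ * c₁ * bar 0#   ≡⟨ solve 2 (λ u v → u :* :0 :+ v :* :bar :0 := :0) refl _ _ ⟩
        0#  ∎) ]′ s′≡0⊎t′≡0
      factored :
        (N (σ c₁ * d₁) + N (σ c₂ * d₂) + (N (σ c₁ * d₂) + N (σ c₂ * d₁))) * σ (σ c₁ * d₁ * bar (σ c₁ * d₂) + σ c₂ * d₁ * bar (σ c₂ * d₂)) ≡
        σ (N (σ c₁ * d₁) + N (σ c₂ * d₂) + (N (σ c₁ * d₂) + N (σ c₂ * d₁))) * (σ c₁ * d₁ * bar (σ c₂ * d₁) + σ c₁ * d₂ * bar (σ c₂ * d₂))
      factored = x+y≡0⇒x≡y (begin
        _ ≡⟨ solve 4 (λ c₁ c₂ d₁ d₂ →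
               (:N (:σ c₁ :* d₁) :+ :N (:σ c₂ :* d₂) :+ (:N (:σ c₁ :* d₂) :+ :N (:σ c₂ :* d₁)))
                 :* :σ (:σ c₁ :* d₁ :* :bar (:σ c₁ :* d₂) :+ :σ c₂ :* d₁ :* :bar (:σ c₂ :* d₂)) :+
               :σ (:N (:σ c₁ :* d₁) :+ :N (:σ c₂ :* d₂) :+ (:N (:σ c₁ :* d₂) :+ :N (:σ c₂ :* d₁)))
                 :* (:σ c₁ :* d₁ :* :bar (:σ c₂ :* d₁) :+ :σ c₁ :* d₂ :* :bar (:σ c₂ :* d₂)) :=
               :σ (:σ (:N c₁ :+ :N c₂)) :* (:N d₁ :+ :N d₂)
                 :* :σ ((:N c₁ :+ :N c₂) :* (d₁ :* :bar d₂) :+ (:N d₁ :+ :N d₂) :* (c₁ :* :bar c₂)))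
               refl c₁ c₂ d₁ d₂ ⟩
        σ (σ D) * (N d₁ + N d₂) * σ (D * (d₁ * bar d₂) + (N d₁ + N d₂) * (c₁ * bar c₂))
          ≡⟨ cong (λ u → σ (σ D) * (N d₁ + N d₂) * σ u) proportional ⟩
        σ (σ D) * (N d₁ + N d₂) * σ 0#
          ≡⟨ solve 1 (λ u → u :* :σ :0 := :0) refl _ ⟩
        0#  ∎)

    noMixedTerm⇒covariant : NoMixedTerm → Nondegenerate → e * σ P ≡ σ e * R
    noMixedTerm⇒covariant noMixed nondeg = split (N Y ≟ 1#)
      where
      Y = proj₁ determinant-root
      root = proj₂ determinant-root
      split : Dec (N Y ≡ 1#) → e * σ P ≡ σ e * R
      split (yes NY≡1) = let x , x≢0 , q≡0 = isotropic-vector Y root NY≡1 in isotropic⇒covariant nondeg x≢0 q≡0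
      split (no  NY≢1) = factors⇒covariant noMixed Y root NY≢1 (rank-one Y root)

-- Frobenius powers, traces and additive Hilbert 90 in the field of order 2^(2k).

module Frobenius {n : ℕ} (K : DiscreteField (Fin (suc n))) (k : ℕ) (k>0 : k ℕ.> 0)
  (order : suc n ≡ 2 ℕ.^ (k ℕ.+ k)) where

  open FiniteFieldProperties K
  open import Algebra.Properties.Monoid.Mult +-monoid using (×-homo-+)
  open ≡-Reasoning

  2^·1 : ∀ j → (2 ℕ.^ j) · 1# ≡ (1# + 1#) ^ j
  2^·1 zero    = +-identityʳ 1#
  2^·1 (suc j) = begin
    (2 ℕ.^ j ℕ.+ (2 ℕ.^ j ℕ.+ 0)) · 1#    ≡⟨ cong (λ t → (2 ℕ.^ j ℕ.+ t) · 1#) (ℕ.+-identityʳ _) ⟩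
    (2 ℕ.^ j ℕ.+ 2 ℕ.^ j) · 1#  ≡⟨ ×-homo-+ 1# (2 ℕ.^ j) (2 ℕ.^ j) ⟩
    (2 ℕ.^ j) · 1# + (2 ℕ.^ j) · 1#       ≡⟨ cong (λ t → t + t) (2^·1 j) ⟩
    (1# + 1#) ^ j + (1# + 1#) ^ j  ≡⟨ cong (λ t → t + t) (*-identityˡ _) ⟨
    1# * (1# + 1#) ^ j + 1# * (1# + 1#) ^ j  ≡⟨ distribʳ _ 1# 1# ⟨
    (1# + 1#) * (1# + 1#) ^ j  ∎

  char-2 : 1# + 1# ≡ 0#
  char-2 = ^-zero⇒zero (k ℕ.+ k) (trans (sym (2^·1 (k ℕ.+ k))) (trans (cong (_· 1#) (sym order)) [1+n]·1≡0))

  double : ∀ x → x + x ≡ 0#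
  double x = begin
    x + x  ≡⟨ cong₂ _+_ (*-identityʳ x) (*-identityʳ x) ⟨
    x * 1# + x * 1#  ≡⟨ distribˡ x 1# 1# ⟨
    x * (1# + 1#)    ≡⟨ cong (x *_) char-2 ⟩
    x * 0#  ≡⟨ zeroʳ x ⟩
    0#  ∎

  square : ∀ x → x ^ 2 ≡ x * x
  square x = cong (x *_) (*-identityʳ x)

  square-+ : ∀ x y → (x + y) ^ 2 ≡ x ^ 2 + y ^ 2
  square-+ x y = begin
    (x + y) ^ 2  ≡⟨ square (x + y) ⟩
    (x + y) * (x + y)  ≡⟨ distribʳ _ x y ⟩
    x * (x + y) + y * (x + y)  ≡⟨ cong₂ _+_ (distribˡ x x y) (distribˡ y x y) ⟩
    x * x + x * y + (y * x + y * y)    ≡⟨ +-assoc _ _ _ ⟩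
    x * x + (x * y + (y * x + y * y))  ≡⟨ cong (x * x +_) (+-assoc _ _ _) ⟨
    x * x + (x * y + y * x + y * y)    ≡⟨ cong (λ t → x * x + (x * y + t + y * y)) (*-comm y x) ⟩
    x * x + (x * y + x * y + y * y)    ≡⟨ cong (λ t → x * x + (t + y * y)) (double (x * y)) ⟩
    x * x + (0# + y * y)  ≡⟨ cong (x * x +_) (+-identityˡ _) ⟩
    x * x + y * y  ≡⟨ cong₂ _+_ (square x) (square y) ⟨
    x ^ 2 + y ^ 2  ∎

  frob : ℕ → F → F
  frob i x = x ^ (2 ℕ.^ i)

  frob-0 : ∀ x → frob 0 x ≡ x
  frob-0 = *-identityʳ

  frob-+ : ∀ i x y → frob i (x + y) ≡ frob i x + frob i y
  frob-+ zero    x y = trans (frob-0 _) (sym (cong₂ _+_ (frob-0 x) (frob-0 y)))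
  frob-+ (suc i) x y = begin
    (x + y) ^ (2 ℕ.* 2 ℕ.^ i)  ≡⟨ ^-assocʳ (x + y) 2 (2 ℕ.^ i) ⟨
    frob i ((x + y) ^ 2)  ≡⟨ cong (frob i) (square-+ x y) ⟩
    frob i (x ^ 2 + y ^ 2)  ≡⟨ frob-+ i _ _ ⟩
    frob i (x ^ 2) + frob i (y ^ 2)       ≡⟨ cong₂ _+_ (^-assocʳ x 2 (2 ℕ.^ i)) (^-assocʳ y 2 (2 ℕ.^ i)) ⟩
    frob (suc i) x + frob (suc i) y       ∎

  frob-* : ∀ i x y → frob i (x * y) ≡ frob i x * frob i y
  frob-* i x y = ^-distrib-* x y (2 ℕ.^ i)

  frob-1 : ∀ i → frob i 1# ≡ 1#
  frob-1 i = 1^ (2 ℕ.^ i)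

  frob-frob : ∀ i j x → frob i (frob j x) ≡ frob (i ℕ.+ j) x
  frob-frob i j x = begin
    (x ^ (2 ℕ.^ j)) ^ (2 ℕ.^ i)   ≡⟨ ^-assocʳ x (2 ℕ.^ j) (2 ℕ.^ i) ⟩
    x ^ (2 ℕ.^ j ℕ.* 2 ℕ.^ i)     ≡⟨ cong (x ^_) (ℕ.^-distribˡ-+-* 2 j i) ⟨
    frob (j ℕ.+ i) x  ≡⟨ cong (λ t → frob t x) (ℕ.+-comm j i) ⟩
    frob (i ℕ.+ j) x  ∎

  frob-comm : ∀ i j x → frob i (frob j x) ≡ frob j (frob i x)
  frob-comm i j x = trans (frob-frob i j x) (trans (cong (λ t → frob t x) (ℕ.+-comm i j)) (sym (frob-frob j i x)))

  frob-period : ∀ j x → frob (j ℕ.* (k ℕ.+ k)) x ≡ x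
  frob-period zero    x = frob-0 x
  frob-period (suc j) x = begin
    frob (k ℕ.+ k ℕ.+ j ℕ.* (k ℕ.+ k)) x  ≡⟨ frob-frob (k ℕ.+ k) _ x ⟨
    frob (k ℕ.+ k) (frob (j ℕ.* (k ℕ.+ k)) x)     ≡⟨ cong (frob (k ℕ.+ k)) (frob-period j x) ⟩
    x ^ (2 ℕ.^ (k ℕ.+ k))  ≡⟨ cong (x ^_) order ⟨
    x ^ suc n  ≡⟨ x^[1+n]≡x x ⟩
    x  ∎

  -- The sum x + x^(2^m) + ... of d conjugates, in Horner form. The number of terms is free, so the
  -- same function serves as the trace over k/m steps and as a partial trace over ℓ/m steps.
  tr : ℕ → ℕ → F → F
  tr m zero    x = 0#
  tr m (suc d) x = x + frob m (tr m d x)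

  frob-0# : ∀ i → frob i 0# ≡ 0#
  frob-0# i = 0^>0 (ℕ.m^n>0 2 i)

  tr-+ : ∀ m d x y → tr m d (x + y) ≡ tr m d x + tr m d y
  tr-+ m zero    x y = sym (+-identityˡ 0#)
  tr-+ m (suc d) x y = begin
    x + y + frob m (tr m d (x + y))  ≡⟨ cong (λ t → x + y + frob m t) (tr-+ m d x y) ⟩
    x + y + frob m (tr m d x + tr m d y)  ≡⟨ cong (x + y +_) (frob-+ m _ _) ⟩
    x + y + (frob m (tr m d x) + frob m (tr m d y))       ≡⟨ interchange x y _ _ ⟩
    x + frob m (tr m d x) + (y + frob m (tr m d y))       ∎
    where
    open import Algebra.Bundles using (CommutativeRing)
    open import Algebra.Properties.CommutativeSemigroup
      (CommutativeRing.+-commutativeSemigroup commutativeRing) using (interchange)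

  tr-0# : ∀ m d → tr m d 0# ≡ 0#
  tr-0# m zero    = refl
  tr-0# m (suc d) = trans (+-identityˡ _) (trans (cong (frob m) (tr-0# m d)) (frob-0# m))

  tr-frob : ∀ i m d x → tr m d (frob i x) ≡ frob i (tr m d x)
  tr-frob i m zero    x = sym (frob-0# i)
  tr-frob i m (suc d) x = begin
    frob i x + frob m (tr m d (frob i x))   ≡⟨ cong (λ t → frob i x + frob m t) (tr-frob i m d x) ⟩
    frob i x + frob m (frob i (tr m d x))   ≡⟨ cong (frob i x +_) (frob-comm m i _) ⟩
    frob i x + frob i (frob m (tr m d x))   ≡⟨ frob-+ i _ _ ⟨
    frob i (x + frob m (tr m d x))          ∎

  tr-comm : ∀ m d m′ d′ x → tr m d (tr m′ d′ x) ≡ tr m′ d′ (tr m d x)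
  tr-comm m d m′ zero     x = tr-0# m d
  tr-comm m d m′ (suc d′) x = begin
    tr m d (x + frob m′ (tr m′ d′ x))  ≡⟨ tr-+ m d _ _ ⟩
    tr m d x + tr m d (frob m′ (tr m′ d′ x))       ≡⟨ cong (tr m d x +_) (tr-frob m′ m d _) ⟩
    tr m d x + frob m′ (tr m d (tr m′ d′ x))       ≡⟨ cong (λ t → tr m d x + frob m′ t) (tr-comm m d m′ d′ x) ⟩
    tr m d x + frob m′ (tr m′ d′ (tr m d x))       ∎

  tr-snoc : ∀ m d x → tr m (suc d) x ≡ tr m d x + frob (d ℕ.* m) x
  tr-snoc m zero    x = trans (cong (x +_) (frob-0# m)) (trans (+-comm x 0#) (cong (0# +_) (sym (frob-0 x))))
  tr-snoc m (suc d) x = begin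
    x + frob m (tr m (suc d) x)  ≡⟨ cong (λ t → x + frob m t) (tr-snoc m d x) ⟩
    x + frob m (tr m d x + frob (d ℕ.* m) x)  ≡⟨ cong (x +_) (frob-+ m _ _) ⟩
    x + (frob m (tr m d x) + frob m (frob (d ℕ.* m) x)) ≡⟨ +-assoc _ _ _ ⟨
    tr m (suc d) x + frob m (frob (d ℕ.* m) x)  ≡⟨ cong (tr m (suc d) x +_) (frob-frob m (d ℕ.* m) x) ⟩
    tr m (suc d) x + frob (suc d ℕ.* m) x  ∎

  tr-telescope : ∀ m d x → tr m d (frob m x + x) ≡ frob (d ℕ.* m) x + x
  tr-telescope m d x = begin
    tr m d (frob m x + x)  ≡⟨ tr-+ m d _ _ ⟩
    tr m d (frob m x) + tr m d x  ≡⟨ cong (_+ tr m d x) (tr-frob m m d x) ⟩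
    frob m (tr m d x) + tr m d x  ≡⟨ cong (_+ tr m d x) (trans (sym (+-identityˡ _))
                                      (trans (cong (_+ frob m (tr m d x)) (sym (double x))) (+-assoc x x _))) ⟩
    x + tr m (suc d) x + tr m d x  ≡⟨ cong (λ t → x + t + tr m d x) (tr-snoc m d x) ⟩
    x + (tr m d x + frob (d ℕ.* m) x) + tr m d x   ≡⟨ cong (λ t → x + t + tr m d x) (+-comm _ _) ⟩
    x + (frob (d ℕ.* m) x + tr m d x) + tr m d x   ≡⟨ +-assoc _ _ _ ⟩
    x + (frob (d ℕ.* m) x + tr m d x + tr m d x)   ≡⟨ cong (x +_) (+-assoc _ _ _) ⟩
    x + (frob (d ℕ.* m) x + (tr m d x + tr m d x)) ≡⟨ cong (λ t → x + (frob (d ℕ.* m) x + t)) (double _) ⟩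
    x + (frob (d ℕ.* m) x + 0#)  ≡⟨ cong (x +_) (+-identityʳ _) ⟩
    x + frob (d ℕ.* m) x  ≡⟨ +-comm _ _ ⟩
    frob (d ℕ.* m) x + x  ∎

  tr-1 : ∀ m d → tr m d 1# ≡ d · 1#
  tr-1 m zero    = refl
  tr-1 m (suc d) = cong (1# +_) (trans (cong (frob m) (tr-1 m d)) (frob-· d))
    where
    frob-· : ∀ d → frob m (d · 1#) ≡ d · 1#
    frob-· zero    = frob-0# m
    frob-· (suc d) = trans (frob-+ m 1# (d · 1#)) (cong₂ _+_ (frob-1 m) (frob-· d))

  sum-tr : ∀ m d x → sum {d} (λ i → x ^ (2 ℕ.^ (m ℕ.* toℕ i))) ≡ tr m d x
  sum-tr m d x = trans (sum-cong-≗ λ i → cong (λ t → frob t x) (ℕ.*-comm m (toℕ {d} i))) (go d)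
    where
    frob-sum : ∀ {d} (t : Fin d → F) → frob m (sum t) ≡ sum (frob m ∘ t)
    frob-sum {zero}  t = frob-0# m
    frob-sum {suc d} t = trans (frob-+ m _ _) (cong (frob m (t zero) +_) (frob-sum (t ∘ suc)))
    go : ∀ d → sum {d} (λ i → frob (toℕ i ℕ.* m) x) ≡ tr m d x
    go zero    = refl
    go (suc d) = cong₂ _+_ (frob-0 x) (begin
      sum {d} (λ i → frob (m ℕ.+ toℕ i ℕ.* m) x)  ≡⟨ sum-cong-≗ {d} (λ i → frob-frob m (toℕ i ℕ.* m) x) ⟨
      sum {d} (λ i → frob m (frob (toℕ i ℕ.* m) x))  ≡⟨ frob-sum {d} _ ⟨
      frob m (sum {d} (λ i → frob (toℕ i ℕ.* m) x))  ≡⟨ cong (frob m) (go d) ⟩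
      frob m (tr m d x)  ∎)

  sum-single : ∀ {d} (t : Fin d → F) i → (∀ j → j ≢ i → t j ≡ 0#) → sum t ≡ t i
  sum-single {suc d} t i others = begin
    sum t  ≡⟨ sum-remove {i = i} t ⟩
    t i + sum (t ∘ punchIn i)  ≡⟨ cong (t i +_) (sum-cong-≗ λ j → others _ (Fin.punchInᵢ≢i i j)) ⟩
    t i + sum {d} (λ _ → 0#)  ≡⟨ cong (t i +_) (sum-replicate-zero d) ⟩
    t i + 0#  ≡⟨ +-identityʳ _ ⟩
    t i  ∎

  -- Pairing the trace with x^{n-1} = x⁻¹ and summing over the field leaves only the
  -- term x · x⁻¹, because the other exponents are not divisible by n.
  trace-nonzero : ∀ m d → d ℕ.* m ≡ k ℕ.+ k → ∃ λ x → tr m d x ≢ 0#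
  trace-nonzero m zero    0≡2k = contradiction (subst (ℕ._> 0) (sym 0≡2k) (ℕ.<-≤-trans k>0 (ℕ.m≤m+n k k))) λ ()
  trace-nonzero m (suc d) dm≡2k with Fin.any? (λ x → ¬? (tr m (suc d) x ≟ 0#))
  ... | yes found = found
  ... | no  none  = contradiction (begin
    sum (_^ n)  ≡⟨ sum-cong-≗ (λ x → trans (cong (λ t → x ^ t) exponent-0) (^-homo-* x (2 ℕ.^ (m ℕ.* 0)) (ℕ.pred n))) ⟩
    power-sum zero  ≡⟨ sum-single power-sum zero vanish ⟨
    sum power-sum  ≡⟨ ∑-comm {suc d} {suc n} (λ i x → frob (m ℕ.* toℕ i) x * x ^ (ℕ.pred n)) ⟩
    sum (λ x → sum {suc d} (λ i → frob (m ℕ.* toℕ i) x * x ^ (ℕ.pred n)))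
      ≡⟨ sum-cong-≗ (λ x → *-distribʳ-sum {suc d} (x ^ ℕ.pred n) (λ i → frob (m ℕ.* toℕ i) x)) ⟨
    sum (λ x → sum {suc d} (λ i → frob (m ℕ.* toℕ i) x) * x ^ (ℕ.pred n))
      ≡⟨ sum-cong-≗ (λ x → cong (_* x ^ ℕ.pred n) (trans (sum-tr m (suc d) x) (all-zero x))) ⟩
    sum (λ x → 0# * x ^ (ℕ.pred n))  ≡⟨ sum-cong-≗ (λ x → zeroˡ (x ^ ℕ.pred n)) ⟩
    sum {suc n} (λ _ → 0#)  ≡⟨ sum-replicate-zero (suc n) ⟩
    0#  ∎)
    (power-sum-nonzero n ℕ.∣-refl n>0)
    where
    all-zero : ∀ x → tr m (suc d) x ≡ 0#
    all-zero x = decidable-stable (_ ≟ 0#) λ ≢0 → none (x , ≢0)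
    suc-pred : suc (ℕ.pred n) ≡ n
    suc-pred = ℕ.suc-pred n {{ℕ.>-nonZero n>0}}
    power-sum : Fin (suc d) → F
    power-sum i = sum (λ x → frob (m ℕ.* toℕ i) x * x ^ (ℕ.pred n))
    exponent-0 : n ≡ 2 ℕ.^ (m ℕ.* 0) ℕ.+ ℕ.pred n
    exponent-0 = sym (trans (cong (λ t → 2 ℕ.^ t ℕ.+ ℕ.pred n) (ℕ.*-zeroʳ m)) suc-pred)
    vanish : ∀ i → i ≢ zero → power-sum i ≡ 0#
    vanish zero    0≢0 = contradiction refl 0≢0
    vanish (suc i) _   = trans
      (sum-cong-≗ (λ x → sym (^-homo-* x (2 ℕ.^ e) (ℕ.pred n))))
      (power-sum-zero (2 ℕ.^ e ℕ.+ ℕ.pred n) λ n∣ →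
        ℕ.<⇒≱ p<n (ℕ.∣⇒≤ {{ℕ.>-nonZero p>0}} (ℕ.∣m+n∣m⇒∣n (subst (n ∣_) exponent n∣) ℕ.∣-refl)))
      where
      m>0 : m ℕ.> 0
      m>0 = ℕ.n≢0⇒n>0 λ { refl → contradiction
        (subst (ℕ._> 0) (trans (sym dm≡2k) (ℕ.*-zeroʳ (suc d))) (ℕ.<-≤-trans k>0 (ℕ.m≤m+n k k))) λ () }
      e = m ℕ.* suc (toℕ i)
      e>0 : e ℕ.> 0
      e>0 = ℕ.*-mono-< m>0 (s≤s z≤n)
      e<2k : e ℕ.< k ℕ.+ k
      e<2k = subst (e ℕ.<_) (trans (ℕ.*-comm m (suc d)) dm≡2k)
        (ℕ.*-monoʳ-< m {{ℕ.>-nonZero m>0}} (s≤s (Fin.toℕ<n i)))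
      p = ℕ.pred (2 ℕ.^ e)
      1+p≡2^e : suc p ≡ 2 ℕ.^ e
      1+p≡2^e = ℕ.suc-pred (2 ℕ.^ e) {{ℕ.m^n≢0 2 e}}
      p>0 : p ℕ.> 0
      p>0 = ℕ.s<s⁻¹ (subst (1 ℕ.<_) (sym 1+p≡2^e) (ℕ.^-monoʳ-< 2 (s≤s (s≤s z≤n)) e>0))
      p<n : p ℕ.< n
      p<n = ℕ.s<s⁻¹ (subst₂ ℕ._<_ (sym 1+p≡2^e) (sym order) (ℕ.^-monoʳ-< 2 (s≤s (s≤s z≤n)) e<2k))
      exponent : 2 ℕ.^ e ℕ.+ ℕ.pred n ≡ n ℕ.+ p
      exponent = begin
        2 ℕ.^ e ℕ.+ ℕ.pred n    ≡⟨ cong (ℕ._+ ℕ.pred n) 1+p≡2^e ⟨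
        suc p ℕ.+ ℕ.pred n      ≡⟨ ℕ.+-comm (suc p) (ℕ.pred n) ⟩
        ℕ.pred n ℕ.+ suc p      ≡⟨ ℕ.+-suc (ℕ.pred n) p ⟩
        suc (ℕ.pred n) ℕ.+ p    ≡⟨ cong (ℕ._+ p) suc-pred ⟩
        n ℕ.+ p  ∎

  -- A trace value τ and its inverse are fixed by `frob m`, so the trace is linear over τ⁻¹ and a
  -- nonzero value can be normalized.
  trace-one : ∀ m d → d ℕ.* m ≡ k ℕ.+ k → ∃ λ θ → tr m d θ ≡ 1#
  trace-one m d dm≡2k with trace-nonzero m d dm≡2k
  ... | x , τ≢0 = x * τ⁻¹ , trans (tr-scale d) (*-inverseʳ τ≢0)
    where
    τ = tr m d x
    τ⁻¹ = τ ⁻¹[ τ≢0 ]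
    frob-τ : frob m τ ≡ τ
    frob-τ = begin
      frob m τ  ≡⟨ tr-frob m m d x ⟨
      tr m d (frob m x)  ≡⟨ +-identityʳ _ ⟨
      tr m d (frob m x) + 0#  ≡⟨ cong (tr m d (frob m x) +_) (double τ) ⟨
      tr m d (frob m x) + (τ + τ)     ≡⟨ +-assoc _ _ _ ⟨
      tr m d (frob m x) + τ + τ       ≡⟨ cong (_+ τ) (tr-+ m d (frob m x) x) ⟨
      tr m d (frob m x + x) + τ       ≡⟨ cong (_+ τ) (tr-telescope m d x) ⟩
      frob (d ℕ.* m) x + x + τ        ≡⟨ cong (λ t → frob t x + x + τ) (trans dm≡2k (sym (ℕ.*-identityˡ _))) ⟩
      frob (1 ℕ.* (k ℕ.+ k)) x + x + τ ≡⟨ cong (λ t → t + x + τ) (frob-period 1 x) ⟩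
      x + x + τ  ≡⟨ cong (_+ τ) (double x) ⟩
      0# + τ  ≡⟨ +-identityˡ τ ⟩
      τ  ∎
    frob-τ⁻¹ : frob m τ⁻¹ ≡ τ⁻¹
    frob-τ⁻¹ = *-cancelˡ τ≢0 (begin
      τ * frob m τ⁻¹  ≡⟨ cong (_* frob m τ⁻¹) frob-τ ⟨
      frob m τ * frob m τ⁻¹   ≡⟨ frob-* m τ τ⁻¹ ⟨
      frob m (τ * τ⁻¹)        ≡⟨ cong (frob m) (*-inverseʳ τ≢0) ⟩
      frob m 1#  ≡⟨ frob-1 m ⟩
      1#  ≡⟨ *-inverseʳ τ≢0 ⟨
      τ * τ⁻¹  ∎)
    tr-scale : ∀ d → tr m d (x * τ⁻¹) ≡ tr m d x * τ⁻¹
    tr-scale zero    = sym (zeroˡ _)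
    tr-scale (suc d) = begin
      x * τ⁻¹ + frob m (tr m d (x * τ⁻¹))  ≡⟨ cong (λ t → x * τ⁻¹ + frob m t) (tr-scale d) ⟩
      x * τ⁻¹ + frob m (tr m d x * τ⁻¹)  ≡⟨ cong (x * τ⁻¹ +_) (frob-* m _ _) ⟩
      x * τ⁻¹ + frob m (tr m d x) * frob m τ⁻¹    ≡⟨ cong (λ t → x * τ⁻¹ + frob m (tr m d x) * t) frob-τ⁻¹ ⟩
      x * τ⁻¹ + frob m (tr m d x) * τ⁻¹  ≡⟨ distribʳ _ _ _ ⟨
      (x + frob m (tr m d x)) * τ⁻¹  ∎

  -- The solution is the sum of the products of `tr m i y` with the i-th conjugate of an element θ
  -- of trace 1. `invariant` follows frob m h + h along the partial sums; at i = d the trace of θ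
  -- turns its first term into y and the trace of y removes the second.
  hilbert-90 : ∀ m d → d ℕ.* m ≡ k ℕ.+ k → ∀ y → tr m d y ≡ 0# → ∃ λ h → frob m h + h ≡ y
  hilbert-90 m d dm≡2k y try≡0 with trace-one m d dm≡2k
  ... | θ , trθ≡1 = h d , (begin
    frob m (h d) + h d  ≡⟨ invariant d ⟩
    y * frob m (tr m d θ) + tr m d y * frob (d ℕ.* m) θ  ≡⟨ cong₂ (λ s t → y * frob m s + t * frob (d ℕ.* m) θ) trθ≡1 try≡0 ⟩
    y * frob m 1# + 0# * frob (d ℕ.* m) θ  ≡⟨ cong₂ _+_ (trans (cong (y *_) (frob-1 m)) (*-identityʳ y)) (zeroˡ _) ⟩
    y + 0#  ≡⟨ +-identityʳ y ⟩
    y  ∎)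
    where
    h : ℕ → F
    h zero    = 0#
    h (suc i) = h i + tr m i y * frob (i ℕ.* m) θ
    open import Algebra.Bundles using (CommutativeRing)
    open import Algebra.Properties.CommutativeSemigroup
      (CommutativeRing.+-commutativeSemigroup commutativeRing) using (interchange)
    invariant : ∀ i → frob m (h i) + h i ≡ y * frob m (tr m i θ) + tr m i y * frob (i ℕ.* m) θ
    invariant zero = begin
      frob m 0# + 0#  ≡⟨ trans (+-identityʳ _) (frob-0# m) ⟩
      0#  ≡⟨ zeroʳ y ⟨
      y * 0#  ≡⟨ +-identityʳ _ ⟨
      y * 0# + 0#  ≡⟨ cong₂ (λ s t → y * s + t) (frob-0# m) (zeroˡ (frob 0 θ)) ⟨
      y * frob m 0# + 0# * frob 0 θ  ∎
    invariant (suc i) = begin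
      frob m (h i + S * v) + (h i + S * v)  ≡⟨ cong (_+ (h i + S * v)) (frob-+ m _ _) ⟩
      frob m (h i) + frob m (S * v) + (h i + S * v)  ≡⟨ interchange _ _ _ _ ⟩
      frob m (h i) + h i + (frob m (S * v) + S * v)  ≡⟨ cong (_+ (frob m (S * v) + S * v)) (invariant i) ⟩
      y * T + S * v + (frob m (S * v) + S * v)  ≡⟨ cong (y * T + S * v +_) (+-comm _ _) ⟩
      y * T + S * v + (S * v + frob m (S * v))  ≡⟨ +-assoc _ _ _ ⟩
      y * T + (S * v + (S * v + frob m (S * v)))  ≡⟨ cong (y * T +_) (+-assoc _ _ _) ⟨
      y * T + (S * v + S * v + frob m (S * v))  ≡⟨ cong (λ t → y * T + (t + frob m (S * v))) (double (S * v)) ⟩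
      y * T + (0# + frob m (S * v))  ≡⟨ cong (y * T +_) (+-identityˡ _) ⟩
      y * T + frob m (S * v)  ≡⟨ cong (y * T +_) (frob-* m S v) ⟩
      y * T + frob m S * frob m v  ≡⟨ cong (λ t → y * T + frob m S * t) (frob-frob m (i ℕ.* m) θ) ⟩
      y * T + frob m S * v′  ≡⟨ cong (y * T +_) (+-identityˡ _) ⟨
      y * T + (0# + frob m S * v′)  ≡⟨ cong (λ t → y * T + (t + frob m S * v′)) (double (y * v′)) ⟨
      y * T + (y * v′ + y * v′ + frob m S * v′)  ≡⟨ cong (y * T +_) (+-assoc _ _ _) ⟩
      y * T + (y * v′ + (y * v′ + frob m S * v′))  ≡⟨ +-assoc _ _ _ ⟨
      y * T + y * v′ + (y * v′ + frob m S * v′)  ≡⟨ cong₂ _+_ (distribˡ y T v′) (distribʳ v′ y (frob m S)) ⟨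
      y * (T + v′) + (y + frob m S) * v′  ≡⟨ cong (λ t → y * t + (y + frob m S) * v′) T+v′ ⟩
      y * frob m (tr m (suc i) θ) + tr m (suc i) y * v′          ∎
      where
      S = tr m i y
      v = frob (i ℕ.* m) θ
      v′ = frob (suc i ℕ.* m) θ
      T = frob m (tr m i θ)
      T+v′ : T + v′ ≡ frob m (tr m (suc i) θ)
      T+v′ = begin
        T + v′  ≡⟨ cong (T +_) (frob-frob m (i ℕ.* m) θ) ⟨
        T + frob m v  ≡⟨ frob-+ m _ _ ⟨
        frob m (tr m i θ + v)  ≡⟨ cong (frob m) (tr-snoc m i θ) ⟨
        frob m (tr m (suc i) θ)  ∎

  -- The absolute trace of a real x splits into its first k terms and their conjugates, which are
  -- equal, so it is 0 and Hilbert 90 for squaring applies.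
  artin-schreier-solvable : ∀ {x} → frob k x ≡ x → ∃ λ z → z * z + z ≡ x
  artin-schreier-solvable {x} x-real = proj₁ solution , trans (cong (_+ proj₁ solution) (sym (square _))) (proj₂ solution)
    where
    tr-split : ∀ i → tr 1 (i ℕ.+ k) x ≡ tr 1 i x + frob i (tr 1 k x)
    tr-split zero    = sym (trans (+-identityˡ _) (frob-0 _))
    tr-split (suc i) = begin
      x + frob 1 (tr 1 (i ℕ.+ k) x)  ≡⟨ cong (λ t → x + frob 1 t) (tr-split i) ⟩
      x + frob 1 (tr 1 i x + frob i (tr 1 k x))  ≡⟨ cong (x +_) (frob-+ 1 _ _) ⟩
      x + (frob 1 (tr 1 i x) + frob 1 (frob i (tr 1 k x)))   ≡⟨ +-assoc _ _ _ ⟨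
      tr 1 (suc i) x + frob 1 (frob i (tr 1 k x))  ≡⟨ cong (tr 1 (suc i) x +_) (frob-frob 1 i _) ⟩
      tr 1 (suc i) x + frob (suc i) (tr 1 k x)  ∎
    trace-0 : tr 1 (k ℕ.+ k) x ≡ 0#
    trace-0 = begin
      tr 1 (k ℕ.+ k) x  ≡⟨ tr-split k ⟩
      tr 1 k x + frob k (tr 1 k x)      ≡⟨ cong (tr 1 k x +_) (tr-frob k 1 k x) ⟨
      tr 1 k x + tr 1 k (frob k x)      ≡⟨ cong (λ t → tr 1 k x + tr 1 k t) x-real ⟩
      tr 1 k x + tr 1 k x  ≡⟨ double _ ⟩
      0#  ∎
    solution = hilbert-90 1 (k ℕ.+ k) (ℕ.*-identityʳ _) x trace-0

  module _ (ℓ : ℕ) where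

    private
      frob-inverse : ∀ i j {t} → i ℕ.+ j ≡ t ℕ.* (k ℕ.+ k) → ∀ x → frob i (frob j x) ≡ x
      frob-inverse i j {t} eq x = trans (frob-frob i j x) (trans (cong (λ s → frob s x) eq) (frob-period t x))

      2k-1 = ℕ.pred (k ℕ.+ k)

      1+2k-1 : suc 2k-1 ≡ k ℕ.+ k
      1+2k-1 = ℕ.suc-pred _ {{ℕ.>-nonZero (ℕ.<-≤-trans k>0 (ℕ.m≤m+n k k))}}

      ℓ+ℓ[2k-1] : ℓ ℕ.+ ℓ ℕ.* 2k-1 ≡ ℓ ℕ.* (k ℕ.+ k)
      ℓ+ℓ[2k-1] = trans (sym (ℕ.*-suc ℓ 2k-1)) (cong (ℓ ℕ.*_) 1+2k-1)

      nonreal : ∃ λ ω → frob k ω ≢ ω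
      -- A real unit has (q - 1)-st power 1, and some unit does not since q - 1 is less than the
      -- number q² - 1 of units.
      nonreal = ω , λ eq → ω^p≢1 (*-cancelˡ ω≢0 (begin
        ω * ω ^ p  ≡⟨ cong (ω ^_) 1+p≡2^k ⟩
        frob k ω  ≡⟨ eq ⟩
        ω  ≡⟨ *-identityʳ ω ⟨
        ω * 1#  ∎))
        where
        p = ℕ.pred (2 ℕ.^ k)
        1+p≡2^k : suc p ≡ 2 ℕ.^ k
        1+p≡2^k = ℕ.suc-pred (2 ℕ.^ k) {{ℕ.m^n≢0 2 k}}
        nontrivial : ∃ λ y → y ≢ 0# × y ^ p ≢ 1#
        nontrivial = power-nontrivial p
          (ℕ.s<s⁻¹ (subst (1 ℕ.<_) (sym 1+p≡2^k) (ℕ.^-monoʳ-< 2 (s≤s (s≤s z≤n)) k>0)))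
          (ℕ.s<s⁻¹ (subst₂ ℕ._<_ (sym 1+p≡2^k) (sym order)
            (ℕ.^-monoʳ-< 2 (s≤s (s≤s z≤n)) (subst (ℕ._< k ℕ.+ k) (ℕ.+-identityʳ k) (ℕ.+-monoʳ-< k k>0)))))
        ω = proj₁ nontrivial
        ω≢0 = proj₁ (proj₂ nontrivial)
        ω^p≢1 = proj₂ (proj₂ nontrivial)

    conjugationStructure : ConjugationStructure K
    conjugationStructure = record
      { 1+1≡0 = char-2
      ; bar = frob k
      ; σ = frob ℓ
      ; bar-+ = frob-+ k
      ; bar-* = frob-* k
      ; bar-bar = frob-inverse k k {1} (sym (ℕ.+-identityʳ _))
      ; σ-+ = frob-+ ℓ
      ; σ-* = frob-* ℓ
      ; bar-σ = frob-comm k ℓ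
      ; bar-1 = frob-1 k
      ; σ-1 = frob-1 ℓ
      ; σ-injective = λ {x} {y} eq → trans (sym (σ⁻¹-σ x)) (trans (cong (frob (ℓ ℕ.* 2k-1)) eq) (σ⁻¹-σ y))
      -- Squaring has period 2k, so 2k - 1 further squarings undo one and ℓ (2k - 1) undo ℓ; the
      -- same exponent 2k - 1 gives the square root.
      ; σ⁻¹ = frob (ℓ ℕ.* 2k-1)
      ; σ-σ⁻¹ = frob-inverse ℓ (ℓ ℕ.* 2k-1) {ℓ} ℓ+ℓ[2k-1]
      ; ω = proj₁ nonreal
      ; bar-ω≢ω = proj₂ nonreal
      ; √ = frob 2k-1
      ; √-square = λ x → trans (sym (square _)) (frob-inverse 1 2k-1 {1} (trans 1+2k-1 (sym (ℕ.+-identityʳ _))) x)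
      ; artin-schreier = artin-schreier-solvable
      }
      where
      σ⁻¹-σ : ∀ x → frob (ℓ ℕ.* 2k-1) (frob ℓ x) ≡ x
      σ⁻¹-σ = frob-inverse (ℓ ℕ.* 2k-1) ℓ {ℓ} (trans (ℕ.+-comm _ ℓ) ℓ+ℓ[2k-1])

-- Exponents modulo q² - 1 and parities.

module Arithmetic where

  open import Data.Nat.Base as ℕ using (ℕ; zero; suc; s≤s; _∸_; _^_; _+_; _*_; _<_; _≤_; _>_; NonZero; >-nonZero; >-nonZero⁻¹; s≤s⁻¹)
  open import Data.Nat.Coprimality as ℕ using (Coprime; coprime-divisor; gcd≡1⇒coprime)
  open import Data.Nat.Divisibility as ℕ
  open import Data.Nat.DivMod as ℕ using (_%_; _/_; m≡m%n+[m/n]*n; m%n<n; m/n*n≡m)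
  open import Data.Nat.GCD as ℕ using (module Bézout; gcd; gcd[m,n]∣m; gcd[m,n]∣n; gcd-greatest)
  open import Data.Nat.LCM as ℕ using (lcm; m∣lcm[m,n]; n∣lcm[m,n]; lcm-least)
  open import Data.Nat.Primality as ℕ using (Prime; prime⇒nonZero; prime⇒irreducible; euclidsLemma; prime[2])
  open import Data.Nat.Properties as ℕ
  open import Data.Nat.Tactic.RingSolver using (solve-∀)

  2∤1 : ¬ 2 ∣ 1
  2∤1 2∣1 = contradiction (∣⇒≤ 2∣1) λ { (s≤s ()) }

  2∣2^ : ∀ {j} → j > 0 → 2 ∣ 2 ^ j
  2∣2^ {suc j} _ = m∣m*n (2 ^ j)

  odd∤2^ : ∀ {d} → 1 < d → ¬ 2 ∣ d → ∀ j → ¬ d ∣ 2 ^ j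
  odd∤2^ 1<d 2∤d zero    d∣1 = <⇒≱ 1<d (∣⇒≤ d∣1)
  odd∤2^ {d} 1<d 2∤d (suc j) d∣2^ = odd∤2^ 1<d 2∤d j (coprime-divisor coprime d∣2^)
    where
    coprime : Coprime d 2
    coprime {i} (i∣d , i∣2) with prime⇒irreducible prime[2] i∣2
    ... | inj₁ i≡1  = i≡1
    ... | inj₂ refl = contradiction i∣d 2∤d

  2^k+1∤2^ℓ : ∀ {k} → k > 0 → ∀ ℓ → ¬ 2 ^ k + 1 ∣ 2 ^ ℓ
  2^k+1∤2^ℓ {k} k>0 = odd∤2^ (subst (1 <_) (+-comm 1 (2 ^ k)) (s≤s (m^n>0 2 k)))
    λ 2∣ → 2∤1 (∣m+n∣m⇒∣n 2∣ (2∣2^ k>0))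

  -- Exponents of the terms of (x^Q (αx + βx^q))^{q-1}.
  module _ (p Q : ℕ) (p>0 : p > 0) (∤Q : ¬ suc p + 1 ∣ Q) where

    private
      instance
        _ = >-nonZero p>0
        nz : NonZero (suc p + 1)
        nz = _

    exponent : ℕ → ℕ
    exponent i = Q * p + (i + suc p * (p ∸ i))

    exponent-factor : ∀ {i} → i ≤ p → exponent i ≡ p * (Q + 1 + (p ∸ i))
    exponent-factor {i} i≤p = begin
      Q * p + (i + suc p * (p ∸ i))  ≡⟨ rearrange Q p i (p ∸ i) ⟩
      Q * p + (i + (p ∸ i) + p * (p ∸ i))   ≡⟨ cong (λ t → Q * p + (t + p * (p ∸ i))) (m+[n∸m]≡n i≤p) ⟩
      Q * p + (p + p * (p ∸ i))  ≡⟨ collect Q p (p ∸ i) ⟩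
      p * (Q + 1 + (p ∸ i))  ∎
      where
      open ≡-Reasoning
      rearrange : ∀ Q p i j → Q * p + (i + suc p * j) ≡ Q * p + (i + j + p * j)
      rearrange = solve-∀
      collect : ∀ Q p j → Q * p + (p + p * j) ≡ p * (Q + 1 + j)
      collect = solve-∀

    exponent>0 : ∀ {i} → i ≤ p → exponent i > 0
    exponent>0 {i} i≤p = subst (_> 0) (sym (exponent-factor i≤p))
      (*-mono-< p>0 (≤-trans (m≤n+m 1 Q) (m≤m+n (Q + 1) (p ∸ i))))

    private
      ρ = Q % (suc p + 1)
      ρ>0 : ρ > 0
      ρ>0 = n≢0⇒n>0 λ ρ≡0 → ∤Q (m%n≡0⇒n∣m Q (suc p + 1) ρ≡0)

    -- With q = p + 1 the factor Q + 1 + (p - i) is congruent to Q - 1 - i modulo q + 1, so i must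
    -- be the residue of Q less 1. As q + 1 does not divide Q, this residue is at least 1 and i
    -- lands between 0 and p.
    special : ℕ
    special = ℕ.pred ρ

    1+special≡ρ : suc special ≡ ρ
    1+special≡ρ = suc-pred ρ {{>-nonZero ρ>0}}

    special≤p : special ≤ p
    special≤p = s≤s⁻¹ (s≤s⁻¹ (subst₂ _<_ (sym 1+special≡ρ) (+-comm (suc p) 1) (m%n<n Q (suc p + 1))))

    special-divides : suc p + 1 ∣ Q + 1 + (p ∸ special)
    special-divides = divides (suc (Q / (suc p + 1))) (begin
      Q + 1 + (p ∸ special)  ≡⟨ cong (λ t → t + 1 + (p ∸ special)) (trans (m≡m%n+[m/n]*n Q (suc p + 1)) (cong (_+ w) (sym 1+special≡ρ))) ⟩
      suc special + w + 1 + (p ∸ special)  ≡⟨ rearrange special w (p ∸ special) ⟩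
      suc (special + (p ∸ special)) + 1 + w  ≡⟨ cong (λ t → suc t + 1 + w) (m+[n∸m]≡n special≤p) ⟩
      suc p + 1 + w  ∎)
      where
      open ≡-Reasoning
      w = Q / (suc p + 1) * (suc p + 1)
      rearrange : ∀ s w t → suc s + w + 1 + t ≡ suc (s + t) + 1 + w
      rearrange = solve-∀

    exponent-special : p * (suc p + 1) ∣ exponent special
    exponent-special = subst (p * (suc p + 1) ∣_) (sym (exponent-factor special≤p)) (*-monoʳ-∣ p special-divides)

    -- Two multiples of q + 1 of the form Q + 1 + j with j ≤ p differ by at most p, which is less
    -- than q + 1.
    exponent-others : ∀ {i} → i ≤ p → p * (suc p + 1) ∣ exponent i → i ≡ special
    exponent-others {i} i≤p div = ∸-cancelˡ-≡ i≤p special≤p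
      (unique (m∸n≤m p i) (m∸n≤m p special) (*-cancelˡ-∣ p (subst (p * (suc p + 1) ∣_) (exponent-factor i≤p) div)) special-divides)
      where
      ordered : ∀ {j j′} → j ≤ j′ → j′ ≤ p → suc p + 1 ∣ Q + 1 + j → suc p + 1 ∣ Q + 1 + j′ → j ≡ j′
      ordered {j} {j′} j≤j′ j′≤p ∣j ∣j′ with j′ ∸ j in eq
      ... | zero  = ≤-antisym j≤j′ (m∸n≡0⇒m≤n eq)
      ... | suc δ = contradiction
        (∣⇒≤ (∣m+n∣m⇒∣n (subst (suc p + 1 ∣_)
          (trans (cong (Q + 1 +_) (sym (trans (cong (j +_) (sym eq)) (m+[n∸m]≡n j≤j′))))
                 (sym (+-assoc (Q + 1) j (suc δ)))) ∣j′) ∣j))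
        (<⇒≱ (≤-<-trans (subst (_≤ p) eq (≤-trans (m∸n≤m j′ j) j′≤p)) (s≤s (m≤m+n p 1))))
      unique : ∀ {j j′} → j ≤ p → j′ ≤ p → suc p + 1 ∣ Q + 1 + j → suc p + 1 ∣ Q + 1 + j′ → j ≡ j′
      unique {j} {j′} j≤p j′≤p ∣j ∣j′ with ≤-total j j′
      ... | inj₁ j≤j′ = ordered j≤j′ j′≤p ∣j ∣j′
      ... | inj₂ j′≤j = sym (ordered j′≤j j≤p ∣j′ ∣j)

  -- Raising r by a multiple of q² - 1 makes r - (Q + 1) a nonnegative multiple of q + 1.
  exponent-decomposition : ∀ {p r Q} → p > 0 → r ≡ Q + 1 [mod suc p + 1 ] →
                           ∃ λ s → r + (Q + 1) * (p * (suc p + 1)) ≡ Q + 1 + (suc p + 1) * s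
  exponent-decomposition {p} {r} {Q} p>0 (divides t |r-Q-1|≡) with ≤-total r (Q + 1)
  ... | inj₂ Q+1≤r = t + (Q + 1) * p , (begin
    r + (Q + 1) * (p * (suc p + 1))  ≡⟨ cong (_+ (Q + 1) * (p * (suc p + 1))) (m+[n∸m]≡n Q+1≤r) ⟨
    Q + 1 + (r ∸ (Q + 1)) + (Q + 1) * (p * (suc p + 1))
      ≡⟨ cong (λ z → Q + 1 + z + (Q + 1) * (p * (suc p + 1))) (trans (sym (m≤n⇒∣n-m∣≡n∸m Q+1≤r)) |r-Q-1|≡) ⟩
    Q + 1 + t * (suc p + 1) + (Q + 1) * (p * (suc p + 1)) ≡⟨ collect Q p t ⟩
    Q + 1 + (suc p + 1) * (t + (Q + 1) * p)        ∎)
    where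
    open ≡-Reasoning
    collect : ∀ Q p t → Q + 1 + t * (suc p + 1) + (Q + 1) * (p * (suc p + 1)) ≡ Q + 1 + (suc p + 1) * (t + (Q + 1) * p)
    collect = solve-∀
  ... | inj₁ r≤Q+1 = (Q + 1) * p ∸ t , +-cancelʳ-≡ (t * (suc p + 1)) _ _ (begin
    r + (Q + 1) * (p * (suc p + 1)) + t * (suc p + 1)   ≡⟨ swap r ((Q + 1) * (p * (suc p + 1))) (t * (suc p + 1)) ⟩
    r + t * (suc p + 1) + (Q + 1) * (p * (suc p + 1))   ≡⟨ cong (_+ (Q + 1) * (p * (suc p + 1))) r+t ⟩
    Q + 1 + (Q + 1) * (p * (suc p + 1))  ≡⟨ cong (Q + 1 +_) (reorder (Q + 1) p) ⟩
    Q + 1 + (suc p + 1) * ((Q + 1) * p)  ≡⟨ cong (λ z → Q + 1 + (suc p + 1) * z) (m∸n+n≡m t≤) ⟨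
    Q + 1 + (suc p + 1) * ((Q + 1) * p ∸ t + t)  ≡⟨ distribute (Q + 1) p ((Q + 1) * p ∸ t) t ⟩
    Q + 1 + (suc p + 1) * ((Q + 1) * p ∸ t) + t * (suc p + 1) ∎)
    where
    open ≡-Reasoning
    swap : ∀ a b c → a + b + c ≡ a + c + b
    swap = solve-∀
    reorder : ∀ a p → a * (p * (suc p + 1)) ≡ (suc p + 1) * (a * p)
    reorder = solve-∀
    distribute : ∀ a p s t → a + (suc p + 1) * (s + t) ≡ a + (suc p + 1) * s + t * (suc p + 1)
    distribute = solve-∀
    r+t : r + t * (suc p + 1) ≡ Q + 1
    r+t = trans (cong (r +_) (trans (sym |r-Q-1|≡) (m≤n⇒∣m-n∣≡n∸m r≤Q+1))) (m+[n∸m]≡n r≤Q+1)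
    t≤ : t ≤ (Q + 1) * p
    t≤ = ≤-trans (m≤m*n t (suc p + 1)) (≤-trans (m+n≤o⇒n≤o r (≤-reflexive r+t)) (m≤m*n (Q + 1) p {{>-nonZero p>0}}))

  even⊎odd : ∀ d → 2 ∣ d ⊎ 2 ∣ suc d
  even⊎odd zero    = inj₁ (2 ∣0)
  even⊎odd (suc d) = Sum.map id (∣m∣n⇒∣m+n (∣-refl {2})) (Sum.swap (even⊎odd d))

  odd-prime-odd : ∀ {p} → Prime p → p ≢ 2 → ¬ 2 ∣ p
  odd-prime-odd p-prime p≢2 2∣p with prime⇒irreducible p-prime 2∣p
  ... | inj₂ 2≡p = p≢2 (sym 2≡p)

  odd-power : ∀ {p} → ¬ 2 ∣ p → ∀ j → ¬ 2 ∣ p ^ j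
  odd-power 2∤p zero    2∣1 = 2∤1 2∣1
  odd-power {p} 2∤p (suc j) 2∣ with euclidsLemma p (p ^ j) prime[2] 2∣
  ... | inj₁ 2∣p = 2∤p 2∣p
  ... | inj₂ 2∣pʲ = odd-power 2∤p j 2∣pʲ

  -- For odd p both r and q - 1 are even.
  coprime⇒p≡2 : ∀ {p} → Prime p → ∀ k ℓ {r} → r ≡ p ^ ℓ + 1 [mod p ^ k + 1 ] → gcd r (p ^ k ∸ 1) ≡ 1 → p ≡ 2
  coprime⇒p≡2 {p} p-prime k ℓ {r} r≡ gcd≡1 with p ≟ 2
  ... | yes p≡2 = p≡2
  ... | no  p≢2 = contradiction (subst (2 ∣_) gcd≡1 (gcd-greatest 2∣r 2∣q-1)) 2∤1
    where
    p-odd = odd-prime-odd p-prime p≢2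
    2∣p^+1 : ∀ j → 2 ∣ p ^ j + 1
    2∣p^+1 j with even⊎odd (p ^ j)
    ... | inj₁ even = contradiction even (odd-power p-odd j)
    ... | inj₂ odd  = subst (2 ∣_) (+-comm 1 (p ^ j)) odd
    2∣q-1 : 2 ∣ p ^ k ∸ 1
    2∣q-1 = ∣m+n∣m⇒∣n (subst (2 ∣_) shift (2∣p^+1 k)) ∣-refl
      where
      shift : p ^ k + 1 ≡ 2 + (p ^ k ∸ 1)
      shift = trans (+-comm (p ^ k) 1) (cong suc (sym (m+[n∸m]≡n (m^n>0 p {{prime⇒nonZero p-prime}} k))))
    2∣diff : 2 ∣ ℕ.∣ r - (p ^ ℓ + 1) ∣
    2∣diff = ∣-trans (2∣p^+1 k) r≡
    2∣r : 2 ∣ r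
    2∣r with ≤-total r (p ^ ℓ + 1)
    ... | inj₂ ≥ = subst (2 ∣_) (m+[n∸m]≡n ≥) (∣m∣n⇒∣m+n (2∣p^+1 ℓ) (subst (2 ∣_) (m≤n⇒∣n-m∣≡n∸m ≥) 2∣diff))
    ... | inj₁ ≤ = ∣m+n∣m⇒∣n (subst (2 ∣_) (sym (m∸n+n≡m ≤)) (2∣p^+1 ℓ)) (subst (2 ∣_) (m≤n⇒∣m-n∣≡n∸m ≤) 2∣diff)

  module LargestPowerOfTwo {k ℓ m : ℕ} .{{_ : NonZero m}} (k>0 : k > 0)
    (m-largest : IsLargestPowerOfTwoDividing (gcd k ℓ) m) where

    open IsLargestPowerOfTwoDividing m-largest using (isPowerOfTwo; largest) renaming (divides to m∣gcd)

    K L : ℕ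
    K = k / m
    L = ℓ / m

    m∣k : m ∣ k
    m∣k = ∣-trans m∣gcd (gcd[m,n]∣m k ℓ)

    m∣ℓ : m ∣ ℓ
    m∣ℓ = ∣-trans m∣gcd (gcd[m,n]∣n k ℓ)

    Km≡k : K * m ≡ k
    Km≡k = m/n*n≡m m∣k

    Lm≡ℓ : L * m ≡ ℓ
    Lm≡ℓ = m/n*n≡m m∣ℓ

    -- Otherwise 2 m would be a larger power of 2 dividing the gcd.
    ¬both-even : 2 ∣ K → 2 ∣ L → ⊥
    ¬both-even 2∣K 2∣L = <⇒≱ m<2m (subst (_≤ m) (cong (2 *_) (sym m≡2^i))
        (largest (suc i) (subst (_∣ gcd k ℓ) (cong (2 *_) m≡2^i)
          (gcd-greatest (subst (2 * m ∣_) Km≡k (*-monoˡ-∣ m 2∣K)) (subst (2 * m ∣_) Lm≡ℓ (*-monoˡ-∣ m 2∣L))))))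
      where
      i = proj₁ isPowerOfTwo
      m≡2^i = proj₂ isPowerOfTwo
      m<2m : m < 2 * m
      m<2m = m<m+n m (subst (0 <_) (sym (+-identityʳ m)) (>-nonZero⁻¹ m))

    private
      J = lcm k ℓ / m
      Jm≡lcm : J * m ≡ lcm k ℓ
      Jm≡lcm = m/n*n≡m (∣-trans m∣k (m∣lcm[m,n] k ℓ))

    lcm-even : 2 ∣ K ⊎ 2 ∣ L → 2 ∣ J
    lcm-even (inj₁ 2∣K) = ∣-trans 2∣K (*-cancelʳ-∣ m (subst₂ _∣_ (sym Km≡k) (sym Jm≡lcm) (m∣lcm[m,n] k ℓ)))
    lcm-even (inj₂ 2∣L) = ∣-trans 2∣L (*-cancelʳ-∣ m (subst₂ _∣_ (sym Lm≡ℓ) (sym Jm≡lcm) (n∣lcm[m,n] k ℓ)))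

    -- The lcm divides k L = K L m, so J divides K L. Together with `lcm-even` this says that J and
    -- K L have the same parity.
    lcm-odd : 2 ∣ J → 2 ∣ K ⊎ 2 ∣ L
    lcm-odd 2∣J = euclidsLemma K L prime[2] (∣-trans 2∣J (*-cancelʳ-∣ m (subst₂ _∣_ (sym Jm≡lcm) KLm lcm∣)))
      where
      lcm∣ : lcm k ℓ ∣ k * L
      lcm∣ = lcm-least (m∣m*n {k} L) (subst₂ _∣_ Lm≡ℓ (*-comm L k) (*-monoʳ-∣ L m∣k))
      KLm : k * L ≡ K * L * m
      KLm = trans (cong (_* L) (sym Km≡k)) (trans (*-assoc K m L) (trans (cong (K *_) (*-comm m L)) (sym (*-assoc K L m))))

  nontrivial-gcd : ∀ {r p} → p > 0 → gcd r p ≢ 1 → 1 < gcd r p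
  nontrivial-gcd {r} {p} p>0 g≢1 = ≤∧≢⇒< (n≢0⇒n>0 λ g≡0 → <⇒≢ p>0 (sym (ℕ.gcd[m,n]≡0⇒n≡0 r g≡0))) (g≢1 ∘ sym)

  inverse-exponent : ∀ {r p} → r > 0 → p > 0 → gcd r p ≡ 1 → ∃[ u ] ∃[ v ] u * r ≡ 1 + v * p
  inverse-exponent {r} {suc zero}    r>0 _ _     = 1 , ℕ.pred r ,
    trans (*-identityˡ r) (trans (sym (suc-pred r {{>-nonZero r>0}})) (cong suc (sym (*-identityʳ _))))
  inverse-exponent {r} {p@(suc (suc p″))} _ _ gcd≡1 with ℕ.coprime-Bézout (gcd≡1⇒coprime gcd≡1)
  ... | Bézout.+- x y eq       = x , y , sym eq
  -- Here x r ≡ -1 modulo p, so the inverse of r is -x; x (p - 1) represents it by a natural number.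
  ... | Bézout.-+ x (suc y) eq = x * suc p″ , p″ + suc p″ * y , (begin
    x * suc p″ * r  ≡⟨ swap x (suc p″) r ⟩
    suc p″ * (x * r)  ≡⟨ cong (suc p″ *_) (suc-injective eq) ⟩
    suc p″ * (suc p″ + y * p)  ≡⟨ collect p″ y ⟩
    1 + (p″ + suc p″ * y) * p  ∎)
    where
    open ≡-Reasoning
    swap : ∀ a b c → a * b * c ≡ b * (a * c)
    swap = solve-∀
    collect : ∀ p y → suc p * (suc p + y * suc (suc p)) ≡ 1 + (p + suc p * y) * suc (suc p)
    collect = solve-∀

open Arithmetic

-- Injectivity of x^r A(x^{q-1}) and nondegeneracy of Ω.

module Criterion {n : ℕ} (K : DiscreteField (Fin (suc n))) (k : ℕ) (k>0 : k ℕ.> 0)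
  (order : suc n ≡ 2 ℕ.^ (k ℕ.+ k)) (ℓ : ℕ) (a b c d : Fin (suc n)) where

  open Frobenius K k k>0 order
    using (conjugationStructure; 2^·1; sum-single)
  open FiniteFieldProperties K
    using (x^[jn]≡1; power-sum-zero; power-sum-nonzero; sum-reindex; sum; sum-cong-≗;
      sum-replicate; ∑-comm; *-distribˡ-sum; _·_)
  open Coefficients K (conjugationStructure ℓ) a b c d public
  open ≡-Reasoning

  F : Set
  F = Fin (suc n)

  Q p : ℕ
  Q = 2 ℕ.^ ℓ
  p = 2 ℕ.^ k ∸ 1

  1+p≡q : suc p ≡ 2 ℕ.^ k
  1+p≡q = ℕ.m+[n∸m]≡n (ℕ.m^n>0 2 k)

  p>0 : p ℕ.> 0
  p>0 = ℕ.s<s⁻¹ (subst (1 ℕ.<_) (sym 1+p≡q) (ℕ.^-monoʳ-< 2 (s≤s (s≤s z≤n)) k>0))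

  n≡p[p+2] : n ≡ p ℕ.* (suc p ℕ.+ 1)
  n≡p[p+2] = ℕ.suc-injective (begin
    suc n  ≡⟨ order ⟩
    2 ℕ.^ (k ℕ.+ k)  ≡⟨ ℕ.^-distribˡ-+-* 2 k k ⟩
    2 ℕ.^ k ℕ.* 2 ℕ.^ k  ≡⟨ cong (λ t → t ℕ.* t) 1+p≡q ⟨
    suc p ℕ.* suc p  ≡⟨ expand p ⟩
    suc (p ℕ.* (suc p ℕ.+ 1))        ∎)
    where
    open import Data.Nat.Tactic.RingSolver using (solve-∀)
    expand : ∀ p → suc p ℕ.* suc p ≡ suc (p ℕ.* (suc p ℕ.+ 1))
    expand = solve-∀

  bar≡x*x^p : ∀ x → bar x ≡ x * x ^ p
  bar≡x*x^p x = cong (x ^_) (sym 1+p≡q)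

  real⇒x^p≡1 : ∀ {x} → x ≢ 0# → Real x → x ^ p ≡ 1#
  real⇒x^p≡1 {x} x≢0 x-real = *-cancelˡ x≢0 (begin
    x * x ^ p   ≡⟨ bar≡x*x^p x ⟨
    bar x       ≡⟨ x-real ⟩
    x  ≡⟨ *-identityʳ x ⟨
    x * 1#      ∎)

  ^-real : ∀ {x} j → Real x → Real (x ^ j)
  ^-real zero    x-real = bar-1
  ^-real (suc j) x-real = *-real x-real (^-real j x-real)

  A : F → F
  A y = a * y ^ (Q ℕ.+ 1) + b * y ^ Q + c * y + d

  B-0 : B 0# ≡ 0#
  B-0 = solve 4 (λ a b c d → :B a b c d :0 := :0) refl a b c d

  x^[Q+1]≡ : ∀ x → x ^ (Q ℕ.+ 1) ≡ σ x * x
  x^[Q+1]≡ x = trans (^-homo-* x Q 1) (cong (σ x *_) (*-identityʳ x))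

  homogenize : ∀ x → σ x * x * A (x ^ p) ≡ B x
  homogenize x = begin
    σ x * x * A y  ≡⟨ cong (λ t → σ x * x * (a * t + b * σ y + c * y + d)) (x^[Q+1]≡ y) ⟩
    σ x * x * (a * (σ y * y) + b * σ y + c * y + d)
      ≡⟨ solve 6 (λ a b c d x y → :σ x :* x :* (a :* (:σ y :* y) :+ b :* :σ y :+ c :* y :+ d) :=
           a :* :σ (x :* y) :* (x :* y) :+ b :* :σ (x :* y) :* x :+ c :* :σ x :* (x :* y) :+ d :* :σ x :* x) refl a b c d x y ⟩
    a * σ (x * y) * (x * y) + b * σ (x * y) * x + c * σ x * (x * y) + d * σ x * x
      ≡⟨ cong (λ t → a * σ t * t + b * σ t * x + c * σ x * t + d * σ x * x) (bar≡x*x^p x) ⟨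
    B x  ∎
    where y = x ^ p

  module Map (r : ℕ) (r>0 : r ℕ.> 0) (r≡ : r ≡ Q ℕ.+ 1 [mod suc p ℕ.+ 1 ]) where

    f : F → F
    f x = x ^ r * A (x ^ p)

    norm-exponent : ℕ
    norm-exponent = proj₁ (exponent-decomposition {p} {r} {Q} p>0 r≡)

    private
      s = norm-exponent
      s-eq = proj₂ (exponent-decomposition {p} {r} {Q} p>0 r≡)

    f-0 : f 0# ≡ 0#
    f-0 = trans (cong (_* A (0# ^ p)) (0^>0 r>0)) (zeroˡ _)

    x^r≡ : ∀ {x} → x ≢ 0# → x ^ r ≡ σ x * x * N x ^ s
    x^r≡ {x} x≢0 = begin
      x ^ r  ≡⟨ *-identityʳ _ ⟨
      x ^ r * 1#  ≡⟨ cong (x ^ r *_) (x^[jn]≡1 (Q ℕ.+ 1) x≢0) ⟨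
      x ^ r * x ^ ((Q ℕ.+ 1) ℕ.* n)  ≡⟨ ^-homo-* x r _ ⟨
      x ^ (r ℕ.+ (Q ℕ.+ 1) ℕ.* n)  ≡⟨ cong (λ t → x ^ (r ℕ.+ (Q ℕ.+ 1) ℕ.* t)) n≡p[p+2] ⟩
      x ^ (r ℕ.+ (Q ℕ.+ 1) ℕ.* (p ℕ.* (suc p ℕ.+ 1)))  ≡⟨ cong (x ^_) s-eq ⟩
      x ^ (Q ℕ.+ 1 ℕ.+ (suc p ℕ.+ 1) ℕ.* s)  ≡⟨ ^-homo-* x (Q ℕ.+ 1) _ ⟩
      x ^ (Q ℕ.+ 1) * x ^ ((suc p ℕ.+ 1) ℕ.* s)        ≡⟨ cong₂ _*_ (x^[Q+1]≡ x) (sym (^-assocʳ x (suc p ℕ.+ 1) s)) ⟩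
      σ x * x * (x ^ (suc p ℕ.+ 1)) ^ s  ≡⟨ cong (λ t → σ x * x * t ^ s) x^[q+1]≡ ⟩
      σ x * x * N x ^ s  ∎
      where
      x^[q+1]≡ : x ^ (suc p ℕ.+ 1) ≡ N x
      x^[q+1]≡ = begin
        x ^ (suc p ℕ.+ 1)     ≡⟨ ^-homo-* x (suc p) 1 ⟩
        x ^ suc p * x ^ 1     ≡⟨ cong₂ _*_ (cong (x ^_) 1+p≡q) (*-identityʳ x) ⟩
        bar x * x  ≡⟨ *-comm _ _ ⟩
        N x  ∎

    f≡NˢB : ∀ x → f x ≡ N x ^ s * B x
    f≡NˢB x = split (x ≟ 0#)
      where
      split : Dec (x ≡ 0#) → f x ≡ N x ^ s * B x
      split (yes refl) = trans f-0 (sym (trans (cong (N 0# ^ s *_) B-0) (zeroʳ _)))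
      split (no  x≢0)  = begin
        x ^ r * A (x ^ p)  ≡⟨ cong (_* A (x ^ p)) (x^r≡ x≢0) ⟩
        σ x * x * N x ^ s * A (x ^ p)  ≡⟨ solve 3 (λ u v w → u :* v :* w := v :* (u :* w)) refl (σ x * x) (N x ^ s) (A (x ^ p)) ⟩
        N x ^ s * (σ x * x * A (x ^ p))        ≡⟨ cong (N x ^ s *_) (homogenize x) ⟩
        N x ^ s * B x  ∎

    Nˢ-real : ∀ x → Real (N x ^ s)
    Nˢ-real x = ^-real s (N-real x)

    f-scale : ∀ {l} → l ≢ 0# → Real l → ∀ y → f (l * y) ≡ l ^ r * f y
    f-scale {l} l≢0 l-real y = begin
      (l * y) ^ r * A ((l * y) ^ p)    ≡⟨ cong₂ (λ t u → t * A u) (^-distrib-* l y r) (begin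
        (l * y) ^ p  ≡⟨ ^-distrib-* l y p ⟩
        l ^ p * y ^ p  ≡⟨ cong (_* y ^ p) (real⇒x^p≡1 l≢0 l-real) ⟩
        1# * y ^ p  ≡⟨ *-identityˡ _ ⟩
        y ^ p  ∎) ⟩
      l ^ r * y ^ r * A (y ^ p)        ≡⟨ *-assoc _ _ _ ⟩
      l ^ r * f y  ∎

    wedge-scale : ∀ {u v} → Real u → Real v → ∀ x y → wedge (u * x) (v * y) ≡ u * v * wedge x y
    wedge-scale u-real v-real x y = by-trace (λ u → wedge (u * x) (_ * y) ≡ u * _ * wedge x y)
      (λ s → by-trace (λ v → wedge ((s + bar s) * x) (v * y) ≡ (s + bar s) * v * wedge x y)
        (λ t → solve 4 (λ s t x y → :wedge ((s :+ :bar s) :* x) ((t :+ :bar t) :* y) :=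
          (s :+ :bar s) :* (t :+ :bar t) :* :wedge x y) refl s t x y) v-real) u-real

    wedge-f : ∀ x y → wedge (f x) (f y) ≡ N x ^ s * N y ^ s * Ω α β P R x y
    wedge-f x y = begin
      wedge (f x) (f y)  ≡⟨ cong₂ wedge (f≡NˢB x) (f≡NˢB y) ⟩
      wedge (N x ^ s * B x) (N y ^ s * B y)  ≡⟨ wedge-scale (Nˢ-real x) (Nˢ-real y) (B x) (B y) ⟩
      N x ^ s * N y ^ s * wedge (B x) (B y)  ≡⟨ cong (N x ^ s * N y ^ s *_) (wedge-B x y) ⟩
      N x ^ s * N y ^ s * Ω α β P R x y  ∎

    wedge≡0⇒proportional : ∀ {x y} → y ≢ 0# → wedge x y ≡ 0# → ∃ λ l → Real l × y * l ≡ x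
    wedge≡0⇒proportional {x} {y} y≢0 w≡0 with divide y≢0 x
    ... | l , refl = l , sym (x+y≡0⇒x≡y (x*y≡0⇒y≡0 (N≢0 y≢0)
      (trans (solve 2 (λ l y → :N y :* (l :+ :bar l) := :wedge (y :* l) y) refl l y) w≡0))) , refl

    module _ (gcd≡1 : gcd r p ≡ 1) where

      private
        u = proj₁ (inverse-exponent r>0 p>0 gcd≡1)
        v = proj₁ (proj₂ (inverse-exponent r>0 p>0 gcd≡1))
        ur≡1+vp = proj₂ (proj₂ (inverse-exponent r>0 p>0 gcd≡1))

      x^[ur]≡x : ∀ {x} → x ≢ 0# → Real x → x ^ (u ℕ.* r) ≡ x
      x^[ur]≡x {x} x≢0 x-real = begin
        x ^ (u ℕ.* r)  ≡⟨ cong (x ^_) (trans ur≡1+vp (cong suc (ℕ.*-comm v p))) ⟩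
        x * x ^ (p ℕ.* v)     ≡⟨ cong (x *_) (^-assocʳ x p v) ⟨
        x * (x ^ p) ^ v       ≡⟨ cong (λ t → x * t ^ v) (real⇒x^p≡1 x≢0 x-real) ⟩
        x * 1# ^ v  ≡⟨ cong (x *_) (1^ v) ⟩
        x * 1#  ≡⟨ *-identityʳ x ⟩
        x  ∎

      -- A zero of Ω gives f x = l f y with l real. Since r is invertible modulo q - 1, l is the
      -- r-th power of the real element μ = l^u, so f x = f (μ y), and injectivity makes x and y
      -- proportional.
      injective⇒nondegenerate : (∀ {x y} → f x ≡ f y → x ≡ y) → Nondegenerate
      injective⇒nondegenerate f-injective x y w≢0 Ω≡0 = w≢0 (begin
        wedge x y  ≡⟨ cong (λ t → wedge t y) (f-injective fx≡f[μy]) ⟩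
        wedge (μ * y) y  ≡⟨ by-trace (λ μ → wedge (μ * y) y ≡ 0#)
                             (λ s → solve 2 (λ s y → :wedge ((s :+ :bar s) :* y) y := :0) refl s y) μ-real ⟩
        0#  ∎)
        where
        f≢0 : ∀ {x} → x ≢ 0# → f x ≢ 0#
        f≢0 x≢0 fx≡0 = x≢0 (f-injective (trans fx≡0 (sym f-0)))
        proportional : ∃ λ l → Real l × f y * l ≡ f x
        proportional = wedge≡0⇒proportional (f≢0 (wedge≢0⇒ʳ≢0 w≢0))
          (trans (wedge-f x y) (trans (cong (N x ^ s * N y ^ s *_) Ω≡0) (zeroʳ _)))
        l = proj₁ proportional
        l-real = proj₁ (proj₂ proportional)
        fyl≡fx = proj₂ (proj₂ proportional)
        l≢0 : l ≢ 0#
        l≢0 l≡0 = f≢0 (wedge≢0⇒ˡ≢0 w≢0) (trans (sym fyl≡fx) (trans (cong (f y *_) l≡0) (zeroʳ _)))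
        μ = l ^ u
        μ-real = ^-real u l-real
        fx≡f[μy] : f x ≡ f (μ * y)
        fx≡f[μy] = begin
          f x  ≡⟨ fyl≡fx ⟨
          f y * l  ≡⟨ *-comm (f y) l ⟩
          l * f y  ≡⟨ cong (_* f y) (x^[ur]≡x l≢0 l-real) ⟨
          l ^ (u ℕ.* r) * f y    ≡⟨ cong (_* f y) (^-assocʳ l u r) ⟨
          μ ^ r * f y  ≡⟨ f-scale (^-≢0 u l≢0) μ-real y ⟨
          f (μ * y)  ∎

      -- Away from 0 equal values give Ω = 0, hence x = l y with l real; then l^r = 1, and
      -- coprimality forces l = 1. The point 0 is separate: a zero of f at x ≠ 0 would be a zero of
      -- B and make Ω vanish on all pairs (x, z).
      nondegenerate⇒injective : Nondegenerate → ∀ {x y} → f x ≡ f y → x ≡ y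
      nondegenerate⇒injective nondeg {x} {y} fx≡fy = split (x ≟ 0#) (y ≟ 0#)
        where
        f≢0 : ∀ {x} → x ≢ 0# → f x ≢ 0#
        f≢0 {x} x≢0 fx≡0 = nondeg x z w≢0 (begin
          Ω α β P R x z  ≡⟨ wedge-B x z ⟨
          wedge (B x) (B z)        ≡⟨ cong (λ t → wedge t (B z)) (x*y≡0⇒y≡0 (^-≢0 s (N≢0 x≢0)) (trans (sym (f≡NˢB x)) fx≡0)) ⟩
          wedge 0# (B z)  ≡⟨ solve 1 (λ z → :wedge :0 z := :0) refl _ ⟩
          0#  ∎)
          where
          z = proj₁ (wedge-nondegenerate x≢0)
          w≢0 = proj₂ (wedge-nondegenerate x≢0)
        split : Dec (x ≡ 0#) → Dec (y ≡ 0#) → x ≡ y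
        split (yes x≡0) (yes y≡0) = trans x≡0 (sym y≡0)
        split (yes x≡0) (no  y≢0) = contradiction (trans (sym fx≡fy) (trans (cong f x≡0) f-0)) (f≢0 y≢0)
        split (no  x≢0) (yes y≡0) = contradiction (trans fx≡fy (trans (cong f y≡0) f-0)) (f≢0 x≢0)
        split (no  x≢0) (no  y≢0) = begin
          x  ≡⟨ yl≡x ⟨
          y * l     ≡⟨ cong (y *_) l≡1 ⟩
          y * 1#    ≡⟨ *-identityʳ y ⟩
          y         ∎
          where
          Ω≡0 : Ω α β P R x y ≡ 0#
          Ω≡0 = x*y≡0⇒y≡0 (x*y≢0 (^-≢0 s (N≢0 x≢0)) (^-≢0 s (N≢0 y≢0))) (begin
            N x ^ s * N y ^ s * Ω α β P R x y    ≡⟨ wedge-f x y ⟨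
            wedge (f x) (f y)  ≡⟨ cong (λ t → wedge t (f y)) fx≡fy ⟩
            wedge (f y) (f y)  ≡⟨ solve 1 (λ z → :wedge z z := :0) refl _ ⟩
            0#  ∎)
          proportional = wedge≡0⇒proportional y≢0 (decidable-stable (wedge x y ≟ 0#) λ w≢0 → nondeg x y w≢0 Ω≡0)
          l = proj₁ proportional
          l-real = proj₁ (proj₂ proportional)
          yl≡x = proj₂ (proj₂ proportional)
          l≢0 : l ≢ 0#
          l≢0 l≡0 = x≢0 (trans (sym yl≡x) (trans (cong (y *_) l≡0) (zeroʳ _)))
          lʳ≡1 : l ^ r ≡ 1#
          lʳ≡1 = *-cancelʳ (f≢0 y≢0) (begin
            l ^ r * f y     ≡⟨ f-scale l≢0 l-real y ⟨
            f (l * y)       ≡⟨ cong f (trans (*-comm l y) yl≡x) ⟩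
            f x  ≡⟨ fx≡fy ⟩
            f y  ≡⟨ *-identityˡ _ ⟨
            1# * f y        ∎)
          l≡1 : l ≡ 1#
          l≡1 = begin
            l  ≡⟨ x^[ur]≡x l≢0 l-real ⟨
            l ^ (u ℕ.* r)   ≡⟨ cong (l ^_) (ℕ.*-comm u r) ⟩
            l ^ (r ℕ.* u)   ≡⟨ ^-assocʳ l r u ⟨
            (l ^ r) ^ u     ≡⟨ cong (_^ u) lʳ≡1 ⟩
            1# ^ u  ≡⟨ 1^ u ⟩
            1#  ∎

  0^p≡0 : 0# ^ p ≡ 0#
  0^p≡0 = 0^>0 p>0

  geometric : ∀ d u v → (u + v) * sum {d} (λ i → u ^ toℕ i * v ^ (d ∸ suc (toℕ i))) ≡ u ^ d + v ^ d
  geometric zero    u v = trans (zeroʳ _) (sym (x+x≡0 1#))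
  geometric (suc d) u v = begin
    (u + v) * (1# * v ^ d + sum {d} (λ i → u * u ^ toℕ i * v ^ (d ∸ suc (toℕ i))))
      ≡⟨ cong (λ t → (u + v) * (1# * v ^ d + t)) (trans (sum-cong-≗ {d} (λ i → *-assoc u _ _)) (sym (*-distribˡ-sum {d} u _))) ⟩
    (u + v) * (1# * v ^ d + u * S)
      ≡⟨ solve 4 (λ u v w S → (u :+ v) :* (:1 :* w :+ u :* S) := (u :+ v) :* w :+ u :* ((u :+ v) :* S)) refl u v (v ^ d) S ⟩
    (u + v) * v ^ d + u * ((u + v) * S)
      ≡⟨ cong (λ t → (u + v) * v ^ d + u * t) (geometric d u v) ⟩
    (u + v) * v ^ d + u * (u ^ d + v ^ d)
      ≡⟨ solve 4 (λ u v w t → (u :+ v) :* w :+ u :* (t :+ w) := u :* t :+ v :* w) refl u v (v ^ d) (u ^ d) ⟩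
    u * u ^ d + v * v ^ d  ∎
    where S = sum {d} (λ i → u ^ toℕ i * v ^ (d ∸ suc (toℕ i)))

  -- In characteristic 2 the binomial coefficients of exponent q - 1 are all odd.
  binomial-[q-1] : ∀ u v → (u + v) ^ p ≡ sum {suc p} (λ i → u ^ toℕ i * v ^ (p ∸ toℕ i))
  binomial-[q-1] u v = split (u + v ≟ 0#)
    where
    S : F → F → F
    S u v = sum {suc p} (λ i → u ^ toℕ i * v ^ (p ∸ toℕ i))
    split : Dec (u + v ≡ 0#) → (u + v) ^ p ≡ S u v
    split (no u+v≢0) = *-cancelˡ u+v≢0 (begin
      (u + v) ^ suc p  ≡⟨ cong ((u + v) ^_) 1+p≡q ⟩
      bar (u + v)  ≡⟨ bar-+ u v ⟩
      bar u + bar v  ≡⟨ cong₂ (λ i j → u ^ i + v ^ j) 1+p≡q 1+p≡q ⟨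
      u ^ suc p + v ^ suc p      ≡⟨ geometric (suc p) u v ⟨
      (u + v) * S u v  ∎)
    split (yes u+v≡0) = begin
      (u + v) ^ p  ≡⟨ cong (_^ p) u+v≡0 ⟩
      0# ^ p  ≡⟨ 0^p≡0 ⟩
      0#  ≡⟨ zeroʳ _ ⟨
      v ^ p * 0#  ≡⟨ cong (v ^ p *_) (q·1≡0) ⟨
      v ^ p * sum {suc p} (λ _ → 1#)    ≡⟨ *-distribˡ-sum {suc p} (v ^ p) (λ _ → 1#) ⟩
      sum {suc p} (λ _ → v ^ p * 1#)    ≡⟨ sum-cong-≗ {suc p} (λ i → trans (*-identityʳ _) (v^p≡ i)) ⟩
      S v v  ≡⟨ cong (λ t → S t v) (x+y≡0⇒x≡y u+v≡0) ⟨
      S u v  ∎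
      where
      v^p≡ : ∀ (i : Fin (suc p)) → v ^ p ≡ v ^ toℕ i * v ^ (p ∸ toℕ i)
      v^p≡ i = trans (cong (v ^_) (sym (ℕ.m+[n∸m]≡n (Fin.toℕ≤pred[n] i)))) (^-homo-* v (toℕ i) (p ∸ toℕ i))
      q·1≡0 : sum {suc p} (λ _ → 1#) ≡ 0#
      q·1≡0 = begin
        sum {suc p} (λ _ → 1#)   ≡⟨ sum-replicate (suc p) ⟩
        suc p · 1#  ≡⟨ cong (_· 1#) 1+p≡q ⟩
        (2 ℕ.^ k) · 1#  ≡⟨ 2^·1 k ⟩
        (1# + 1#) ^ k  ≡⟨ cong (_^ k) 1+1≡0 ⟩
        0# ^ k  ≡⟨ 0^>0 k>0 ⟩
        0#  ∎

  mixed : F → F → F → F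
  mixed s t z = σ z * (s * z + t * bar z)

  -- Only the term whose exponent is divisible by q² - 1 contributes to the power sum.
  mixed-power-sum : ∀ s t → sum (λ z → mixed s t z ^ p) ≡ 0# → s ≡ 0# ⊎ t ≡ 0#
  mixed-power-sum s t sum≡0 = split (s ≟ 0#) (t ≟ 0#)
    where
    ∤Q : ¬ suc p ℕ.+ 1 ∣ Q
    ∤Q = subst (λ t → ¬ t ℕ.+ 1 ∣ Q) (sym 1+p≡q) (2^k+1∤2^ℓ k>0 ℓ)
    E : ℕ → ℕ
    E = exponent p Q p>0 ∤Q
    coefficient : Fin (suc p) → F
    coefficient i = s ^ toℕ i * t ^ (p ∸ toℕ i)
    i₀ = fromℕ< (s≤s (special≤p p Q p>0 ∤Q))
    toℕ-i₀ : toℕ i₀ ≡ special p Q p>0 ∤Q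
    toℕ-i₀ = Fin.toℕ-fromℕ< _
    expand : ∀ z → mixed s t z ^ p ≡ sum (λ i → coefficient i * z ^ E (toℕ i))
    expand z = begin
      (σ z * (s * z + t * bar z)) ^ p  ≡⟨ ^-distrib-* (σ z) _ p ⟩
      σ z ^ p * (s * z + t * bar z) ^ p  ≡⟨ cong (σ z ^ p *_) (binomial-[q-1] (s * z) (t * bar z)) ⟩
      σ z ^ p * sum {suc p} (λ i → (s * z) ^ toℕ i * (t * bar z) ^ (p ∸ toℕ i))
        ≡⟨ *-distribˡ-sum {suc p} (σ z ^ p) (λ i → (s * z) ^ toℕ i * (t * bar z) ^ (p ∸ toℕ i)) ⟩
      sum {suc p} (λ i → σ z ^ p * ((s * z) ^ toℕ i * (t * bar z) ^ (p ∸ toℕ i)))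
        ≡⟨ sum-cong-≗ {suc p} (λ i → monomial (toℕ i) (p ∸ toℕ i)) ⟩
      sum {suc p} (λ i → coefficient i * z ^ E (toℕ i))  ∎
      where
      monomial : ∀ i j → σ z ^ p * ((s * z) ^ i * (t * bar z) ^ j) ≡ s ^ i * t ^ j * z ^ (Q ℕ.* p ℕ.+ (i ℕ.+ suc p ℕ.* j))
      monomial i j = begin
        σ z ^ p * ((s * z) ^ i * (t * bar z) ^ j)
          ≡⟨ cong₂ (λ u v → σ z ^ p * (u * v)) (^-distrib-* s z i) (^-distrib-* t (bar z) j) ⟩
        σ z ^ p * (s ^ i * z ^ i * (t ^ j * bar z ^ j))
          ≡⟨ solve 5 (λ a b c d e → a :* (b :* c :* (d :* e)) := b :* d :* (a :* (c :* e))) refl (σ z ^ p) (s ^ i) (z ^ i) (t ^ j) (bar z ^ j) ⟩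
        s ^ i * t ^ j * (σ z ^ p * (z ^ i * bar z ^ j))
          ≡⟨ cong₂ (λ u v → s ^ i * t ^ j * (u * (z ^ i * v))) (^-assocʳ z Q p)
               (trans (cong (λ t → (z ^ t) ^ j) (sym 1+p≡q)) (^-assocʳ z (suc p) j)) ⟩
        s ^ i * t ^ j * (z ^ (Q ℕ.* p) * (z ^ i * z ^ (suc p ℕ.* j)))
          ≡⟨ cong (λ u → s ^ i * t ^ j * (z ^ (Q ℕ.* p) * u)) (^-homo-* z i (suc p ℕ.* j)) ⟨
        s ^ i * t ^ j * (z ^ (Q ℕ.* p) * z ^ (i ℕ.+ suc p ℕ.* j))
          ≡⟨ cong (s ^ i * t ^ j *_) (^-homo-* z (Q ℕ.* p) _) ⟨
        s ^ i * t ^ j * z ^ (Q ℕ.* p ℕ.+ (i ℕ.+ suc p ℕ.* j))  ∎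
    others : ∀ i → i ≢ i₀ → coefficient i * sum (_^ E (toℕ i)) ≡ 0#
    others i i≢i₀ = trans (cong (coefficient i *_) (power-sum-zero (E (toℕ i)) λ n∣E →
      i≢i₀ (Fin.toℕ-injective (trans (exponent-others p Q p>0 ∤Q (Fin.toℕ≤pred[n] i) (subst (_∣ E (toℕ i)) n≡p[p+2] n∣E)) (sym toℕ-i₀)))))
      (zeroʳ _)
    PS≢0 : sum (_^ E (toℕ i₀)) ≢ 0#
    PS≢0 = power-sum-nonzero (E (toℕ i₀))
      (subst₂ _∣_ (sym n≡p[p+2]) (cong E (sym toℕ-i₀)) (exponent-special p Q p>0 ∤Q))
      (exponent>0 p Q p>0 ∤Q (Fin.toℕ≤pred[n] i₀))
    coefficient≡0 : coefficient i₀ ≡ 0#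
    coefficient≡0 = decidable-stable (_ ≟ 0#) λ c≢0 → x*y≢0 c≢0 PS≢0 (begin
      coefficient i₀ * sum (_^ E (toℕ i₀))  ≡⟨ sum-single _ i₀ others ⟨
      sum (λ i → coefficient i * sum (_^ E (toℕ i)))  ≡⟨ sum-cong-≗ {suc p} (λ i → *-distribˡ-sum (coefficient i) (_^ E (toℕ i))) ⟩
      sum {suc p} (λ i → sum (λ z → coefficient i * z ^ E (toℕ i))) ≡⟨ ∑-comm (λ i z → coefficient i * z ^ E (toℕ i)) ⟩
      sum (λ z → sum (λ i → coefficient i * z ^ E (toℕ i)))      ≡⟨ sum-cong-≗ expand ⟨
      sum (λ z → mixed s t z ^ p)  ≡⟨ sum≡0 ⟩
      0#  ∎)
    split : Dec (s ≡ 0#) → Dec (t ≡ 0#) → s ≡ 0# ⊎ t ≡ 0#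
    split (yes s≡0) _         = inj₁ s≡0
    split (no _)    (yes t≡0) = inj₂ t≡0
    split (no s≢0)  (no t≢0)  = contradiction coefficient≡0 (x*y≢0 (^-≢0 (toℕ i₀) s≢0) (^-≢0 (p ∸ toℕ i₀) t≢0))

  module _ (r : ℕ) (r>0 : r ℕ.> 0) (r≡ : r ≡ Q ℕ.+ 1 [mod suc p ℕ.+ 1 ]) where

    open Map r r>0 r≡

    -- Reindexing along the permutations `L`, `f` and `Λ` turns the power sum of the factored form
    -- into that of the identity, which is 0 because 0 < q - 1 < q² - 1. Replacing B by f is
    -- harmless: the real factor N(x)^s passes through `Λ`, and for x ≠ 0 its (q - 1)-st power is 1.
    injective⇒noMixedTerm : (∀ {x y} → f x ≡ f y → x ≡ y) → (e≢0 : e ≢ 0#) → NoMixedTerm e≢0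
    injective⇒noMixedTerm f-injective e≢0 Y c₁ c₂ s t NY≢1 Nc₁+Nc₂≢0 factor = mixed-power-sum s t (begin
      sum (λ z → mixed s t z ^ p)       ≡⟨ sum-reindex (λ z → mixed s t z ^ p) L (linear-injective L L-+ L≡0⇒≡0) ⟨
      sum (λ x → mixed s t (L x) ^ p)   ≡⟨ sum-cong-≗ (λ x → trans (cong (_^ p) (sym (factor x))) (rescale x)) ⟩
      sum (λ x → Λ (f x) ^ p)  ≡⟨ sum-reindex (λ y → Λ y ^ p) f f-injective ⟩
      sum (λ y → Λ y ^ p)  ≡⟨ sum-reindex (_^ p) Λ (linear-injective Λ Λ-+ Λ≡0⇒≡0) ⟩
      sum (_^ p)  ≡⟨ power-sum-zero p (λ n∣p → ℕ.<⇒≱ p<n (ℕ.∣⇒≤ {{ℕ.>-nonZero p>0}} n∣p)) ⟩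
      0#  ∎)
      where
      L Λ : F → F
      L x = c₁ * bar x + c₂ * x
      Λ y = y + Y * bar y
      linear-injective : ∀ (g : F → F) → (∀ x y → g (x + y) ≡ g x + g y) → (∀ {x} → g x ≡ 0# → x ≡ 0#) →
                         ∀ {x y} → g x ≡ g y → x ≡ y
      linear-injective g g-+ g-kernel {x} {y} gx≡gy = x+y≡0⇒x≡y (g-kernel (trans (g-+ x y) (x≡y⇒x+y≡0 gx≡gy)))
      L-+ : ∀ x y → L (x + y) ≡ L x + L y
      L-+ = solve 4 (λ c₁ c₂ x y → c₁ :* :bar (x :+ y) :+ c₂ :* (x :+ y) := c₁ :* :bar x :+ c₂ :* x :+ (c₁ :* :bar y :+ c₂ :* y)) refl c₁ c₂
      L≡0⇒≡0 : ∀ {x} → L x ≡ 0# → x ≡ 0#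
      L≡0⇒≡0 {x} Lx≡0 = x*y≡0⇒y≡0 Nc₁+Nc₂≢0 (begin
        (N c₁ + N c₂) * x  ≡⟨ solve 3 (λ c₁ c₂ x → let L = c₁ :* :bar x :+ c₂ :* x in
                                        (:N c₁ :+ :N c₂) :* x := c₁ :* :bar L :+ :bar c₂ :* L) refl c₁ c₂ x ⟩
        c₁ * bar (L x) + bar c₂ * L x ≡⟨ cong (λ t → c₁ * bar t + bar c₂ * t) Lx≡0 ⟩
        c₁ * bar 0# + bar c₂ * 0#   ≡⟨ solve 2 (λ u v → u :* :bar :0 :+ v :* :0 := :0) refl _ _ ⟩
        0#  ∎)
      Λ-+ : ∀ x y → Λ (x + y) ≡ Λ x + Λ y
      Λ-+ = solve 3 (λ Y x y → x :+ y :+ Y :* :bar (x :+ y) := x :+ Y :* :bar x :+ (y :+ Y :* :bar y)) refl Y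
      Λ≡0⇒≡0 : ∀ {x} → Λ x ≡ 0# → x ≡ 0#
      Λ≡0⇒≡0 {x} Λx≡0 = x*y≡0⇒y≡0 (λ n≡0 → NY≢1 (x+y≡0⇒x≡y n≡0)) (begin
        (N Y + 1#) * x  ≡⟨ solve 2 (λ Y x → (:N Y :+ :1) :* x := x :+ Y :* :bar x :+ Y :* :bar (x :+ Y :* :bar x)) refl Y x ⟩
        Λ x + Y * bar (Λ x)      ≡⟨ cong (λ t → t + Y * bar t) Λx≡0 ⟩
        0# + Y * bar 0#  ≡⟨ solve 1 (λ Y → :0 :+ Y :* :bar :0 := :0) refl Y ⟩
        0#  ∎)
      p<n : p ℕ.< n
      p<n = subst (p ℕ.<_) (sym n≡p[p+2]) (subst (ℕ._< p ℕ.* (suc p ℕ.+ 1)) (ℕ.*-identityʳ p)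
        (ℕ.*-monoʳ-< p {{ℕ.>-nonZero p>0}} (s≤s (ℕ.m≤n+m 1 p))))
      Λ-scale : ∀ {u} → Real u → ∀ x → Λ (u * x) ≡ u * Λ x
      Λ-scale u-real x = by-trace (λ u → Λ (u * x) ≡ u * Λ x) (λ s → solve 3 (λ Y s x → let u = s :+ :bar s in
        u :* x :+ Y :* :bar (u :* x) := u :* (x :+ Y :* :bar x)) refl Y s x) u-real
      rescale : ∀ x → Λ (B x) ^ p ≡ Λ (f x) ^ p
      rescale x = split (x ≟ 0#)
        where
        split : Dec (x ≡ 0#) → Λ (B x) ^ p ≡ Λ (f x) ^ p
        split (yes refl) = cong (λ t → Λ t ^ p) (trans B-0 (sym f-0))
        split (no  x≢0)  = sym (begin
          Λ (f x) ^ p  ≡⟨ cong (λ t → Λ t ^ p) (f≡NˢB x) ⟩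
          Λ (N x ^ s′ * B x) ^ p  ≡⟨ cong (_^ p) (Λ-scale (Nˢ-real x) (B x)) ⟩
          (N x ^ s′ * Λ (B x)) ^ p  ≡⟨ ^-distrib-* _ _ p ⟩
          (N x ^ s′) ^ p * Λ (B x) ^ p     ≡⟨ cong (_* Λ (B x) ^ p) (real⇒x^p≡1 (^-≢0 s′ (N≢0 x≢0)) (Nˢ-real x)) ⟩
          1# * Λ (B x) ^ p  ≡⟨ *-identityˡ _ ⟩
          Λ (B x) ^ p  ∎)
          where s′ = norm-exponent

-- Solvability of h^Q + h = u + 1 with h + h̄ = 1 in terms of a trace.

module TraceCriterion {n : ℕ} (K : DiscreteField (Fin (suc n))) (k : ℕ) (k>0 : k ℕ.> 0)
  (order : suc n ≡ 2 ℕ.^ (k ℕ.+ k)) (ℓ : ℕ) where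

  open Frobenius K k k>0 order
  open FiniteFieldProperties K using (_·_)
  open Quadrinomial K (conjugationStructure ℓ)
  open ≡-Reasoning

  Bit : Fin (suc n) → Set
  Bit x = x ≡ 0# ⊎ x ≡ 1#

  x²+x≡0⇒bit : ∀ {x} → x * x + x ≡ 0# → Bit x
  x²+x≡0⇒bit {x} eq = split (x ≟ 0#)
    where
    split : Dec (x ≡ 0#) → Bit x
    split (yes x≡0) = inj₁ x≡0
    split (no  x≢0) = inj₂ (x+y≡0⇒x≡y (x*y≡0⇒y≡0 x≢0
      (trans (solve 1 (λ x → x :* (x :+ :1) := x :* x :+ x) refl x) eq)))

  bit-+ : ∀ {x y} → Bit x → Bit y → Bit (x + y)
  bit-+ (inj₁ refl) (inj₁ refl) = inj₁ (+-identityˡ 0#)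
  bit-+ (inj₁ refl) (inj₂ refl) = inj₂ (+-identityˡ 1#)
  bit-+ (inj₂ refl) (inj₁ refl) = inj₂ (+-identityʳ 1#)
  bit-+ (inj₂ refl) (inj₂ refl) = inj₁ 1+1≡0

  bit-* : ∀ {x y} → Bit x → Bit y → Bit (x * y)
  bit-* (inj₁ refl) _ = inj₁ (zeroˡ _)
  bit-* (inj₂ refl) (inj₁ refl) = inj₁ (zeroʳ _)
  bit-* (inj₂ refl) (inj₂ refl) = inj₂ (*-identityˡ 1#)

  bit≢0⇒≡1 : ∀ {x} → Bit x → x ≢ 0# → x ≡ 1#
  bit≢0⇒≡1 (inj₁ x≡0) x≢0 = contradiction x≡0 x≢0
  bit≢0⇒≡1 (inj₂ x≡1) _   = x≡1

  parity : ∀ j → (2 ∣ j × j · 1# ≡ 0#) ⊎ (¬ 2 ∣ j × j · 1# ≡ 1#)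
  parity zero = inj₁ (2 ℕ.∣0 , refl)
  parity (suc j) with parity j
  ... | inj₁ (even , j≡0) = inj₂
    ((λ even′ → 2∤1 (ℕ.∣m+n∣m⇒∣n (subst (2 ∣_) (ℕ.+-comm 1 j) even′) even)) , trans (cong (1# +_) j≡0) (+-identityʳ 1#))
  ... | inj₂ (odd , j≡1) = inj₁
    ([ (λ even → contradiction even odd) , id ]′ (even⊎odd j) , trans (cong (1# +_) j≡1) 1+1≡0)

  bit-· : ∀ j → Bit (j · 1#)
  bit-· j = Sum.map proj₂ proj₂ (parity j)

  tr-bit : ∀ m j {x} → Bit x → tr m j x ≡ j · 1# * x
  tr-bit m j (inj₁ refl) = trans (tr-0# m j) (sym (zeroʳ _))
  tr-bit m j (inj₂ refl) = trans (tr-1 m j) (sym (*-identityʳ _))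

  module _ (m K′ L : ℕ) (K′m≡k : K′ ℕ.* m ≡ k) (Lm≡ℓ : L ℕ.* m ≡ ℓ)
           (¬both-even : 2 ∣ K′ → 2 ∣ L → ⊥) where

    private
      κ = K′ · 1#
      λ′ = L · 1#

    tr-bar : ∀ x → tr m K′ (frob m x + x) ≡ bar x + x
    tr-bar x = trans (tr-telescope m K′ x) (cong (λ t → frob t x + x) K′m≡k)

    tr-σ : ∀ x → tr m L (frob m x + x) ≡ σ x + x
    tr-σ x = trans (tr-telescope m L x) (cong (λ t → frob t x + x) Lm≡ℓ)

    -- Both sides apply two commuting partial traces to `frob m x + x`: k/m steps telescope to x̄ +
    -- x and ℓ/m steps to σ x + x.
    tr-σx+x : ∀ x → tr m K′ (σ x + x) ≡ tr m L (bar x + x)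
    tr-σx+x x = begin
      tr m K′ (σ x + x)  ≡⟨ cong (tr m K′) (tr-σ x) ⟨
      tr m K′ (tr m L (frob m x + x))      ≡⟨ tr-comm m K′ m L _ ⟩
      tr m L (tr m K′ (frob m x + x))      ≡⟨ cong (tr m L) (tr-bar x) ⟩
      tr m L (bar x + x)  ∎

    SolvableFor : Fin (suc n) → Set
    SolvableFor u = ∃ λ h → h + bar h ≡ 1# × σ h + h ≡ u + 1#

    solvable⇒trace : ∀ {u} → SolvableFor u → tr m K′ u ≡ κ + λ′
    solvable⇒trace {u} (h , h+h̄≡1 , σh+h≡u+1) = x+y≡0⇒x≡y (begin
      tr m K′ u + (κ + λ′)  ≡⟨ +-assoc _ _ _ ⟨
      tr m K′ u + κ + λ′  ≡⟨ cong (λ t → tr m K′ u + t + λ′) (tr-1 m K′) ⟨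
      tr m K′ u + tr m K′ 1# + λ′        ≡⟨ cong (_+ λ′) (tr-+ m K′ u 1#) ⟨
      tr m K′ (u + 1#) + λ′  ≡⟨ cong (λ t → tr m K′ t + λ′) σh+h≡u+1 ⟨
      tr m K′ (σ h + h) + λ′  ≡⟨ cong (_+ λ′) (tr-σx+x h) ⟩
      tr m L (bar h + h) + λ′  ≡⟨ cong (λ t → tr m L t + λ′) (trans (+-comm _ _) h+h̄≡1) ⟩
      tr m L 1# + λ′  ≡⟨ cong (_+ λ′) (tr-1 m L) ⟩
      λ′ + λ′  ≡⟨ x+x≡0 λ′ ⟩
      0#  ∎)

    -- The sum of the two sides is 1 + (1 + κ) (1 + λ), which equals 1 unless κ and λ are both 0.
    κ+λ≢κλ : κ + λ′ ≢ κ * λ′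
    κ+λ≢κλ eq = split (parity K′) (parity L)
      where
      refute : κ + λ′ + κ * λ′ ≡ 1# → ⊥
      refute ≡1 = 1≢0 (trans (sym ≡1) (x≡y⇒x+y≡0 eq))
      split : (2 ∣ K′ × κ ≡ 0#) ⊎ (¬ 2 ∣ K′ × κ ≡ 1#) → (2 ∣ L × λ′ ≡ 0#) ⊎ (¬ 2 ∣ L × λ′ ≡ 1#) → ⊥
      split (inj₁ (even , _)) (inj₁ (even′ , _)) = ¬both-even even even′
      split (inj₂ (_ , κ≡1)) _ = refute (trans (cong (λ t → t + λ′ + t * λ′) κ≡1)
        (solve 1 (λ l → :1 :+ l :+ :1 :* l := :1) refl λ′))
      split _ (inj₂ (_ , λ≡1)) = refute (trans (cong (λ t → κ + t + κ * t) λ≡1)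
        (solve 1 (λ k → k :+ :1 :+ k :* :1 := :1) refl κ))

    trace⇒unsolvable : ∀ {u} → tr m K′ u ≡ κ * λ′ → ¬ SolvableFor u
    trace⇒unsolvable tr≡ solvable = κ+λ≢κλ (trans (sym (solvable⇒trace solvable)) tr≡)

    -- For a solution h₁ of h² + h = ν both h₁ + h̄₁ and σ h₁ + h₁ + u are in 𝔽₂; adding an
    -- element j with j^(2^m) + j = 1 changes them by k / m and ℓ / m.
    unsolvable⇒trace : ∀ {u ν} → Real ν → u * u + u ≡ ν + σ ν → ¬ SolvableFor u → tr m K′ u ≡ κ * λ′
    unsolvable⇒trace {u} {ν} ν-real u²+u≡ unsolvable = decidable-stable (_ ≟ _) λ tr≢ →
      unsolvable (construct tr≢ (parity K′) (parity L))
      where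
      h₁ = proj₁ (artin-schreier ν-real)
      h₁²+h₁≡ν = proj₂ (artin-schreier ν-real)
      j-solution : ∃ λ j → frob m j + j ≡ 1#
      j-solution = hilbert-90 m (K′ ℕ.+ K′) (trans (ℕ.*-distribʳ-+ m K′ K′) (cong₂ ℕ._+_ K′m≡k K′m≡k)) 1# (begin
        tr m (K′ ℕ.+ K′) 1#       ≡⟨ tr-1 m (K′ ℕ.+ K′) ⟩
        (K′ ℕ.+ K′) · 1#  ≡⟨ ×-homo-+ 1# K′ K′ ⟩
        κ + κ  ≡⟨ x+x≡0 κ ⟩
        0#  ∎)
        where open import Algebra.Properties.Monoid.Mult +-monoid using (×-homo-+)
      j = proj₁ j-solution
      j-eq = proj₂ j-solution
      bar-j : bar j + j ≡ κ
      bar-j = trans (sym (tr-bar j)) (trans (cong (tr m K′) j-eq) (tr-1 m K′))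
      σ-j : σ j + j ≡ λ′
      σ-j = trans (sym (tr-σ j)) (trans (cong (tr m L) j-eq) (tr-1 m L))
      η = bar h₁ + h₁
      ε = u + (σ h₁ + h₁)
      η-bit : Bit η
      η-bit = x²+x≡0⇒bit (begin
        η * η + η  ≡⟨ solve 1 (λ h → let η = :bar h :+ h in η :* η :+ η := :bar (h :* h :+ h) :+ (h :* h :+ h)) refl h₁ ⟩
        bar (h₁ * h₁ + h₁) + (h₁ * h₁ + h₁)       ≡⟨ cong (λ t → bar t + t) h₁²+h₁≡ν ⟩
        bar ν + ν  ≡⟨ x≡y⇒x+y≡0 ν-real ⟩
        0#  ∎)
      ε-bit : Bit ε
      ε-bit = x²+x≡0⇒bit (begin
        ε * ε + ε
          ≡⟨ solve 2 (λ u h → let ε = u :+ (:σ h :+ h) in ε :* ε :+ ε := u :* u :+ u :+ (h :* h :+ h :+ :σ (h :* h :+ h))) refl u h₁ ⟩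
        u * u + u + (h₁ * h₁ + h₁ + σ (h₁ * h₁ + h₁))   ≡⟨ cong (λ t → u * u + u + (t + σ t)) h₁²+h₁≡ν ⟩
        u * u + u + (ν + σ ν)  ≡⟨ x≡y⇒x+y≡0 u²+u≡ ⟩
        0#  ∎)
      trace-u : tr m K′ u ≡ κ * ε + λ′ * η
      trace-u = begin
        tr m K′ u  ≡⟨ cong (tr m K′) (solve 2 (λ u h → u := u :+ (:σ h :+ h) :+ (:σ h :+ h)) refl u h₁) ⟩
        tr m K′ (ε + (σ h₁ + h₁))  ≡⟨ tr-+ m K′ _ _ ⟩
        tr m K′ ε + tr m K′ (σ h₁ + h₁)  ≡⟨ cong₂ _+_ (tr-bit m K′ ε-bit) (trans (tr-σx+x h₁) (tr-bit m L η-bit)) ⟩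
        κ * ε + λ′ * η  ∎
      adjust : ∀ {t} → Bit t → η + t * κ ≡ 1# → ε + t * λ′ ≡ 1# → SolvableFor u
      adjust {t} t-bit η+tκ≡1 ε+tλ≡1 = h₁ + t * j ,
        (begin
          h₁ + t * j + bar (h₁ + t * j)
            ≡⟨ solve 4 (λ h t j t̄ → h :+ t :* j :+ :bar (h :+ t :* j) := :bar h :+ h :+ (t :* j :+ :bar t :* :bar j)) refl h₁ t j t ⟩
          η + (t * j + bar t * bar j)       ≡⟨ cong (λ s → η + (t * j + s * bar j)) (fixed bar-0 bar-1) ⟩
          η + (t * j + t * bar j)  ≡⟨ solve 4 (λ n t j j̄ → n :+ (t :* j :+ t :* j̄) := n :+ t :* (j̄ :+ j)) refl η t j (bar j) ⟩
          η + t * (bar j + j)  ≡⟨ cong (λ s → η + t * s) bar-j ⟩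
          η + t * κ  ≡⟨ η+tκ≡1 ⟩
          1#  ∎) ,
        (begin
          σ (h₁ + t * j) + (h₁ + t * j)
            ≡⟨ solve 4 (λ h t j u → :σ (h :+ t :* j) :+ (h :+ t :* j) := u :+ (u :+ (:σ h :+ h) :+ (:σ t :* :σ j :+ t :* j))) refl h₁ t j u ⟩
          u + (ε + (σ t * σ j + t * j))     ≡⟨ cong (λ s → u + (ε + (s * σ j + t * j))) (fixed σ-0 σ-1) ⟩
          u + (ε + (t * σ j + t * j))       ≡⟨ cong (λ s → u + (ε + s)) (distribˡ t (σ j) j) ⟨
          u + (ε + t * (σ j + j))  ≡⟨ cong (λ s → u + (ε + t * s)) σ-j ⟩
          u + (ε + t * λ′)  ≡⟨ cong (u +_) ε+tλ≡1 ⟩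
          u + 1#  ∎)
        where
        fixed : ∀ {g : Fin (suc n) → Fin (suc n)} → g 0# ≡ 0# → g 1# ≡ 1# → g t ≡ t
        fixed {g} g-0 g-1 = [ (λ { refl → g-0 }) , (λ { refl → g-1 }) ]′ t-bit
      construct : tr m K′ u ≢ κ * λ′ → (2 ∣ K′ × κ ≡ 0#) ⊎ (¬ 2 ∣ K′ × κ ≡ 1#) → (2 ∣ L × λ′ ≡ 0#) ⊎ (¬ 2 ∣ L × λ′ ≡ 1#) → SolvableFor u
      construct _ (inj₁ (even , _)) (inj₁ (even′ , _)) = contradiction even′ (¬both-even even)
      -- For κ = 0 the second equation dictates the multiple t = ε + 1 of j, and the first reduces
      -- to η = 1; with η = 0 the trace κ ε + λ η would be 0 = κ λ.
      construct tr≢ (inj₁ (_ , κ≡0)) (inj₂ (_ , λ≡1)) = adjust {ε + 1#} (bit-+ ε-bit (inj₂ refl))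
        (begin
          η + (ε + 1#) * κ  ≡⟨ cong (λ t → η + (ε + 1#) * t) κ≡0 ⟩
          η + (ε + 1#) * 0#        ≡⟨ solve 2 (λ n t → n :+ t :* :0 := n) refl η _ ⟩
          η  ≡⟨ bit≢0⇒≡1 η-bit (λ η≡0 → tr≢ (trans trace-u (begin
            κ * ε + λ′ * η  ≡⟨ cong₂ (λ s t → s * ε + λ′ * t) κ≡0 η≡0 ⟩
            0# * ε + λ′ * 0#  ≡⟨ solve 2 (λ ε l → :0 :* ε :+ l :* :0 := :0 :* l) refl ε λ′ ⟩
            0# * λ′  ≡⟨ cong (_* λ′) κ≡0 ⟨
            κ * λ′  ∎))) ⟩
          1#  ∎)
        (begin
          ε + (ε + 1#) * λ′        ≡⟨ cong (λ t → ε + (ε + 1#) * t) λ≡1 ⟩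
          ε + (ε + 1#) * 1#        ≡⟨ solve 1 (λ ε → ε :+ (ε :+ :1) :* :1 := :1) refl ε ⟩
          1#  ∎)
      -- For κ = 1 the first equation dictates t = η + 1. The second then fails only if ε = (η + 1)
      -- λ, and in that case the trace ε + λ η would be λ = κ λ.
      construct tr≢ (inj₂ (_ , κ≡1)) _ = adjust {η + 1#} (bit-+ η-bit (inj₂ refl))
        (begin
          η + (η + 1#) * κ  ≡⟨ cong (λ t → η + (η + 1#) * t) κ≡1 ⟩
          η + (η + 1#) * 1#        ≡⟨ solve 1 (λ ε → ε :+ (ε :+ :1) :* :1 := :1) refl η ⟩
          1#  ∎)
        (bit≢0⇒≡1 (bit-+ ε-bit (bit-* (bit-+ η-bit (inj₂ refl)) (bit-· L))) λ ≡0 → tr≢ (trans trace-u (x+y≡0⇒x≡y (begin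
          κ * ε + λ′ * η + κ * λ′  ≡⟨ cong (λ t → t * ε + λ′ * η + t * λ′) κ≡1 ⟩
          1# * ε + λ′ * η + 1# * λ′ ≡⟨ solve 3 (λ ε l n → :1 :* ε :+ l :* n :+ :1 :* l := ε :+ (n :+ :1) :* l) refl ε λ′ η ⟩
          ε + (η + 1#) * λ′        ≡⟨ ≡0 ⟩
          0#  ∎))))

-- Conditions (3), (4) and (5) for p = 2 and r coprime to q - 1.

module CharacteristicTwo {n : ℕ} (K : DiscreteField (Fin (suc n))) (k : ℕ) (k>0 : k ℕ.> 0)
  (order : suc n ≡ 2 ℕ.^ (k ℕ.+ k)) (ℓ : ℕ) (a b c d : Fin (suc n))
  (m : ℕ) .{{m-nonZero : NonZero m}} (m-largest : IsLargestPowerOfTwoDividing (gcd k ℓ) m)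
  (r : ℕ) (r>0 : r ℕ.> 0) (r≡ : r ≡ 2 ℕ.^ ℓ ℕ.+ 1 [mod suc (2 ℕ.^ k ∸ 1) ℕ.+ 1 ])
  (gcd≡1 : gcd r (2 ℕ.^ k ∸ 1) ≡ 1) where

  open Criterion K k k>0 order ℓ a b c d
  open Map r r>0 r≡ public using (f)
  open Map r r>0 r≡ hiding (f)
  open Frobenius K k k>0 order using (sum-tr)
  open FiniteFieldProperties K using (_·_; sum)
  open LargestPowerOfTwo {k} {ℓ} {m} k>0 m-largest renaming (K to K′)
  private module Trace = TraceCriterion K k k>0 order ℓ
  open ≡-Reasoning

  private
    J = lcm k ℓ ℕ./ m

  J≡κλ : J · 1# ≡ K′ · 1# * L · 1#
  J≡κλ = split (Trace.parity K′) (Trace.parity L) (Trace.parity J)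
    where
    split : (2 ∣ K′ × K′ · 1# ≡ 0#) ⊎ (¬ 2 ∣ K′ × K′ · 1# ≡ 1#) →
            (2 ∣ L × L · 1# ≡ 0#) ⊎ (¬ 2 ∣ L × L · 1# ≡ 1#) →
            (2 ∣ J × J · 1# ≡ 0#) ⊎ (¬ 2 ∣ J × J · 1# ≡ 1#) → J · 1# ≡ K′ · 1# * L · 1#
    split (inj₁ (even , _)) _ (inj₂ (odd , _)) = contradiction (lcm-even (inj₁ even)) odd
    split _ (inj₁ (even , _)) (inj₂ (odd , _)) = contradiction (lcm-even (inj₂ even)) odd
    split (inj₁ (_ , κ≡0)) _ (inj₁ (_ , J≡0)) = trans J≡0 (sym (trans (cong (_* L · 1#) κ≡0) (zeroˡ _)))
    split _ (inj₁ (_ , λ≡0)) (inj₁ (_ , J≡0)) = trans J≡0 (sym (trans (cong (K′ · 1# *_) λ≡0) (zeroʳ _)))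
    split (inj₂ (odd , _)) (inj₂ (odd′ , _)) (inj₁ (even , _)) = contradiction (lcm-odd even) [ odd , odd′ ]′
    split (inj₂ (_ , κ≡1)) (inj₂ (_ , λ≡1)) (inj₂ (_ , J≡1)) = trans J≡1 (sym (trans (cong₂ _*_ κ≡1 λ≡1) (*-identityˡ 1#)))

  TraceCondition : Fin (suc n) → Set
  TraceCondition u = sum {K′} (λ i → u ^ (2 ℕ.^ (m ℕ.* toℕ i))) ≡ J · 1#

  σe≡ : σ e ≡ e * e ^ (Q ∸ 1)
  σe≡ = cong (e ^_) (sym (ℕ.m+[n∸m]≡n (ℕ.m^n>0 2 ℓ)))

  injective⇒conditions : (∀ {x y} → f x ≡ f y → x ≡ y) →
    e ≢ 0# × σ P ≡ e ^ (Q ∸ 1) * R × (∀ u → e * u ≡ β → TraceCondition u)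
  injective⇒conditions f-injective = e≢0′ , *-cancelˡ e≢0′ (begin
      e * σ P  ≡⟨ covariant ⟩
      σ e * R  ≡⟨ cong (_* R) σe≡ ⟩
      e * e ^ (Q ∸ 1) * R       ≡⟨ *-assoc _ _ _ ⟩
      e * (e ^ (Q ∸ 1) * R)     ∎) ,
    λ u eu≡β → trans (sum-tr m K′ u) (trans
      (Trace.unsolvable⇒trace m K′ L Km≡k Lm≡ℓ ¬both-even (N-real _) (u²+u≡Nπ+σNπ e≢0′ covariant u eu≡β)
        (nondegenerate⇒unsolvable e≢0′ covariant u eu≡β nondeg))
      (sym J≡κλ))
    where
    nondeg = injective⇒nondegenerate gcd≡1 f-injective
    e≢0′ = e≢0 nondeg
    covariant = noMixedTerm⇒covariant e≢0′ (injective⇒noMixedTerm r r>0 r≡ f-injective e≢0′) nondeg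

  conditions⇒injective : e ≢ 0# → σ P ≡ e ^ (Q ∸ 1) * R → ∀ u → e * u ≡ β → TraceCondition u →
    ∀ {x y} → f x ≡ f y → x ≡ y
  conditions⇒injective e≢0′ σP≡ u eu≡β trace = nondegenerate⇒injective gcd≡1
    (unsolvable⇒nondegenerate e≢0′ covariant u eu≡β
      (Trace.trace⇒unsolvable m K′ L Km≡k Lm≡ℓ ¬both-even (trans (sym (sum-tr m K′ u)) (trans trace J≡κλ))))
    where
    covariant : e * σ P ≡ σ e * R
    covariant = begin
      e * σ P  ≡⟨ cong (e *_) σP≡ ⟩
      e * (e ^ (Q ∸ 1) * R)     ≡⟨ *-assoc _ _ _ ⟨
      e * e ^ (Q ∸ 1) * R       ≡⟨ cong (_* R) σe≡ ⟨
      σ e * R  ∎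

-- Evaluation of sums, products and compositions of polynomials.

module PolynomialEvaluation {c ℓ : Level} (R : CommutativeRing c ℓ) where

  open CommutativeRing R hiding (zero) renaming (refl to ≈-refl; sym to ≈-sym; trans to ≈-trans)
  open Polynomial (Semiring.rawSemiring semiring)
  open import Algebra.Properties.CommutativeSemiring.Exp commutativeSemiring using (_^_; ^-congˡ)
  open import Algebra.Properties.CommutativeSemigroup +-commutativeSemigroup using (interchange)
  open import Algebra.Properties.CommutativeSemigroup *-commutativeSemigroup using (x∙yz≈y∙xz)
  open import Relation.Binary.Reasoning.Setoid setoid

  eval-monomial : ∀ a n x → eval (monomial a n) x ≈ a * x ^ n
  eval-monomial a zero    x = ≈-trans (+-congˡ (zeroʳ x)) (≈-trans (+-identityʳ a) (≈-sym (*-identityʳ a)))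
  eval-monomial a (suc n) x = begin
    0# + x * eval (monomial a n) x   ≈⟨ +-identityˡ _ ⟩
    x * eval (monomial a n) x        ≈⟨ *-congˡ (eval-monomial a n x) ⟩
    x * (a * x ^ n)  ≈⟨ x∙yz≈y∙xz x a _ ⟩
    a * (x * x ^ n)  ∎

  eval-+ᴾ : ∀ f g x → eval (f +ᴾ g) x ≈ eval f x + eval g x
  eval-+ᴾ []      g       x = ≈-sym (+-identityˡ _)
  eval-+ᴾ (a ∷ f) []      x = ≈-sym (+-identityʳ _)
  eval-+ᴾ (a ∷ f) (b ∷ g) x = begin
    a + b + x * eval (f +ᴾ g) x  ≈⟨ +-congˡ (*-congˡ (eval-+ᴾ f g x)) ⟩
    a + b + x * (eval f x + eval g x)       ≈⟨ +-congˡ (distribˡ x _ _) ⟩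
    a + b + (x * eval f x + x * eval g x)   ≈⟨ interchange a b _ _ ⟩
    a + x * eval f x + (b + x * eval g x)   ∎

  eval-scale : ∀ a g x → eval (map (a *_) g) x ≈ a * eval g x
  eval-scale a []      x = ≈-sym (zeroʳ a)
  eval-scale a (b ∷ g) x = begin
    a * b + x * eval (map (a *_) g) x   ≈⟨ +-congˡ (*-congˡ (eval-scale a g x)) ⟩
    a * b + x * (a * eval g x)  ≈⟨ +-congˡ (x∙yz≈y∙xz x a _) ⟩
    a * b + a * (x * eval g x)  ≈⟨ distribˡ a b _ ⟨
    a * (b + x * eval g x)  ∎

  eval-*ᴾ : ∀ f g x → eval (f *ᴾ g) x ≈ eval f x * eval g x
  eval-*ᴾ []      g x = ≈-sym (zeroˡ _)
  eval-*ᴾ (a ∷ f) g x = begin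
    eval (map (a *_) g +ᴾ (0# ∷ (f *ᴾ g))) x        ≈⟨ eval-+ᴾ (map (a *_) g) _ x ⟩
    eval (map (a *_) g) x + (0# + x * eval (f *ᴾ g) x)
      ≈⟨ +-cong (eval-scale a g x) (+-identityˡ _) ⟩
    a * eval g x + x * eval (f *ᴾ g) x  ≈⟨ +-congˡ (*-congˡ (eval-*ᴾ f g x)) ⟩
    a * eval g x + x * (eval f x * eval g x)        ≈⟨ +-congˡ (*-assoc x _ _) ⟨
    a * eval g x + x * eval f x * eval g x  ≈⟨ distribʳ _ a _ ⟨
    (a + x * eval f x) * eval g x  ∎

  eval-∘ᴾ : ∀ f g x → eval (f ∘ᴾ g) x ≈ eval f (eval g x)
  eval-∘ᴾ []      g x = ≈-refl
  eval-∘ᴾ (a ∷ f) g x = begin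
    eval ((a ∷ []) +ᴾ g *ᴾ (f ∘ᴾ g)) x  ≈⟨ eval-+ᴾ (a ∷ []) (g *ᴾ (f ∘ᴾ g)) x ⟩
    a + x * 0# + eval (g *ᴾ (f ∘ᴾ g)) x  ≈⟨ +-cong (+-congˡ (zeroʳ x)) (eval-*ᴾ g (f ∘ᴾ g) x) ⟩
    a + 0# + eval g x * eval (f ∘ᴾ g) x  ≈⟨ +-cong (+-identityʳ a) (*-congˡ (eval-∘ᴾ f g x)) ⟩
    a + eval g x * eval f (eval g x)  ∎

  eval-quadrinomial : ∀ a b c d Q r p x → let y = x ^ p in
    eval ((X^ r) *ᴾ ((monomial a (Q ℕ.+ 1) +ᴾ monomial b Q +ᴾ monomial c 1 +ᴾ monomial d 0) ∘ᴾ (X^ p))) x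
    ≈ x ^ r * (a * y ^ (Q ℕ.+ 1) + b * y ^ Q + c * y + d)
  eval-quadrinomial a b c d Q r p x = begin
    eval ((X^ r) *ᴾ (A ∘ᴾ (X^ p))) x  ≈⟨ eval-*ᴾ (X^ r) (A ∘ᴾ (X^ p)) x ⟩
    eval (X^ r) x * eval (A ∘ᴾ (X^ p)) x  ≈⟨ *-cong (eval-X^ r) (eval-∘ᴾ A (X^ p) x) ⟩
    x ^ r * eval A (eval (X^ p) x)  ≈⟨ *-congˡ (eval-A (eval (X^ p) x)) ⟩
    x ^ r * (a * y′ ^ (Q ℕ.+ 1) + b * y′ ^ Q + c * y′ + d)
      ≈⟨ *-congˡ (+-congʳ (+-cong (+-cong (*-congˡ (^-congˡ (Q ℕ.+ 1) (eval-X^ p))) (*-congˡ (^-congˡ Q (eval-X^ p)))) (*-congˡ (eval-X^ p)))) ⟩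
    x ^ r * (a * y ^ (Q ℕ.+ 1) + b * y ^ Q + c * y + d)  ∎
    where
    A = monomial a (Q ℕ.+ 1) +ᴾ monomial b Q +ᴾ monomial c 1 +ᴾ monomial d 0
    y = x ^ p
    y′ = eval (X^ p) x
    eval-X^ : ∀ j → eval (X^ j) x ≈ x ^ j
    eval-X^ j = ≈-trans (eval-monomial 1# j x) (*-identityˡ _)
    eval-A : ∀ y → eval A y ≈ a * y ^ (Q ℕ.+ 1) + b * y ^ Q + c * y + d
    eval-A y = begin
      eval A y
        ≈⟨ eval-+ᴾ (monomial a (Q ℕ.+ 1) +ᴾ monomial b Q +ᴾ monomial c 1) (monomial d 0) y ⟩
      eval (monomial a (Q ℕ.+ 1) +ᴾ monomial b Q +ᴾ monomial c 1) y + eval (monomial d 0) y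
        ≈⟨ +-cong (eval-+ᴾ (monomial a (Q ℕ.+ 1) +ᴾ monomial b Q) (monomial c 1) y) (≈-trans (eval-monomial d 0 y) (*-identityʳ d)) ⟩
      eval (monomial a (Q ℕ.+ 1) +ᴾ monomial b Q) y + eval (monomial c 1) y + d
        ≈⟨ +-congʳ (+-cong (eval-+ᴾ (monomial a (Q ℕ.+ 1)) (monomial b Q) y) (≈-trans (eval-monomial c 1 y) (*-congˡ (*-identityʳ y)))) ⟩
      eval (monomial a (Q ℕ.+ 1)) y + eval (monomial b Q) y + c * y + d
        ≈⟨ +-congʳ (+-congʳ (+-cong (eval-monomial a (Q ℕ.+ 1) y) (eval-monomial b Q y))) ⟩
      a * y ^ (Q ℕ.+ 1) + b * y ^ Q + c * y + d  ∎

-- Necessity of (1), in any characteristic.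

module NecessaryCoprimality {n : ℕ} (K : DiscreteField (Fin (suc n))) where

  open FiniteFieldProperties K
  open ≡-Reasoning

  -- An element μ ≠ 1 with μ^g = 1 for g = gcd r p has the same image as 1.
  injective⇒coprime : ∀ {r p} (A : F → F) → n ℕ.> 0 → p ℕ.> 0 → p ∣ n →
                      (∀ {x y} → x ^ r * A (x ^ p) ≡ y ^ r * A (y ^ p) → x ≡ y) → gcd r p ≡ 1
  injective⇒coprime {r} {p} A n>0 p>0 p∣n injective = decidable-stable (gcd r p ℕ.≟ 1) λ gcd≢1 →
    let g               = gcd r p
        g>1             = nontrivial-gcd {r} p>0 gcd≢1
        ℕ.divides j n≡jg = ℕ.∣-trans (gcd[m,n]∣n r p) p∣n
        j>0             = positive n>0 n≡jg
        j<n             = subst (j ℕ.<_) (sym n≡jg) (subst (ℕ._< j ℕ.* g) (ℕ.*-identityʳ j) (ℕ.*-monoʳ-< j {{ℕ.>-nonZero j>0}} g>1))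
        y , y≢0 , y^j≢1 = power-nontrivial j j>0 j<n
        μ^g≡1 : (y ^ j) ^ g ≡ 1#
        μ^g≡1 = trans (^-assocʳ y j g) (trans (cong (y ^_) (sym n≡jg)) (x^n≡1 y≢0))
        μ^≡1 : ∀ {i} → g ∣ i → (y ^ j) ^ i ≡ 1#
        μ^≡1 g∣i = power-trivial μ^g≡1 g∣i
    in y^j≢1 (injective (cong₂ (λ s t → s * A t)
         (trans (μ^≡1 (gcd[m,n]∣m r p)) (sym (1^ r)))
         (trans (μ^≡1 (gcd[m,n]∣n r p)) (sym (1^ p)))))
    where
    positive : ∀ {n j g} → n ℕ.> 0 → n ≡ j ℕ.* g → j ℕ.> 0
    positive {j = zero}  n>0 n≡0 = contradiction (sym n≡0) (ℕ.<⇒≢ n>0)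
    positive {j = suc _} _   _   = s≤s z≤n
    power-trivial : ∀ {x g i} → x ^ g ≡ 1# → g ∣ i → x ^ i ≡ 1#
    power-trivial {x} {g} x^g≡1 (ℕ.divides j refl) = begin
      x ^ (j ℕ.* g)   ≡⟨ cong (x ^_) (ℕ.*-comm j g) ⟩
      x ^ (g ℕ.* j)   ≡⟨ ^-assocʳ x g j ⟨
      (x ^ g) ^ j     ≡⟨ cong (_^ j) x^g≡1 ⟩
      1# ^ j  ≡⟨ 1^ j ⟩
      1#  ∎

-- The field structure carried over to Fin (suc n), where equality is propositional.
module Transfer {c ℓ₁ ℓ₂} (F : HeytingField c ℓ₁ ℓ₂) {n : ℕ} (n>0 : n ℕ.> 0)
  (enumeration : Field.HasOrder F (suc n)) where

  module F = HeytingField F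
  open F using (Carrier; _≈_)
  module R = CommutativeRing (HeytingCommutativeRing.commutativeRing F.heytingCommutativeRing)
  open Inverse enumeration using (to; from; to-cong; from-cong; strictlyInverseˡ; strictlyInverseʳ)

  to-injective : ∀ {x y} → to x ≡ to y → x ≈ y
  to-injective {x} {y} eq = R.trans (R.sym (strictlyInverseʳ x)) (R.trans (from-cong eq) (strictlyInverseʳ y))

  from-injective : ∀ {x y} → from x ≈ from y → x ≡ y
  from-injective {x} {y} eq = trans (sym (strictlyInverseˡ x)) (trans (to-cong eq) (strictlyInverseˡ y))

  rawRing : RawRing _ _
  rawRing = record
    { Carrier = Fin (suc n)
    ; _≈_     = _≡_
    ; _+_     = λ x y → to (from x F.+ from y)
    ; _*_     = λ x y → to (from x F.* from y)
    ; -_      = λ x → to (F.- from x)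
    ; 0#      = to F.0#
    ; 1#      = to F.1#
    }

  from-isRingMonomorphism : IsRingMonomorphism rawRing R.rawRing from
  from-isRingMonomorphism = record
    { isRingHomomorphism = record
      { isSemiringHomomorphism = record
        { isNearSemiringHomomorphism = record
          { +-isMonoidHomomorphism = record
            { isMagmaHomomorphism = record
              { isRelHomomorphism = record { cong = from-cong }
              ; homo              = λ x y → strictlyInverseʳ _
              }
            ; ε-homo = strictlyInverseʳ _
            }
          ; *-homo = λ x y → strictlyInverseʳ _
          }
        ; 1#-homo = strictlyInverseʳ _
        }
      ; -‿homo = λ x → strictlyInverseʳ _
      }
    ; injective = from-injective
    }

  1≉0 : ¬ F.1# ≈ F.0#
  1≉0 1≈0 = two-elements n>0 0≡_
    where
    0≡_ : ∀ (x : Fin (suc n)) → to F.0# ≡ x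
    0≡ x = from-injective (R.trans (strictlyInverseʳ _) (R.sym (R.trans (R.sym (R.*-identityʳ _))
      (R.trans (R.*-congˡ 1≈0) (R.zeroʳ _)))))
    two-elements : ∀ {n} {z : Fin (suc n)} → n ℕ.> 0 → ¬ (∀ x → z ≡ x)
    two-elements {suc n} {z} _ all = contradiction (trans (sym (all zero)) (all (suc zero))) λ ()

  x#0⇒inverse : ∀ {x} (x#0 : x F.# F.0#) → x F.* proj₁ (F.#⇒invertible x#0) ≈ F.1#
  x#0⇒inverse {x} x#0 = R.trans (R.*-congʳ x≈x-0) (proj₂ (proj₂ (F.#⇒invertible x#0)))
    where
    open import Algebra.Properties.Group R.+-group using (ε⁻¹≈ε)
    x≈x-0 : x ≈ x F.+ F.- F.0#
    x≈x-0 = R.sym (R.trans (R.+-congˡ ε⁻¹≈ε) (R.+-identityʳ x))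

  inverse⇒x#0 : ∀ {x y} → x F.* y ≈ F.1# → x F.# F.0#
  inverse⇒x#0 {x} {y} xy≈1 = F.invertible⇒# (y , R.trans (R.*-comm _ _) inverseʳ , inverseʳ)
    where
    open import Algebra.Properties.Group R.+-group using (ε⁻¹≈ε)
    inverseʳ : (x F.+ F.- F.0#) F.* y ≈ F.1#
    inverseʳ = R.trans (R.*-congʳ (R.trans (R.+-congˡ ε⁻¹≈ε) (R.+-identityʳ x))) xy≈1

  field-on-Fin : DiscreteField (Fin (suc n))
  field-on-Fin = record
    { isCommutativeRing = RingMonomorphism.isCommutativeRing from-isRingMonomorphism R.isCommutativeRing
    ; _≟_               = Fin._≟_
    ; 1≢0               = 1≉0 ∘ to-injective
    -- From x ≢ 0 tightness yields only that x is not unable to be apart from 0. A finite search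
    -- makes the existence of an inverse decidable, hence stable under double negation.
    ; inverse           = λ {x} x≢0 → decidable-stable (Fin.any? λ y → to (from x F.* from y) Fin.≟ to F.1#) λ no-inverse →
        x≢0 (from-injective (R.trans (proj₁ (F.tight (from x) F.0#) λ x#0 →
          no-inverse (to (proj₁ (F.#⇒invertible x#0)) , to-cong
            (R.trans (R.*-congˡ (strictlyInverseʳ _)) (x#0⇒inverse x#0)))) (R.sym (strictlyInverseʳ _))))
    }

  open FiniteFieldProperties field-on-Fin hiding (F)
  open Field F using () renaming (_^_ to _^ᶠ_; sum to sumᶠ; _·_ to _·ᶠ_)

  to-+ : ∀ x y → to (x F.+ y) ≡ to x + to y
  to-+ x y = to-cong (R.sym (R.+-cong (strictlyInverseʳ x) (strictlyInverseʳ y)))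

  to-* : ∀ x y → to (x F.* y) ≡ to x * to y
  to-* x y = to-cong (R.sym (R.*-cong (strictlyInverseʳ x) (strictlyInverseʳ y)))

  to-^ : ∀ x j → to (x ^ᶠ j) ≡ to x ^ j
  to-^ x zero    = refl
  to-^ x (suc j) = trans (to-* x _) (cong (to x *_) (to-^ x j))

  to-· : ∀ j x → to (j ·ᶠ x) ≡ j · to x
  to-· zero    x = refl
  to-· (suc j) x = trans (to-+ x _) (cong (to x +_) (to-· j x))

  to-sum : ∀ {j} (t : Fin j → Carrier) → to (sumᶠ t) ≡ sum (to ∘ t)
  to-sum {zero}  t = refl
  to-sum {suc j} t = trans (to-+ (t zero) _) (cong (to (t zero) +_) (to-sum (t ∘ suc)))

-- Translation of the polynomial and of the conditions between the two carriers.

module Main {c₀ ℓ₁ ℓ₂} (F : HeytingField c₀ ℓ₁ ℓ₂)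
  (p k ℓ : ℕ) (p-prime : Prime p) (k>0 : k ℕ.> 0)
  {n : ℕ} (1+n≡q² : suc n ≡ (p ℕ.^ k) ℕ.^ 2) (enumeration : Field.HasOrder F (suc n))
  (r : ℕ) (r>0 : r ℕ.> 0) (r≡ : r ≡ p ℕ.^ ℓ ℕ.+ 1 [mod p ℕ.^ k ℕ.+ 1 ])
  (a b c d : Field.Carrier F) (m : ℕ) .{{_ : NonZero m}} (m-largest : IsLargestPowerOfTwoDividing (gcd k ℓ) m) where

  open Field F

  private
    q = p ℕ.^ k
    Q = p ℕ.^ ℓ
    A = monomial a (Q ℕ.+ 1) +ᴾ monomial b Q +ᴾ monomial c 1 +ᴾ monomial d 0
    polynomial = (X^ r) *ᴾ (A ∘ᴾ (X^ (q ∸ 1)))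
    E = a ^ (q ℕ.+ 1) + b ^ (q ℕ.+ 1) + c ^ (q ℕ.+ 1) + d ^ (q ℕ.+ 1)
    b^+c^ = b ^ (q ℕ.+ 1) + c ^ (q ℕ.+ 1)

    instance
      p-nonTrivial : ℕ.NonTrivial p
      p-nonTrivial = prime⇒nonTrivial p-prime
      p-nonZero : NonZero p
      p-nonZero = prime⇒nonZero p-prime

    q>1 : 1 ℕ.< q
    q>1 = ℕ.^-monoʳ-< p (ℕ.nonTrivial⇒n>1 p) k>0

    q-1>0 : q ∸ 1 ℕ.> 0
    q-1>0 = ℕ.m<n⇒0<n∸m q>1

    1+[q-1]≡q : suc (q ∸ 1) ≡ q
    1+[q-1]≡q = ℕ.m+[n∸m]≡n (ℕ.<⇒≤ q>1)

    n≡ : n ≡ (suc (q ∸ 1) ℕ.+ 1) ℕ.* (q ∸ 1)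
    n≡ = ℕ.suc-injective (trans 1+n≡q² (trans (cong (ℕ._^ 2) (sym 1+[q-1]≡q)) (expand (q ∸ 1))))
      where
      open import Data.Nat.Tactic.RingSolver using (solve-∀)
      expand : ∀ j → suc j ℕ.* (suc j ℕ.* 1) ≡ suc ((suc j ℕ.+ 1) ℕ.* j)
      expand = solve-∀

    n>0 : n ℕ.> 0
    n>0 = subst (ℕ._> 0) (sym n≡) (ℕ.*-mono-< (s≤s (z≤n {q ∸ 1 ℕ.+ 1})) q-1>0)

  open Transfer F n>0 enumeration
  open Inverse enumeration using (to; from; strictlyInverseˡ; to-cong)

  private
    module K = FiniteFieldProperties field-on-Fin
    a′ = to a
    b′ = to b
    c′ = to c
    d′ = to d

    A′ : K.F → K.F
    A′ y = a′ K.* y K.^ (Q ℕ.+ 1) K.+ b′ K.* y K.^ Q K.+ c′ K.* y K.+ d′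

    f : K.F → K.F
    f x = x K.^ r K.* A′ (x K.^ (q ∸ 1))

    f-injective : Set
    f-injective = ∀ {x y} → f x ≡ f y → x ≡ y

    to-eval : ∀ x → to (eval polynomial x) ≡ f (to x)
    to-eval x = begin
      to (eval polynomial x)
        ≡⟨ to-cong (PolynomialEvaluation.eval-quadrinomial
            (HeytingCommutativeRing.commutativeRing (HeytingField.heytingCommutativeRing F)) a b c d Q r (q ∸ 1) x) ⟩
      to (x ^ r * (a * y ^ (Q ℕ.+ 1) + b * y ^ Q + c * y + d))
        ≡⟨ trans (to-* _ _) (cong₂ K._*_ (to-^ x r) (begin
             to (a * y ^ (Q ℕ.+ 1) + b * y ^ Q + c * y + d)
               ≡⟨ trans (to-+ _ _) (cong (K._+ d′) (trans (to-+ _ _) (cong₂ K._+_ (trans (to-+ _ _)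
                    (cong₂ K._+_ (trans (to-* _ _) (cong (a′ K.*_) (to-^ y (Q ℕ.+ 1))))
                                 (trans (to-* _ _) (cong (b′ K.*_) (to-^ y Q))))) (to-* _ _)))) ⟩
             A′ (to y)
               ≡⟨ cong A′ (to-^ x (q ∸ 1)) ⟩
             A′ (to x K.^ (q ∸ 1)) ∎)) ⟩
      f (to x)  ∎
      where
      open ≡-Reasoning
      y = x ^ (q ∸ 1)

    permutes⇒injective : Permutes polynomial → f-injective
    permutes⇒injective (eval-injective , _) {x} {y} fx≡fy = from-injective (eval-injective (to-injective (begin
      to (eval polynomial (from x))  ≡⟨ to-eval (from x) ⟩
      f (to (from x))  ≡⟨ cong f (strictlyInverseˡ x) ⟩
      f x  ≡⟨ fx≡fy ⟩
      f y  ≡⟨ cong f (strictlyInverseˡ y) ⟨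
      f (to (from y))  ≡⟨ to-eval (from y) ⟨
      to (eval polynomial (from y))  ∎)))
      where open ≡-Reasoning

    injective⇒permutes : f-injective → Permutes polynomial
    injective⇒permutes injective =
      (λ {x} {y} eq → to-injective (injective (trans (sym (to-eval x)) (trans (to-cong eq) (to-eval y))))) ,
      λ y → from (preimage y) , λ {z} z≈ → to-injective (begin
        to (eval polynomial z)   ≡⟨ to-eval z ⟩
        f (to z)  ≡⟨ cong f (trans (to-cong z≈) (strictlyInverseˡ _)) ⟩
        f (preimage y)  ≡⟨ proj₂ (K.injective⇒surjective f injective (to y)) ⟩
        to y  ∎)
      where
      open ≡-Reasoning
      preimage : Carrier → K.F
      preimage y = proj₁ (K.injective⇒surjective f injective (to y))

    injective⇒gcd≡1 : f-injective → gcd r (q ∸ 1) ≡ 1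
    injective⇒gcd≡1 injective = NecessaryCoprimality.injective⇒coprime field-on-Fin {r} {q ∸ 1} A′ n>0 q-1>0
      (ℕ.divides (suc (q ∸ 1) ℕ.+ 1) n≡) injective

    Conditions : Set _
    Conditions = gcd r (q ∸ 1) ≡ 1
      × p ≡ 2
      × (Σ[ e#0 ∈ E # 0# ]
          ( (a * b ^ q + c * d ^ q) ^ Q ≈ E ^ (Q ∸ 1) * (a * c ^ q + b * d ^ q)
          × Tr 2 k m (b^+c^ ÷ E [ e#0 ]) ≈ (lcm k ℓ / m) · 1# ) )

    module Even (p≡2 : p ≡ 2) (gcd≡1 : gcd r (q ∸ 1) ≡ 1) where

      private
        q≡2^k : q ≡ 2 ℕ.^ k
        q≡2^k = cong (ℕ._^ k) p≡2

        Q≡2^ℓ : Q ≡ 2 ℕ.^ ℓ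
        Q≡2^ℓ = cong (ℕ._^ ℓ) p≡2

        order : suc n ≡ 2 ℕ.^ (k ℕ.+ k)
        order = trans 1+n≡q² (trans (cong₂ ℕ._*_ q≡2^k (trans (ℕ.*-identityʳ q) q≡2^k)) (sym (ℕ.^-distribˡ-+-* 2 k k)))

        module C = CharacteristicTwo field-on-Fin k k>0 order ℓ a′ b′ c′ d′ m m-largest r r>0
          (subst₂ (λ s t → r ≡ s ℕ.+ 1 [mod t ℕ.+ 1 ]) Q≡2^ℓ (trans (sym 1+[q-1]≡q) (cong (λ t → suc (t ∸ 1)) q≡2^k)) r≡)
          (trans (cong (λ t → gcd r (t ∸ 1)) (sym q≡2^k)) gcd≡1)
        open Criterion field-on-Fin k k>0 order ℓ a′ b′ c′ d′ using (N; bar; σ; e; P; R; β)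
        open ≡-Reasoning

        norm : ∀ x → to (x ^ (q ℕ.+ 1)) ≡ N (to x)
        norm x = begin
          to (x ^ (q ℕ.+ 1))  ≡⟨ to-^ x (q ℕ.+ 1) ⟩
          to x K.^ (q ℕ.+ 1)  ≡⟨ cong (λ t → to x K.^ (t ℕ.+ 1)) q≡2^k ⟩
          to x K.^ (2 ℕ.^ k ℕ.+ 1)        ≡⟨ K.^-homo-* (to x) (2 ℕ.^ k) 1 ⟩
          bar (to x) K.* to x K.^ 1       ≡⟨ cong (bar (to x) K.*_) (K.*-identityʳ _) ⟩
          bar (to x) K.* to x  ≡⟨ K.*-comm _ _ ⟩
          N (to x)  ∎

        to-E : to E ≡ e
        to-E = begin
          to E  ≡⟨ trans (to-+ _ _) (cong₂ K._+_ (trans (to-+ _ _)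
                                                           (cong₂ K._+_ (trans (to-+ _ _) (cong₂ K._+_ (norm a) (norm b))) (norm c))) (norm d)) ⟩
          N a′ K.+ N b′ K.+ N c′ K.+ N d′  ≡⟨ cong (K._+ N d′) (K.+-assoc _ _ _) ⟩
          N a′ K.+ (N b′ K.+ N c′) K.+ N d′  ≡⟨ K.+-assoc _ _ _ ⟩
          N a′ K.+ (N b′ K.+ N c′ K.+ N d′)  ≡⟨ cong (N a′ K.+_) (K.+-comm _ _) ⟩
          N a′ K.+ (N d′ K.+ (N b′ K.+ N c′))  ≡⟨ K.+-assoc _ _ _ ⟨
          e  ∎

        to-pair : ∀ x y z w → to (x * y ^ q + z * w ^ q) ≡ to x K.* bar (to y) K.+ to z K.* bar (to w)
        to-pair x y z w = trans (to-+ _ _) (cong₂ K._+_ (to-x*y^q x y) (to-x*y^q z w))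
          where
          to-x*y^q : ∀ x y → to (x * y ^ q) ≡ to x K.* bar (to y)
          to-x*y^q x y = trans (to-* _ _) (cong (to x K.*_) (trans (to-^ y q) (cong (to y K.^_) q≡2^k)))

        to-lhs : to ((a * b ^ q + c * d ^ q) ^ Q) ≡ σ P
        to-lhs = trans (to-^ _ Q) (cong₂ K._^_ (to-pair a b c d) Q≡2^ℓ)

        to-rhs : to (E ^ (Q ∸ 1) * (a * c ^ q + b * d ^ q)) ≡ e K.^ (2 ℕ.^ ℓ ∸ 1) K.* R
        to-rhs = trans (to-* _ _) (cong₂ K._*_
          (trans (to-^ E (Q ∸ 1)) (cong₂ K._^_ to-E (cong (_∸ 1) Q≡2^ℓ))) (to-pair a c b d))

        quotient : ∀ e#0 → e K.* to (b^+c^ ÷ E [ e#0 ]) ≡ β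
        quotient e#0 = begin
          e K.* to (b^+c^ * E⁻¹)  ≡⟨ cong (K._* to (b^+c^ * E⁻¹)) to-E ⟨
          to E K.* to (b^+c^ * E⁻¹)  ≡⟨ cong (to E K.*_) (trans (to-* _ _) (K.*-comm _ _)) ⟩
          to E K.* (to E⁻¹ K.* to b^+c^)      ≡⟨ K.*-assoc _ _ _ ⟨
          to E K.* to E⁻¹ K.* to b^+c^        ≡⟨ cong (K._* to b^+c^) (trans (sym (to-* _ _)) (to-cong (x#0⇒inverse e#0))) ⟩
          K.1# K.* to b^+c^  ≡⟨ K.*-identityˡ _ ⟩
          to b^+c^  ≡⟨ trans (to-+ _ _) (cong₂ K._+_ (norm b) (norm c)) ⟩
          β  ∎
          where E⁻¹ = proj₁ (#⇒invertible e#0)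

        to-Tr : ∀ x → to (Tr 2 k m x) ≡ K.sum {k / m} (λ i → to x K.^ (2 ℕ.^ (m ℕ.* toℕ i)))
        to-Tr x = trans (to-sum {k / m} _) (K.sum-cong-≗ {k / m} λ i → to-^ x (2 ℕ.^ (m ℕ.* toℕ i)))

        f≡f : ∀ x → f x ≡ C.f x
        f≡f x = cong₂ (λ s t → x K.^ r K.* (a′ K.* (x K.^ (t ∸ 1)) K.^ (s ℕ.+ 1) K.+ b′ K.* (x K.^ (t ∸ 1)) K.^ s
          K.+ c′ K.* x K.^ (t ∸ 1) K.+ d′)) Q≡2^ℓ q≡2^k

      conditions : f-injective → Conditions
      conditions f-inj = gcd≡1 , p≡2 , e#0 ,
        to-injective (trans to-lhs (trans σP≡ (sym to-rhs))) ,
        to-injective (trans (to-Tr _) (trans (trace _ (quotient e#0)) (sym (to-· (lcm k ℓ / m) 1#))))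
        where
        all = C.injective⇒conditions λ eq → f-inj (trans (f≡f _) (trans eq (sym (f≡f _))))
        e≢0 = proj₁ all
        σP≡ = proj₁ (proj₂ all)
        trace = proj₂ (proj₂ all)
        e#0 : E # 0#
        e#0 = inverse⇒x#0 {y = from (proj₁ (K.inverse e≢0))} (to-injective (begin
          to (E * from (proj₁ (K.inverse e≢0)))    ≡⟨ trans (to-* _ _) (cong₂ K._*_ to-E (strictlyInverseˡ _)) ⟩
          e K.* proj₁ (K.inverse e≢0)  ≡⟨ proj₂ (K.inverse e≢0) ⟩
          K.1#  ∎))

      injective : (e#0 : E # 0#) →
        (a * b ^ q + c * d ^ q) ^ Q ≈ E ^ (Q ∸ 1) * (a * c ^ q + b * d ^ q) →
        Tr 2 k m (b^+c^ ÷ E [ e#0 ]) ≈ (lcm k ℓ / m) · 1# → f-injective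
      injective e#0 eq₄ eq₅ eq = C.conditions⇒injective e≢0
        (trans (sym to-lhs) (trans (to-cong eq₄) to-rhs)) _ (quotient e#0)
        (trans (sym (to-Tr _)) (trans (to-cong eq₅) (to-· (lcm k ℓ / m) 1#))) (trans (sym (f≡f _)) (trans eq (f≡f _)))
        where
        e≢0 : e ≢ K.0#
        e≢0 e≡0 = K.1≢0 (begin
          K.1#  ≡⟨ to-cong (x#0⇒inverse e#0) ⟨
          to (E * E⁻¹)  ≡⟨ to-* _ _ ⟩
          to E K.* to E⁻¹  ≡⟨ cong (K._* to E⁻¹) (trans to-E e≡0) ⟩
          K.0# K.* to E⁻¹  ≡⟨ K.zeroˡ _ ⟩
          K.0#  ∎)
          where E⁻¹ = proj₁ (#⇒invertible e#0)

  theorem : Permutes polynomial ⇔ Conditions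
  theorem = mk⇔ forward backward
    where
    forward : Permutes polynomial → Conditions
    -- Coprimality has to come first: it forces p = 2, and only then does the theory in
    -- characteristic 2 apply.
    forward perm = Even.conditions (coprime⇒p≡2 p-prime k ℓ {r} r≡ gcd≡1) gcd≡1 injective
      where
      injective : f-injective
      injective = permutes⇒injective perm
      gcd≡1 = injective⇒gcd≡1 injective
    backward : Conditions → Permutes polynomial
    backward (gcd≡1 , p≡2 , e#0 , eq₄ , eq₅) = injective⇒permutes (Even.injective p≡2 gcd≡1 e#0 eq₄ eq₅)

theorem1p1 :
  ∀ {c₀ ℓ₁ ℓ₂} (F : HeytingField c₀ ℓ₁ ℓ₂) (p k ℓ : ℕ) →
  let open Field F
      q = p ℕ.^ k
      Q = p ℕ.^ ℓ
  in
  Prime p → k ℕ.> 0 → ℓ ℕ.> 0 →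
  HasOrder (q ℕ.^ 2) →
  (r : ℕ) → r ℕ.> 0 → r ≡ Q ℕ.+ 1 [mod q ℕ.+ 1 ] →
  (a b c d : Carrier) →
  (m : ℕ) .{{_ : NonZero m}} → IsLargestPowerOfTwoDividing (gcd k ℓ) m →
  let A = monomial a (Q ℕ.+ 1) +ᴾ monomial b Q +ᴾ monomial c 1 +ᴾ monomial d 0
      e = a ^ (q ℕ.+ 1) + b ^ (q ℕ.+ 1) + c ^ (q ℕ.+ 1) + d ^ (q ℕ.+ 1)
  in
  Permutes ((X^ r) *ᴾ (A ∘ᴾ (X^ (q ∸ 1))))
  ⇔
  ( gcd r (q ∸ 1) ≡ 1
  × p ≡ 2
  × (Σ[ e#0 ∈ e # 0# ]
      ( (a * b ^ q + c * d ^ q) ^ Q ≈ e ^ (Q ∸ 1) * (a * c ^ q + b * d ^ q)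
      × Tr 2 k m ((b ^ (q ℕ.+ 1) + c ^ (q ℕ.+ 1)) ÷ e [ e#0 ]) ≈ (lcm k ℓ ℕ./ m) · 1# ) ) )
theorem1p1 F p k ℓ p-prime k>0 _ enumeration r r>0 r≡ a b c d m m-largest =
  Main.theorem F p k ℓ p-prime k>0 order
    (subst (Field.HasOrder F) (sym order) enumeration) r r>0 r≡ a b c d m m-largest
  where
  -- The finite field theory lives on `Fin (suc n)`, with n = q² - 1 the number of units, so the
  -- order must be exhibited as a successor.
  order : suc (ℕ.pred ((p ℕ.^ k) ℕ.^ 2)) ≡ (p ℕ.^ k) ℕ.^ 2
  order = ℕ.suc-pred _ {{ℕ.m^n≢0 _ 2 {{ℕ.m^n≢0 p k {{prime⇒nonZero p-prime}}}}}}
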